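{- Let $k\ge 6$ be an integer and let $m=3k+2$. Let $G$ be a connected $\{\theta(1,2,2),\theta(1,2,3)\}$-free graph of size $m$ with no pendant vertices. Then $q(G)\le q'(m)$, where $q'(m)$ is the largest root of $$x^4-\tfrac23(m+10)x^3+\tfrac23(7m+16)x^2-(10m-7)x+\tfrac43(5m-16)=0.$$ Moreover, equality $q(G)=q'(m)$ holds if and only if $G\cong H^{(5)}_{\frac{2m-7}{3}}$.
   Context: All graphs are finite, simple, undirected and connected. The size of a graph is its number of edges. A pendant vertex is a vertex of degree $1$. A graph is $\mathcal F$-free if it contains no member of the family $\mathcal F$ as a (not necessarily induced) subgraph. $q(G)$ denotes the signless Laplacian spectral radius of $G$, i.e. the largest eigenvalue of $Q(G)=D(G)+A(G)$, where $A(G)$ is the adjacency matrix and $D(G)$ the diagonal matrix of vertex degrees. The theta graph $\theta(l_1,\dots,l_k)$ consists of $k\ge 3$ internally disjoint paths of lengths (numbers of edges) $l_1,\dots,l_k$, all joining the same two distinct end vertices. For odd $p\ge5$, the friendship graph $F_p$ of order $p$ consists of $\frac{p-1}{2}$ triangles having precisely one vertex (the central vertex) common to all of them. For odd $p\ge 5$ and $r\ge 4$, the graph $H_p^{(r)}$, of order $p+r-1$, is obtained from $F_p$ by identifying the central vertex of $F_p$ with a vertex of the cycle $C_r$ on $r$ vertices. -}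

module Defs where

open import Algebra.Bundles.Raw using (RawRing)
import Algebra.Definitions.RawSemiring as RawSemiringDefs
open import Data.Bool.Base using (if_then_else_)
open import Data.Fin.Base using (Fin; toℕ)
open import Data.Fin.Patterns using (0F; 1F)
import Data.Fin.Properties as Fin
import Data.Integer.Base as ℤ
open import Data.List.Base using (List; length; lookup)
open import Data.List.Relation.Unary.All using (All)
open import Data.Nat.Base using (ℕ; suc; _∸_; _/_)
import Data.Nat.Base as ℕ
import Data.Nat.Properties as ℕ
open import Data.Product.Base using (∃; _×_; _,_)
open import Data.Rational.Base as ℚ using (ℚ; 0ℚ; 1ℚ; ½)
import Data.Rational.Properties as ℚ
open import Data.Rational.Solver using (module +-*-Solver)
open import Data.Vec.Functional using (Vector)
open import Function.Bundles using (_↔_; _⇔_; Inverse)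
open import Function.Definitions using (Injective)
open import Level using (0ℓ)
open import Relation.Binary.Core using (Rel)
open import Relation.Binary.Definitions using (Symmetric; Irreflexive; Decidable)
open import Relation.Binary.Construct.Closure.ReflexiveTransitive using (Star)
open import Relation.Binary.Construct.Closure.Symmetric as SymClosure using (SymClosure; fwd; bwd)
open import Relation.Binary.PropositionalEquality using (_≡_; refl; sym; cong; subst; module ≡-Reasoning)
open import Relation.Nullary using (¬_; does)

open import Algebra.Properties.CommutativeMonoid.Sum ℕ.+-0-commutativeMonoid
  using () renaming (sum to sumℕ)

-- Real numbers: Cauchy sequences of rationals, with equality and order
-- given by the limits.

module Real where

  Eventually : (ℕ → Set) → Set
  Eventually P = ∃ λ N → ∀ n → N ℕ.≤ n → P n

  IsCauchy : (ℕ → ℚ) → Set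
  IsCauchy a = ∀ ε → 0ℚ ℚ.< ε →
    ∃ λ N → ∀ i j → N ℕ.≤ i → N ℕ.≤ j → ℚ.∣ a i ℚ.- a j ∣ ℚ.< ε

  record ℝ : Set where
    constructor mkℝ
    field
      seq    : ℕ → ℚ
      cauchy : IsCauchy seq

  open ℝ public

  infix 4 _≃_ _≤_

  _≃_ : Rel ℝ 0ℓ
  x ≃ y = ∀ ε → 0ℚ ℚ.< ε → Eventually λ n → ℚ.∣ seq x n ℚ.- seq y n ∣ ℚ.< ε

  _≤_ : Rel ℝ 0ℓ
  x ≤ y = ∀ ε → 0ℚ ℚ.< ε → Eventually λ n → seq x n ℚ.< seq y n ℚ.+ ε

  open +-*-Solver using (solve; _:=_; _:+_; _:*_; _:-_; :-_; con)

  half-pos : ∀ {ε} → 0ℚ ℚ.< ε → 0ℚ ℚ.< ε ℚ.* ½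
  half-pos {ε} 0<ε = ℚ.positive⁻¹ (ε ℚ.* ½)
    where instance
      _ = ℚ.positive 0<ε
      _ = ℚ.pos*pos⇒pos ε ½

  half+half : ∀ ε → ε ℚ.* ½ ℚ.+ ε ℚ.* ½ ≡ ε
  half+half = solve 1 (λ e → e :* con ½ :+ e :* con ½ := e) refl

  bounded : ∀ {a} → IsCauchy a →
    ∃ λ K → 0ℚ ℚ.< K × Eventually λ n → ℚ.∣ a n ∣ ℚ.≤ K
  bounded {a} ca with ca 1ℚ (ℚ.positive⁻¹ 1ℚ)
  ... | N , close = 1ℚ ℚ.+ ℚ.∣ a N ∣
      , ℚ.+-mono-<-≤ (ℚ.positive⁻¹ 1ℚ) (ℚ.0≤∣p∣ (a N))
      , N , λ n N≤n → begin
          ℚ.∣ a n ∣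
            ≡⟨ cong ℚ.∣_∣ (split (a n) (a N)) ⟩
          ℚ.∣ (a n ℚ.- a N) ℚ.+ a N ∣
            ≤⟨ ℚ.∣p+q∣≤∣p∣+∣q∣ (a n ℚ.- a N) (a N) ⟩
          ℚ.∣ a n ℚ.- a N ∣ ℚ.+ ℚ.∣ a N ∣
            ≤⟨ ℚ.+-monoˡ-≤ ℚ.∣ a N ∣ (ℚ.<⇒≤ (close n N N≤n ℕ.≤-refl)) ⟩
          1ℚ ℚ.+ ℚ.∣ a N ∣ ∎
    where
    open ℚ.≤-Reasoning
    split : ∀ x y → x ≡ (x ℚ.- y) ℚ.+ y
    split = solve 2 (λ x y → x := (x :- y) :+ y) refl

  +-cauchy : ∀ {a b} → IsCauchy a → IsCauchy b → IsCauchy λ n → a n ℚ.+ b n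
  +-cauchy {a} {b} ca cb ε 0<ε
    with ca (ε ℚ.* ½) (half-pos 0<ε) | cb (ε ℚ.* ½) (half-pos 0<ε)
  ... | M , closeA | N , closeB = M ℕ.⊔ N , λ i j ≤i ≤j → begin-strict
      ℚ.∣ (a i ℚ.+ b i) ℚ.- (a j ℚ.+ b j) ∣
        ≡⟨ cong ℚ.∣_∣ (regroup (a i) (b i) (a j) (b j)) ⟩
      ℚ.∣ (a i ℚ.- a j) ℚ.+ (b i ℚ.- b j) ∣
        ≤⟨ ℚ.∣p+q∣≤∣p∣+∣q∣ (a i ℚ.- a j) (b i ℚ.- b j) ⟩
      ℚ.∣ a i ℚ.- a j ∣ ℚ.+ ℚ.∣ b i ℚ.- b j ∣
        <⟨ ℚ.+-mono-<
             (closeA i j (ℕ.m⊔n≤o⇒m≤o M N ≤i) (ℕ.m⊔n≤o⇒m≤o M N ≤j))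
             (closeB i j (ℕ.m⊔n≤o⇒n≤o M N ≤i) (ℕ.m⊔n≤o⇒n≤o M N ≤j)) ⟩
      ε ℚ.* ½ ℚ.+ ε ℚ.* ½
        ≡⟨ half+half ε ⟩
      ε ∎
    where
    open ℚ.≤-Reasoning
    regroup : ∀ x y z w → (x ℚ.+ y) ℚ.- (z ℚ.+ w) ≡ (x ℚ.- z) ℚ.+ (y ℚ.- w)
    regroup = solve 4 (λ x y z w →
      (x :+ y) :- (z :+ w) := (x :- z) :+ (y :- w)) refl

  neg-cauchy : ∀ {a} → IsCauchy a → IsCauchy λ n → ℚ.- a n
  neg-cauchy {a} ca ε 0<ε with ca ε 0<ε
  ... | N , close = N , λ i j ≤i ≤j → begin-strict
      ℚ.∣ (ℚ.- a i) ℚ.- (ℚ.- a j) ∣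
        ≡⟨ cong ℚ.∣_∣ (swap (a i) (a j)) ⟩
      ℚ.∣ a j ℚ.- a i ∣
        <⟨ close j i ≤j ≤i ⟩
      ε ∎
    where
    open ℚ.≤-Reasoning
    swap : ∀ x y → (ℚ.- x) ℚ.- (ℚ.- y) ≡ y ℚ.- x
    swap = solve 2 (λ x y → (:- x) :- (:- y) := y :- x) refl

  shrink : ∀ C ε → 0ℚ ℚ.< C → 0ℚ ℚ.< ε → ∃ λ δ → 0ℚ ℚ.< δ × C ℚ.* δ ≡ ε
  shrink C ε 0<C 0<ε = 1/C ℚ.* ε
    , ℚ.positive⁻¹ (1/C ℚ.* ε) {{ℚ.pos*pos⇒pos 1/C {{ℚ.1/pos⇒pos C}} ε {{ℚ.positive 0<ε}}}}
    , (begin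
        C ℚ.* (1/C ℚ.* ε)   ≡⟨ ℚ.*-assoc C 1/C ε ⟨
        (C ℚ.* 1/C) ℚ.* ε   ≡⟨ cong (ℚ._* ε) (ℚ.*-inverseʳ C) ⟩
        1ℚ ℚ.* ε            ≡⟨ ℚ.*-identityˡ ε ⟩
        ε                   ∎)
    where
    open ≡-Reasoning
    instance
      C-pos : ℚ.Positive C
      C-pos = ℚ.positive 0<C
      C-nonZero : ℚ.NonZero C
      C-nonZero = ℚ.pos⇒nonZero C
    1/C : ℚ
    1/C = ℚ.1/ C

  ∣*∣-< : ∀ {C δ} x y → 0ℚ ℚ.< C →
    ℚ.∣ x ∣ ℚ.≤ C → ℚ.∣ y ∣ ℚ.< δ → ℚ.∣ x ℚ.* y ∣ ℚ.< C ℚ.* δ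
  ∣*∣-< {C} {δ} x y 0<C x≤C y<δ = begin-strict
    ℚ.∣ x ℚ.* y ∣         ≡⟨ ℚ.∣p*q∣≡∣p∣*∣q∣ x y ⟩
    ℚ.∣ x ∣ ℚ.* ℚ.∣ y ∣   ≤⟨ ℚ.*-monoʳ-≤-nonNeg ℚ.∣ y ∣ {{ℚ.nonNegative (ℚ.0≤∣p∣ y)}} x≤C ⟩
    C ℚ.* ℚ.∣ y ∣         <⟨ ℚ.*-monoʳ-<-pos C {{ℚ.positive 0<C}} y<δ ⟩
    C ℚ.* δ               ∎
    where open ℚ.≤-Reasoning

  ∣*-*∣-< : ∀ {K L δ} x y z w → 0ℚ ℚ.< K → 0ℚ ℚ.< L →
    ℚ.∣ x ∣ ℚ.≤ K → ℚ.∣ w ∣ ℚ.≤ L → ℚ.∣ x ℚ.- z ∣ ℚ.< δ → ℚ.∣ y ℚ.- w ∣ ℚ.< δ →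
    ℚ.∣ x ℚ.* y ℚ.- z ℚ.* w ∣ ℚ.< (K ℚ.+ L) ℚ.* δ
  ∣*-*∣-< {K} {L} {δ} x y z w 0<K 0<L x≤K w≤L x-z<δ y-w<δ = begin-strict
    ℚ.∣ x ℚ.* y ℚ.- z ℚ.* w ∣
      ≡⟨ cong ℚ.∣_∣ (split x y z w) ⟩
    ℚ.∣ x ℚ.* (y ℚ.- w) ℚ.+ w ℚ.* (x ℚ.- z) ∣
      ≤⟨ ℚ.∣p+q∣≤∣p∣+∣q∣ (x ℚ.* (y ℚ.- w)) (w ℚ.* (x ℚ.- z)) ⟩
    ℚ.∣ x ℚ.* (y ℚ.- w) ∣ ℚ.+ ℚ.∣ w ℚ.* (x ℚ.- z) ∣
      <⟨ ℚ.+-mono-< (∣*∣-< x (y ℚ.- w) 0<K x≤K y-w<δ) (∣*∣-< w (x ℚ.- z) 0<L w≤L x-z<δ) ⟩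
    K ℚ.* δ ℚ.+ L ℚ.* δ
      ≡⟨ ℚ.*-distribʳ-+ δ K L ⟨
    (K ℚ.+ L) ℚ.* δ ∎
    where
    open ℚ.≤-Reasoning
    split : ∀ x y z w → x ℚ.* y ℚ.- z ℚ.* w ≡ x ℚ.* (y ℚ.- w) ℚ.+ w ℚ.* (x ℚ.- z)
    split = solve 4 (λ x y z w →
      x :* y :- z :* w := x :* (y :- w) :+ w :* (x :- z)) refl

  *-cauchy : ∀ {a b} → IsCauchy a → IsCauchy b → IsCauchy λ n → a n ℚ.* b n
  *-cauchy {a} {b} ca cb ε 0<ε =
    let K , 0<K , M , a≤K = bounded ca
        L , 0<L , N , b≤L = bounded cb
        δ , 0<δ , total   = shrink (K ℚ.+ L) ε (ℚ.+-mono-< 0<K 0<L) 0<ε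
        M′ , closeA       = ca δ 0<δ
        N′ , closeB       = cb δ 0<δ
    in (M ℕ.⊔ N) ℕ.⊔ (M′ ℕ.⊔ N′) , λ i j ≤i ≤j →
      let ≤i′ = ℕ.m⊔n≤o⇒n≤o (M ℕ.⊔ N) (M′ ℕ.⊔ N′) ≤i
          ≤j′ = ℕ.m⊔n≤o⇒n≤o (M ℕ.⊔ N) (M′ ℕ.⊔ N′) ≤j
      in subst (ℚ.∣ a i ℚ.* b i ℚ.- a j ℚ.* b j ∣ ℚ.<_) total
        (∣*-*∣-< (a i) (b i) (a j) (b j) 0<K 0<L
          (a≤K i (ℕ.m⊔n≤o⇒m≤o M N (ℕ.m⊔n≤o⇒m≤o (M ℕ.⊔ N) (M′ ℕ.⊔ N′) ≤i)))
          (b≤L j (ℕ.m⊔n≤o⇒n≤o M N (ℕ.m⊔n≤o⇒m≤o (M ℕ.⊔ N) (M′ ℕ.⊔ N′) ≤j)))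
          (closeA i j (ℕ.m⊔n≤o⇒m≤o M′ N′ ≤i′) (ℕ.m⊔n≤o⇒m≤o M′ N′ ≤j′))
          (closeB i j (ℕ.m⊔n≤o⇒n≤o M′ N′ ≤i′) (ℕ.m⊔n≤o⇒n≤o M′ N′ ≤j′)))

  fromℚ : ℚ → ℝ
  fromℚ p = mkℝ (λ _ → p) λ ε 0<ε → 0 , λ _ _ _ _ → begin-strict
      ℚ.∣ p ℚ.- p ∣ ≡⟨ cong ℚ.∣_∣ (ℚ.+-inverseʳ p) ⟩
      0ℚ            <⟨ 0<ε ⟩
      ε             ∎
    where open ℚ.≤-Reasoning

  fromℕ : ℕ → ℝ
  fromℕ n = fromℚ (ℤ.+ n ℚ./ 1)

  infixl 7 _*_
  infixl 6 _+_ _-_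
  infix  8 -_

  _+_ _*_ : ℝ → ℝ → ℝ
  x + y = mkℝ (λ n → seq x n ℚ.+ seq y n) (+-cauchy {seq x} {seq y} (cauchy x) (cauchy y))
  x * y = mkℝ (λ n → seq x n ℚ.* seq y n) (*-cauchy {seq x} {seq y} (cauchy x) (cauchy y))

  -_ : ℝ → ℝ
  - x = mkℝ (λ n → ℚ.- seq x n) (neg-cauchy {seq x} (cauchy x))

  _-_ : ℝ → ℝ → ℝ
  x - y = x + (- y)

  0ℝ 1ℝ : ℝ
  0ℝ = fromℚ 0ℚ
  1ℝ = fromℚ 1ℚ

  ℝ-rawRing : RawRing 0ℓ 0ℓ
  ℝ-rawRing = record
    { Carrier = ℝ ; _≈_ = _≃_
    ; _+_ = _+_ ; _*_ = _*_ ; -_ = -_ ; 0# = 0ℝ ; 1# = 1ℝ }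

  open RawSemiringDefs (RawRing.rawSemiring ℝ-rawRing) public using (sum; _^_)

  IsGreatest : (ℝ → Set) → ℝ → Set
  IsGreatest P x = P x × (∀ y → P y → y ≤ x)

  IsLargestRoot : (ℝ → ℝ) → ℝ → Set
  IsLargestRoot f = IsGreatest λ x → f x ≃ 0ℝ

  Matrix : ℕ → Set
  Matrix n = Fin n → Fin n → ℝ

  -- For the symmetric matrices below, real eigenvalues with real
  -- eigenvectors are all the eigenvalues.
  IsEigenvalue : ∀ {n} → Matrix n → ℝ → Set
  IsEigenvalue {n} M μ = ∃ λ (x : Vector ℝ n) →
    ¬ (∀ i → x i ≃ 0ℝ) × (∀ i → sum (λ j → M i j * x j) ≃ μ * x i)

  IsLargestEigenvalue : ∀ {n} → Matrix n → ℝ → Set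
  IsLargestEigenvalue M = IsGreatest (IsEigenvalue M)

open Real using (ℝ)

record Graph : Set₁ where
  field
    Vertex      : Set
    Adj         : Rel Vertex 0ℓ
    symmetric   : Symmetric Adj
    irreflexive : Irreflexive _≡_ Adj

record FiniteGraph : Set₁ where
  field
    order       : ℕ
    Adj         : Rel (Fin order) 0ℓ
    symmetric   : Symmetric Adj
    irreflexive : Irreflexive _≡_ Adj
    adj?        : Decidable Adj

  toGraph : Graph
  toGraph = record
    { Vertex = Fin order ; Adj = Adj ; symmetric = symmetric ; irreflexive = irreflexive }

  adjacency : Fin order → Fin order → ℕ
  adjacency u v = if does (adj? u v) then 1 else 0

  degree : Fin order → ℕ
  degree u = sumℕ λ v → adjacency u v

  -- Each edge is counted once, from its smaller endpoint.
  size : ℕ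
  size = sumℕ λ u → sumℕ λ v → if does (u Fin.<? v) then adjacency u v else 0

  Connected : Set
  Connected = ∀ u v → Star Adj u v

  Pendant : Fin order → Set
  Pendant u = degree u ≡ 1

  adjacencyMatrix degreeMatrix signlessLaplacian : Real.Matrix order
  adjacencyMatrix u v = Real.fromℕ (adjacency u v)
  degreeMatrix u v = if does (u Fin.≟ v) then Real.fromℕ (degree u) else Real.0ℝ
  signlessLaplacian u v = degreeMatrix u v Real.+ adjacencyMatrix u v

  -- The relation "q = q(G)".
  IsSignlessLaplacianSpectralRadius : ℝ → Set
  IsSignlessLaplacianSpectralRadius = Real.IsLargestEigenvalue signlessLaplacian

infix 4 _⊑_ _≅_

-- F is a (not necessarily induced) subgraph of G, up to isomorphism.
_⊑_ : Graph → Graph → Set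
F ⊑ G = ∃ λ (f : Graph.Vertex F → Graph.Vertex G) →
  Injective _≡_ _≡_ f × (∀ {u v} → Graph.Adj F u v → Graph.Adj G (f u) (f v))

_Free : List Graph → Graph → Set₁
(ℱ Free) G = All (λ F → ¬ F ⊑ G) ℱ

_≅_ : Graph → Graph → Set
G ≅ H = ∃ λ (f : Graph.Vertex G ↔ Graph.Vertex H) →
  ∀ u v → Graph.Adj G u v ⇔ Graph.Adj H (Inverse.to f u) (Inverse.to f v)

-- θ(l₁,…,lₖ). The i-th path runs from source to target through its
-- lᵢ ∸ 1 inner vertices; it is the single edge source–target if lᵢ ≡ 1.
data ThetaVertex (ls : List ℕ) : Set where
  source target : ThetaVertex ls
  inner : (i : Fin (length ls)) → Fin (lookup ls i ∸ 1) → ThetaVertex ls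

data ThetaLink (ls : List ℕ) : Rel (ThetaVertex ls) 0ℓ where
  direct : ∀ i → lookup ls i ≡ 1 → ThetaLink ls source target
  first  : ∀ i j → toℕ j ≡ 0 → ThetaLink ls source (inner i j)
  next   : ∀ i j j′ → toℕ j′ ≡ suc (toℕ j) → ThetaLink ls (inner i j) (inner i j′)
  last   : ∀ i j → suc (suc (toℕ j)) ≡ lookup ls i → ThetaLink ls (inner i j) target

θ : List ℕ → Graph
θ ls = record
  { Vertex      = ThetaVertex ls
  ; Adj         = SymClosure (ThetaLink ls)
  ; symmetric   = SymClosure.symmetric (ThetaLink ls)
  ; irreflexive = λ { refl (fwd l) → noLoop l ; refl (bwd l) → noLoop l }
  }
  where
  noLoop : ∀ {u} → ¬ ThetaLink ls u u
  noLoop (next _ _ _ eq) = ℕ.1+n≢n (sym eq)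

-- H p r, for odd p ≥ 5 and r ≥ 4: the centre and the leaves, in pairs, form
-- the friendship graph F_p; the centre and the r ∸ 1 rim vertices form C_r.
data HVertex (p r : ℕ) : Set where
  centre : HVertex p r
  leaf   : Fin ((p ∸ 1) / 2) → Fin 2 → HVertex p r
  rim    : Fin (r ∸ 1) → HVertex p r

data HLink (p r : ℕ) : Rel (HVertex p r) 0ℓ where
  spoke : ∀ i b → HLink p r centre (leaf i b)
  base  : ∀ i → HLink p r (leaf i 0F) (leaf i 1F)
  first : ∀ j → toℕ j ≡ 0 → HLink p r centre (rim j)
  next  : ∀ j j′ → toℕ j′ ≡ suc (toℕ j) → HLink p r (rim j) (rim j′)
  last  : ∀ j → suc (suc (toℕ j)) ≡ r → HLink p r (rim j) centre

H : (p r : ℕ) → Graph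
H p r = record
  { Vertex      = HVertex p r
  ; Adj         = SymClosure (HLink p r)
  ; symmetric   = SymClosure.symmetric (HLink p r)
  ; irreflexive = λ { refl (fwd l) → noLoop l ; refl (bwd l) → noLoop l }
  }
  where
  noLoop : ∀ {u} → ¬ HLink p r u u
  noLoop (next _ _ eq) = ℕ.1+n≢n (sym eq)

quartic : ℕ → ℝ → ℝ
quartic m x =
    x ^ 4
  - fromℚ (ℤ.+ 2 ℚ./ 3) * (fromℕ m + fromℕ 10) * x ^ 3
  + fromℚ (ℤ.+ 2 ℚ./ 3) * (fromℕ 7 * fromℕ m + fromℕ 16) * x ^ 2
  - (fromℕ 10 * fromℕ m - fromℕ 7) * x
  + fromℚ (ℤ.+ 4 ℚ./ 3) * (fromℕ 5 * fromℕ m - fromℕ 16)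
  where open Real

-- Collatz–Wielandt: a positive y with Q y ≤ μ y bounds every eigenvalue of Q by μ.
-- With μ = 2k + 1 + 5/(5k + 1), where the quartic is still negative, y = 7 d − 1
-- works when all degrees d are below 2k.  For a vertex u of degree at least 2k,
-- write the number of edges as a multiple of deg u plus charges of the other
-- vertices: the charges sum to at most 4, so they leave only H and graphs made of
-- triangles and 4-cycles through u, for which explicit weights give q ≤ μ again.
-- For H the eigenvalue equation reduces to the quartic, so that its largest root is
-- an eigenvalue, and it is approached by rational μ admitting positive weights.

{-# OPTIONS --safe #-}
module Submission where

open import Defs
open import Algebra.Bundles using (CommutativeMonoid; CommutativeRing)
open import Data.Bool.Base using (if_then_else_; true; false)
open import Data.Empty using (⊥; ⊥-elim)
open import Data.Fin.Base using (Fin; zero; suc; toℕ)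
open import Data.Fin.Patterns using (0F; 1F; 2F; 3F)
import Data.Fin.Properties as Fin
import Data.Integer.Base as ℤ
import Data.Integer.Properties as ℤ
open import Data.List.Base
  using (List; []; _∷_; _++_; length; lookup; filter; allFin; tabulate; map; foldr)
open import Data.List.Membership.Propositional using (_∈_)
open import Data.List.Membership.Propositional.Properties
  using (∈-lookup; ∈-filter⁺; ∈-filter⁻; ∈-allFin; ∈-tabulate⁺; ∈-tabulate⁻; ∈-++⁺ˡ; ∈-++⁺ʳ; ∈-map⁺)
open import Data.List.Properties using (length-++; length-tabulate)
open import Data.List.Relation.Unary.All using (All; []; _∷_)
import Data.List.Relation.Unary.All as All
import Data.List.Relation.Unary.All.Properties as All
open import Data.List.Relation.Unary.AllPairs using ([]; _∷_)
open import Data.List.Relation.Unary.Any using (here; there; index)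
open import Data.List.Relation.Unary.Any.Properties using (lookup-index)
open import Data.List.Relation.Unary.Unique.Propositional using (Unique)
import Data.List.Relation.Unary.Unique.Propositional.Properties as Unique
import Data.Nat.Base as ℕ
import Data.Nat.Properties as ℕ
open import Data.Nat.Base using (ℕ; zero; suc)
open import Data.Product.Base using (∃; ∃-syntax; _×_; _,_; proj₁; proj₂)
import Data.Rational.Unnormalised.Base as ℚᵘ
import Data.Rational.Unnormalised.Properties as ℚᵘ
open import Data.Sum.Base using (_⊎_; inj₁; inj₂; [_,_]′)
open import Data.Vec.Base using (Vec; []; _∷_)
import Data.Vec.Base as Vec
import Data.Vec.Properties as Vec
open import Function.Base using (id; _∘_)
open import Function.Bundles using (Inverse; Equivalence; _⇔_; mk↔ₛ′; mk⇔)
open import Relation.Binary.Construct.Closure.Symmetric as SymClosure using (SymClosure; fwd; bwd)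
open import Relation.Binary.Definitions using (tri<; tri≈; tri>)
open import Relation.Binary.PropositionalEquality hiding (setoid)
open import Relation.Nullary using (¬_; Dec; yes; no; does; contradiction)
open import Relation.Nullary.Decidable using (dec-true; dec-false; _×-dec_; ¬?)

-- The equality case asks for a strict gap, while the order of these reals is undecidable; one
-- rational `μ` supplies the gap. Competitors satisfy `q ≤ μ`, and since the quartic is negative at
-- `μ`, the number `μ` cannot be equal to the root `q′`. The gap is narrow: the weights for
-- triangles and 4-cycles balance at `2k + 1 + 1/k − 1/(2k²) + O(1/k³)`, whereas
-- `q(H) = 2k + 1 + 1/k + O(1/k³)`. The term `5/(5k + 1) = 1/k − 1/(5k²) + O(1/k³)` falls in
-- between. The largest root `q′` is only assumed, so a root to compare it with is constructed by
-- bisection between `μ` and `μ + 1`. Each upper endpoint bounds `q(H)`, hence so does the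
-- constructed root, which is at most `q′`; conversely `q′` is an eigenvalue of `H`. The charges
-- satisfy `2m = 3 deg u + Σ charge` with `2m = 6k + 4`. Degree `2k` leaves a total of 4. A larger
-- degree can only be `2k + 1` with total 1, and a charged vertex never occurs alone.

-- Collatz-Wielandt bounds for real eigenvalues

module CollatzWielandt where

  open import Data.Rational.Base
  open import Data.Rational.Properties
  open import Data.Rational.Solver using (module +-*-Solver)
  open import Algebra.Properties.Semiring.Sum (CommutativeRing.semiring +-*-commutativeRing) using (*-distribˡ-sum)
  open import Algebra.Properties.CommutativeMonoid.Sum +-0-commutativeMonoid
    using () renaming (sum to sumℚ; sum-cong-≗ to sumℚ-cong)

  open Real using (ℝ; seq; cauchy; Eventually)
  open +-*-Solver using (solve; _:=_; _:+_; _:*_; _:-_; :-_; con)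

  ι : ℕ → ℚ
  ι n = ℤ.+ n / 1

  toℚᵘ-ι : ∀ n → toℚᵘ (ι n) ℚᵘ.≃ ℚᵘ.mkℚᵘ (ℤ.+ n) 0
  toℚᵘ-ι n = toℚᵘ-fromℚᵘ (ℚᵘ.mkℚᵘ (ℤ.+ n) 0)

  ι-+ : ∀ m n → ι (m ℕ.+ n) ≡ ι m + ι n
  ι-+ m n = toℚᵘ-injective (ℚᵘ.≃-trans (toℚᵘ-ι (m ℕ.+ n)) (ℚᵘ.≃-trans
    (ℚᵘ.*≡* (cong (ℤ._* ℤ.+ 1) (sym (cong₂ ℤ._+_ (ℤ.*-identityʳ (ℤ.+ m)) (ℤ.*-identityʳ (ℤ.+ n))))))
    (ℚᵘ.≃-sym (ℚᵘ.≃-trans (toℚᵘ-homo-+ (ι m) (ι n)) (ℚᵘ.+-cong (toℚᵘ-ι m) (toℚᵘ-ι n))))))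

  ι-* : ∀ m n → ι (m ℕ.* n) ≡ ι m * ι n
  ι-* m n = toℚᵘ-injective (ℚᵘ.≃-trans (toℚᵘ-ι (m ℕ.* n)) (ℚᵘ.≃-trans
    (ℚᵘ.*≡* (cong (ℤ._* ℤ.+ 1) (ℤ.pos-* m n)))
    (ℚᵘ.≃-sym (ℚᵘ.≃-trans (toℚᵘ-homo-* (ι m) (ι n)) (ℚᵘ.*-cong (toℚᵘ-ι m) (toℚᵘ-ι n))))))

  ι-mono-≤ : ∀ m n → m ℕ.≤ n → ι m ≤ ι n
  ι-mono-≤ m n m≤n = toℚᵘ-cancel-≤
    (ℚᵘ.≤-respˡ-≃ (ℚᵘ.≃-sym (toℚᵘ-ι m)) (ℚᵘ.≤-respʳ-≃ (ℚᵘ.≃-sym (toℚᵘ-ι n))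
      (ℚᵘ.*≤* (ℤ.*-monoʳ-≤-nonNeg (ℤ.+ 1) (ℤ.+≤+ m≤n)))))

  ι-mono-< : ∀ m n → m ℕ.< n → ι m < ι n
  ι-mono-< m n m<n = toℚᵘ-cancel-<
    (ℚᵘ.<-respˡ-≃ (ℚᵘ.≃-sym (toℚᵘ-ι m)) (ℚᵘ.<-respʳ-≃ (ℚᵘ.≃-sym (toℚᵘ-ι n))
      (ℚᵘ.*<* (ℤ.*-monoʳ-<-pos (ℤ.+ 1) (ℤ.+<+ m<n)))))

  ι-nonNeg : ∀ n → 0ℚ ≤ ι n
  ι-nonNeg n = ι-mono-≤ 0 n ℕ.z≤n

  ι-pos : ∀ n → 0 ℕ.< n → 0ℚ < ι n
  ι-pos n = ι-mono-< 0 n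

  p≤q⇒0≤q-p : ∀ {p q} → p ≤ q → 0ℚ ≤ q - p
  p≤q⇒0≤q-p {p} {q} p≤q = subst (_≤ q - p) (+-inverseʳ p) (+-monoˡ-≤ (- p) p≤q)

  p<q⇒0<q-p : ∀ {p q} → p < q → 0ℚ < q - p
  p<q⇒0<q-p {p} {q} p<q = subst (_< q - p) (+-inverseʳ p) (+-monoˡ-< (- p) p<q)

  q-p+p≡q : ∀ p q → q - p + p ≡ q
  q-p+p≡q = solve 2 (λ p q → q :- p :+ p := q) refl

  0≤q-p⇒p≤q : ∀ {p q} → 0ℚ ≤ q - p → p ≤ q
  0≤q-p⇒p≤q {p} {q} h = subst₂ _≤_ (+-identityˡ p) (q-p+p≡q p q) (+-monoˡ-≤ p h)

  0<q-p⇒p<q : ∀ {p q} → 0ℚ < q - p → p < q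
  0<q-p⇒p<q {p} {q} h = subst₂ _<_ (+-identityˡ p) (q-p+p≡q p q) (+-monoˡ-< p h)

  *-pos : ∀ {p q} → 0ℚ < p → 0ℚ < q → 0ℚ < p * q
  *-pos {p} {q} 0<p 0<q = positive⁻¹ (p * q) {{pos*pos⇒pos p {{positive 0<p}} q {{positive 0<q}}}}

  +-nonNeg : ∀ {p q} → 0ℚ ≤ p → 0ℚ ≤ q → 0ℚ ≤ p + q
  +-nonNeg = +-mono-≤

  ∣p∣<e : ∀ {p e} → - e < p → p < e → ∣ p ∣ < e
  ∣p∣<e {p} {e} -e<p p<e with ∣p∣≡p∨∣p∣≡-p p
  ... | inj₁ eq = subst (_< e) (sym eq) p<e
  ... | inj₂ eq = subst (_< e) (sym eq) (subst (- p <_) (neg-involutive e) (neg-antimono-< -e<p))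
    where
    neg-involutive : ∀ e → - (- e) ≡ e
    neg-involutive = solve 1 (λ e → :- (:- e) := e) refl

  p≤∣p∣ : ∀ p → p ≤ ∣ p ∣
  p≤∣p∣ p with ∣p∣≡p∨∣p∣≡-p p
  ... | inj₁ eq = ≤-reflexive (sym eq)
  ... | inj₂ eq with ≤-total 0ℚ p
  ...   | inj₁ 0≤p = ≤-reflexive (sym (0≤p⇒∣p∣≡p 0≤p))
  ...   | inj₂ p≤0 = ≤-trans p≤0 (0≤∣p∣ p)

  ∣p-q∣≡∣q-p∣ : ∀ p q → ∣ p - q ∣ ≡ ∣ q - p ∣
  ∣p-q∣≡∣q-p∣ p q = trans (sym (∣-p∣≡∣p∣ (p - q))) (cong ∣_∣ (swap p q))
    where
    swap : ∀ p q → - (p - q) ≡ q - p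
    swap = solve 2 (λ p q → :- (p :- q) := q :- p) refl

  ∣p-q∣<e⇒p<q+e : ∀ {p q e} → ∣ p - q ∣ < e → p < q + e
  ∣p-q∣<e⇒p<q+e {p} {q} {e} h = subst₂ _<_ (q-p+p≡q q p) (+-comm e q)
    (+-monoˡ-< q (≤-<-trans (p≤∣p∣ (p - q)) h))

  ∣p-q∣<e⇒q<p+e : ∀ {p q e} → ∣ p - q ∣ < e → q < p + e
  ∣p-q∣<e⇒q<p+e {p} {q} {e} h = ∣p-q∣<e⇒p<q+e (subst (_< e) (∣p-q∣≡∣q-p∣ p q) h)

  sumℚ-mono : ∀ {n} {f g : Fin n → ℚ} → (∀ i → f i ≤ g i) → sumℚ f ≤ sumℚ g
  sumℚ-mono {zero}  h = ≤-refl
  sumℚ-mono {suc n} h = +-mono-≤ (h zero) (sumℚ-mono λ i → h (suc i))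

  ∣sumℚ∣≤sumℚ∣∣ : ∀ {n} (f : Fin n → ℚ) → ∣ sumℚ f ∣ ≤ sumℚ (λ i → ∣ f i ∣)
  ∣sumℚ∣≤sumℚ∣∣ {zero}  f = ≤-refl
  ∣sumℚ∣≤sumℚ∣∣ {suc n} f = ≤-trans (∣p+q∣≤∣p∣+∣q∣ (f zero) _)
    (+-monoʳ-≤ ∣ f zero ∣ (∣sumℚ∣≤sumℚ∣∣ λ i → f (suc i)))

  argmax : ∀ {n} (z : Fin (suc n) → ℚ) → ∃[ i ] ∀ j → z j ≤ z i
  argmax {zero}  z = zero , λ { zero → ≤-refl }
  argmax {suc n} z with argmax (λ i → z (suc i))
  ... | i , max with ≤-total (z (suc i)) (z zero)
  ...   | inj₁ ≤0 = zero  , λ { zero → ≤-refl ; (suc j) → ≤-trans (max j) ≤0 }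
  ...   | inj₂ 0≤ = suc i , λ { zero → 0≤ ; (suc j) → max j }

  -- Collatz–Wielandt: compare an approximate eigenvector x with y at an index
  -- maximising ∣x∣ / y.
  approximate-eigenvector-small :
    ∀ {n} (M : Fin n → Fin n → ℚ) → (∀ i j → 0ℚ ≤ M i j) →
    (y : Fin n → ℚ) → (∀ i → 0ℚ < y i) →
    ∀ μ → (∀ i → sumℚ (λ j → M i j * y j) ≤ μ * y i) →
    ∀ (x : Fin n → ℚ) q ε η → 0ℚ ≤ μ → 0ℚ < ε → μ + ε ≤ q →
    (∀ i → ∣ sumℚ (λ j → M i j * x j) - q * x i ∣ ≤ η * y i) →
    ∀ j → ε * ∣ x j ∣ ≤ η * y j
  approximate-eigenvector-small {suc n} M M≥0 y y>0 μ My≤μy x q ε η 0≤μ 0<ε μ+ε≤q res j =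
    begin
      ε * ∣ x j ∣     ≡⟨ cong (ε *_) (sym (z*y j)) ⟩
      ε * (z j * y j) ≤⟨ *-monoˡ-≤-nonNeg ε {{ε≥0}} (*-monoʳ-≤-nonNeg (y j) {{y≥0 j}} (max j)) ⟩
      ε * (z i * y j) ≡⟨ sym (*-assoc ε (z i) (y j)) ⟩
      (ε * z i) * y j ≤⟨ *-monoʳ-≤-nonNeg (y j) {{y≥0 j}} εz≤η ⟩
      η * y j         ∎
    where
    open ≤-Reasoning
    ε≥0 : NonNegative ε
    ε≥0 = nonNegative (<⇒≤ 0<ε)
    y≥0 : ∀ i → NonNegative (y i)
    y≥0 i = nonNegative (<⇒≤ (y>0 i))
    z : Fin (suc n) → ℚ
    z i = ∣ x i ∣ * (1/ y i) {{pos⇒nonZero (y i) {{positive (y>0 i)}}}}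
    z*y : ∀ i → z i * y i ≡ ∣ x i ∣
    z*y i = trans (*-assoc ∣ x i ∣ _ (y i))
      (trans (cong (∣ x i ∣ *_) (*-inverseˡ (y i) {{_}})) (*-identityʳ _))
    i   = proj₁ (argmax z)
    max = proj₂ (argmax z)
    z≥0 : 0ℚ ≤ z i
    z≥0 = *-cancelʳ-≤-pos (y i) {{positive (y>0 i)}}
      (subst₂ _≤_ (sym (*-zeroˡ (y i))) (sym (z*y i)) (0≤∣p∣ (x i)))
    Mx : ℚ
    Mx = sumℚ (λ j → M i j * x j)
    ∣Mx∣≤ : ∣ Mx ∣ ≤ z i * (μ * y i)
    ∣Mx∣≤ = begin
      ∣ Mx ∣                              ≤⟨ ∣sumℚ∣≤sumℚ∣∣ (λ j → M i j * x j) ⟩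
      sumℚ (λ j → ∣ M i j * x j ∣)        ≤⟨ sumℚ-mono (λ j → term j) ⟩
      sumℚ (λ j → z i * (M i j * y j))    ≡⟨ sym (*-distribˡ-sum (z i) (λ j → M i j * y j)) ⟩
      z i * sumℚ (λ j → M i j * y j)      ≤⟨ *-monoˡ-≤-nonNeg (z i) {{nonNegative z≥0}} (My≤μy i) ⟩
      z i * (μ * y i)                     ∎
      where
      term : ∀ j → ∣ M i j * x j ∣ ≤ z i * (M i j * y j)
      term j = begin
        ∣ M i j * x j ∣         ≡⟨ ∣p*q∣≡∣p∣*∣q∣ (M i j) (x j) ⟩
        ∣ M i j ∣ * ∣ x j ∣     ≡⟨ cong₂ _*_ (0≤p⇒∣p∣≡p (M≥0 i j)) (sym (z*y j)) ⟩
        M i j * (z j * y j)     ≤⟨ *-monoˡ-≤-nonNeg (M i j) {{nonNegative (M≥0 i j)}}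
                                     (*-monoʳ-≤-nonNeg (y j) {{y≥0 j}} (max j)) ⟩
        M i j * (z i * y j)     ≡⟨ solve 3 (λ a b c → a :* (b :* c) := b :* (a :* c)) refl (M i j) (z i) (y j) ⟩
        z i * (M i j * y j)     ∎
    q≥0 : 0ℚ ≤ q
    q≥0 = ≤-trans (≤-trans 0≤μ (subst (_≤ μ + ε) (+-identityʳ μ) (+-monoʳ-≤ μ (<⇒≤ 0<ε)))) μ+ε≤q
    -- At the maximising index the row equation gives `q ∣xᵢ∣ ≤ residual + ∣(Mx)ᵢ∣`, and the maximum
    -- replaces every `∣xⱼ∣` by `zᵢ yⱼ`. The terms `μ zᵢ yᵢ` then cancel, leaving `ε zᵢ ≤ η`.
    bound : (μ + ε) * (z i * y i) ≤ η * y i + z i * (μ * y i)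
    bound = begin
      (μ + ε) * (z i * y i)           ≡⟨ cong ((μ + ε) *_) (z*y i) ⟩
      (μ + ε) * ∣ x i ∣               ≤⟨ *-monoʳ-≤-nonNeg ∣ x i ∣ {{nonNegative (0≤∣p∣ (x i))}} μ+ε≤q ⟩
      q * ∣ x i ∣                     ≡⟨ cong (_* ∣ x i ∣) (sym (0≤p⇒∣p∣≡p q≥0)) ⟩
      ∣ q ∣ * ∣ x i ∣                 ≡⟨ sym (∣p*q∣≡∣p∣*∣q∣ q (x i)) ⟩
      ∣ q * x i ∣                     ≡⟨ cong ∣_∣ (solve 2 (λ a b → a := (a :- b) :+ b) refl (q * x i) Mx) ⟩
      ∣ (q * x i - Mx) + Mx ∣         ≤⟨ ∣p+q∣≤∣p∣+∣q∣ (q * x i - Mx) Mx ⟩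
      ∣ q * x i - Mx ∣ + ∣ Mx ∣       ≤⟨ +-mono-≤ (subst (_≤ η * y i) (∣p-q∣≡∣q-p∣ Mx (q * x i)) (res i)) ∣Mx∣≤ ⟩
      η * y i + z i * (μ * y i)       ∎
    εz≤η : ε * z i ≤ η
    εz≤η = *-cancelʳ-≤-pos (y i) {{positive (y>0 i)}} (0≤q-p⇒p≤q
      (subst (0ℚ ≤_) (regroup μ ε (z i) (y i) η) (p≤q⇒0≤q-p bound)))
      where
      regroup : ∀ μ ε z y η → η * y + z * (μ * y) - (μ + ε) * (z * y) ≡ η * y - ε * z * y
      regroup = solve 5 (λ μ ε z y η →
        η :* y :+ z :* (μ :* y) :- (μ :+ ε) :* (z :* y) := η :* y :- ε :* z :* y) refl

  eventually-all : ∀ {n} {P : Fin n → ℕ → Set} →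
    (∀ i → Eventually (P i)) → Eventually (λ t → ∀ i → P i t)
  eventually-all {zero}  h = 0 , λ _ _ ()
  eventually-all {suc n} h with h zero | eventually-all (λ i → h (suc i))
  ... | a , f | b , g = a ℕ.⊔ b , λ
    { t ≤t zero    → f t (ℕ.m⊔n≤o⇒m≤o a b ≤t)
    ; t ≤t (suc i) → g t (ℕ.m⊔n≤o⇒n≤o a b ≤t) i }

  seq-sum : ∀ {n} (f : Fin n → ℝ) t → seq (Real.sum f) t ≡ sumℚ (λ i → seq (f i) t)
  seq-sum {zero}  f t = refl
  seq-sum {suc n} f t = cong (seq (f zero) t +_) (seq-sum (λ i → f (suc i)) t)

  p+½e<p+e : ∀ p {e} → 0ℚ < e → p + e * ½ < p + e
  p+½e<p+e p {e} 0<e = 0<q-p⇒p<q (subst (0ℚ <_)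
    (solve 2 (λ p e → e :* con ½ := p :+ e :- (p :+ e :* con ½)) refl p e) (Real.half-pos 0<e))

  p-0≡p : ∀ p → p - 0ℚ ≡ p
  p-0≡p = solve 1 (λ p → p :- con 0ℚ := p) refl

  ½e<e : ∀ {e} → 0ℚ < e → e * ½ < e
  ½e<e {e} 0<e = subst₂ _<_ (+-identityˡ (e * ½)) (+-identityˡ e) (p+½e<p+e 0ℚ 0<e)

  -- An overlapping alternative in place of trichotomy, which is undecidable for Cauchy sequences. A
  -- single rational term, late enough to be within `κ = ε/4` of all later ones, is compared with
  -- `μ + ε/2`; either answer keeps a margin of `ε/4`.
  bounded-or-apart : ∀ q μ ε → 0ℚ < ε →
    (Eventually λ t → seq q t < μ + ε) ⊎
    (∃[ κ ] 0ℚ < κ × Eventually λ t → μ + κ ≤ seq q t)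
  bounded-or-apart q μ ε 0<ε = helper (cauchy q κ 0<κ)
    where
    open ≤-Reasoning
    κ : ℚ
    κ = ε * ½ * ½
    0<κ : 0ℚ < κ
    0<κ = Real.half-pos (Real.half-pos 0<ε)
    helper : (∃[ N ] ∀ i j → N ℕ.≤ i → N ℕ.≤ j → ∣ seq q i - seq q j ∣ < κ) →
      (Eventually λ t → seq q t < μ + ε) ⊎
      (∃[ κ ] 0ℚ < κ × Eventually λ t → μ + κ ≤ seq q t)
    helper (N , close) with seq q N <? μ + ε * ½
    ... | yes q< = inj₁ (N , λ t N≤t → begin-strict
        seq q t                             <⟨ ∣p-q∣<e⇒p<q+e (close t N N≤t ℕ.≤-refl) ⟩
        seq q N + κ                         <⟨ +-monoˡ-< κ q< ⟩
        μ + ε * ½ + κ                       <⟨ p+½e<p+e (μ + ε * ½) (Real.half-pos 0<ε) ⟩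
        μ + ε * ½ + ε * ½                   ≡⟨ +-assoc μ (ε * ½) (ε * ½) ⟩
        μ + (ε * ½ + ε * ½)                 ≡⟨ cong (μ +_) (Real.half+half ε) ⟩
        μ + ε                               ∎)
    ... | no  q≮ = inj₂ (κ , 0<κ , N , λ t N≤t → 0≤q-p⇒p≤q (subst (0ℚ ≤_)
        (regroup μ ε (seq q N) (seq q t))
        (+-nonNeg (<⇒≤ (p<q⇒0<q-p {seq q N} {seq q t + ε * ½ * ½} (∣p-q∣<e⇒q<p+e {seq q t} (close t N N≤t ℕ.≤-refl)))) (p≤q⇒0≤q-p {μ + ε * ½} {seq q N} (≮⇒≥ q≮)))))
      where
      regroup : ∀ m e a b → (b + e * ½ * ½ - a) + (a - (m + e * ½)) ≡ b - (m + e * ½ * ½)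
      regroup = solve 4 (λ m e a b → (b :+ e :* con ½ :* con ½ :- a) :+ (a :- (m :+ e :* con ½))
        := b :- (m :+ e :* con ½ :* con ½)) refl

  -- If `q` stayed above `μ + κ`, the rational terms of `x` would be approximate eigenvectors with
  -- arbitrarily small residual, and the preceding estimate would make every coordinate of `x` equal
  -- to zero. The entries of `R` are constant sequences, so each row can be evaluated over the
  -- rationals at a fixed index `t`.
  collatz-wielandt :
    ∀ {n} (R : Real.Matrix n) (M : Fin n → Fin n → ℚ) → (∀ i j t → seq (R i j) t ≡ M i j) →
    (∀ i j → 0ℚ ≤ M i j) →
    (y : Fin n → ℚ) → (∀ i → 0ℚ < y i) →
    ∀ μ → 0ℚ ≤ μ → (∀ i → sumℚ (λ j → M i j * y j) ≤ μ * y i) →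
    ∀ q → Real.IsEigenvalue R q → q Real.≤ Real.fromℚ μ
  collatz-wielandt {n} R M R≡M M≥0 y y>0 μ 0≤μ My≤μy q (x , x≄0 , eigen) ε 0<ε =
    [ id , (λ (κ , 0<κ , q≥) → contradiction (x≃0 κ 0<κ q≥) x≄0) ]′ (bounded-or-apart q μ ε 0<ε)
    where
    open ≤-Reasoning
    Residual : ℚ → Fin n → ℕ → Set
    Residual η i t = ∣ seq (Real.sum (λ j → R i j Real.* x j)) t - seq q t * seq (x i) t ∣ < η * y i
    x≃0 : ∀ κ → 0ℚ < κ → (Eventually λ t → μ + κ ≤ seq q t) → ∀ i → x i Real.≃ Real.0ℝ
    x≃0 κ 0<κ (N , q≥) i δ 0<δ =
      -- The residual tolerance is chosen so that `η yᵢ = κ δ/2`; cancelling `κ` then leaves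
      -- `∣xᵢ∣ ≤ δ/2 < δ`.
      let η , 0<η , yη  = Real.shrink (y i) (κ * (δ * ½)) (y>0 i) (*-pos 0<κ (Real.half-pos 0<δ))
          N′ , residual = eventually-all {P = Residual η} (λ j → eigen j (η * y j) (*-pos 0<η (y>0 j)))
      in N ℕ.⊔ N′ , λ t ≤t → conclude η yη t
           (q≥ t (ℕ.m⊔n≤o⇒m≤o N N′ ≤t)) (residual t (ℕ.m⊔n≤o⇒n≤o N N′ ≤t))
      where
      conclude : ∀ η → y i * η ≡ κ * (δ * ½) → ∀ t → μ + κ ≤ seq q t →
        (∀ j → Residual η j t) → ∣ seq (x i) t - 0ℚ ∣ < δ
      conclude η yη t q≥ residual = begin-strict
        ∣ seq (x i) t - 0ℚ ∣  ≡⟨ cong ∣_∣ (p-0≡p (seq (x i) t)) ⟩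
        ∣ seq (x i) t ∣       ≤⟨ *-cancelˡ-≤-pos κ {{positive 0<κ}} κx≤ ⟩
        δ * ½                 <⟨ ½e<e 0<δ ⟩
        δ                     ∎
        where
        residual′ : ∀ j → ∣ sumℚ (λ l → M j l * seq (x l) t) - seq q t * seq (x j) t ∣ ≤ η * y j
        residual′ j = <⇒≤ (subst (λ s → ∣ s - seq q t * seq (x j) t ∣ < η * y j)
          (trans (seq-sum (λ l → R j l Real.* x l) t)
                 (sumℚ-cong (λ l → cong (_* seq (x l) t) (R≡M j l t))))
          (residual j))
        κx≤ : κ * ∣ seq (x i) t ∣ ≤ κ * (δ * ½)
        κx≤ = begin
          κ * ∣ seq (x i) t ∣ ≤⟨ approximate-eigenvector-small M M≥0 y y>0 μ My≤μy
                                   (λ j → seq (x j) t) (seq q t) κ η 0≤μ 0<κ q≥ residual′ i ⟩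
          η * y i             ≡⟨ *-comm η (y i) ⟩
          y i * η             ≡⟨ yη ⟩
          κ * (δ * ½)         ∎

-- Continuity by interleaving and roots by rational bisection

module Roots where

  open CollatzWielandt
  open import Data.Rational.Base
  open import Data.Rational.Properties
  open import Data.Rational.Solver using (module +-*-Solver)

  open Real using (ℝ; mkℝ; seq; cauchy; Eventually; IsCauchy)
  open +-*-Solver using (solve; _:=_; _:+_; _:*_; _:-_; :-_; con)

  ∣-∣-triangle : ∀ {a b c d e} → ∣ a - b ∣ < d → ∣ b - c ∣ < e → ∣ a - c ∣ < d + e
  ∣-∣-triangle {a} {b} {c} {d} {e} ab bc = begin-strict
    ∣ a - c ∣               ≡⟨ cong ∣_∣ (solve 3 (λ a b c → a :- c := (a :- b) :+ (b :- c)) refl a b c) ⟩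
    ∣ (a - b) + (b - c) ∣   ≤⟨ ∣p+q∣≤∣p∣+∣q∣ (a - b) (b - c) ⟩
    ∣ a - b ∣ + ∣ b - c ∣   <⟨ +-mono-< ab bc ⟩
    d + e                   ∎
    where open ≤-Reasoning

  interleave : (ℕ → ℚ) → (ℕ → ℚ) → ℕ → ℚ
  interleave a b zero          = a 0
  interleave a b (suc zero)    = b 0
  interleave a b (suc (suc n)) = interleave (λ t → a (suc t)) (λ t → b (suc t)) n

  interleave-even : ∀ a b t → interleave a b (t ℕ.+ t) ≡ a t
  interleave-even a b zero    = refl
  interleave-even a b (suc t) rewrite ℕ.+-suc t t = interleave-even _ _ t

  interleave-odd : ∀ a b t → interleave a b (suc (t ℕ.+ t)) ≡ b t
  interleave-odd a b zero    = refl
  interleave-odd a b (suc t) rewrite ℕ.+-suc t t = interleave-odd _ _ t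

  interleave-all : ∀ (P : ℚ → Set) N {a b} →
    (∀ t → N ℕ.≤ t → P (a t)) → (∀ t → N ℕ.≤ t → P (b t)) →
    ∀ i → N ℕ.+ N ℕ.≤ i → P (interleave a b i)
  interleave-all P zero    pa pb zero          _ = pa 0 ℕ.z≤n
  interleave-all P zero    pa pb (suc zero)    _ = pb 0 ℕ.z≤n
  interleave-all P zero    pa pb (suc (suc i)) _ =
    interleave-all P zero (λ t _ → pa (suc t) ℕ.z≤n) (λ t _ → pb (suc t) ℕ.z≤n) i ℕ.z≤n
  interleave-all P (suc N) pa pb i             ≤i rewrite ℕ.+-suc N N with i | ≤i
  ... | suc (suc j) | ℕ.s≤s (ℕ.s≤s ≤j) =
    interleave-all P N (λ t N≤t → pa (suc t) (ℕ.s≤s N≤t)) (λ t N≤t → pb (suc t) (ℕ.s≤s N≤t)) j ≤j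

  module _ (x y : ℝ) (x≃y : x Real.≃ y) where

    interleave-cauchy : IsCauchy (interleave (seq x) (seq y))
    interleave-cauchy ε 0<ε =
      let N  , close = cauchy x (ε * ½ * ½) (Real.half-pos (Real.half-pos 0<ε))
          N′ , near  = x≃y (ε * ½ * ½) (Real.half-pos (Real.half-pos 0<ε))
      in (N ℕ.⊔ N′) ℕ.+ (N ℕ.⊔ N′) , λ i j ≤i ≤j →
        subst (∣ interleave (seq x) (seq y) i - interleave (seq x) (seq y) j ∣ <_) (Real.half+half ε)
          (∣-∣-triangle {interleave (seq x) (seq y) i} {seq x N} {interleave (seq x) (seq y) j}
            (within N N′ close near i ≤i)
            (subst (_< ε * ½) (∣p-q∣≡∣q-p∣ (interleave (seq x) (seq y) j) (seq x N))
              (within N N′ close near j ≤j)))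
      where
      within : ∀ N N′ →
        (∀ i j → N ℕ.≤ i → N ℕ.≤ j → ∣ seq x i - seq x j ∣ < ε * ½ * ½) →
        (∀ t → N′ ℕ.≤ t → ∣ seq x t - seq y t ∣ < ε * ½ * ½) →
        ∀ i → (N ℕ.⊔ N′) ℕ.+ (N ℕ.⊔ N′) ℕ.≤ i →
        ∣ interleave (seq x) (seq y) i - seq x N ∣ < ε * ½
      within N N′ close near = interleave-all (λ p → ∣ p - seq x N ∣ < ε * ½) (N ℕ.⊔ N′)
        (λ t ≤t → <-trans (close t N (ℕ.m⊔n≤o⇒m≤o N N′ ≤t) ℕ.≤-refl) (½e<e (Real.half-pos 0<ε)))
        (λ t ≤t → subst (∣ seq y t - seq x N ∣ <_) (Real.half+half (ε * ½))
          (∣-∣-triangle {seq y t} {seq x t} {seq x N}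
            (subst (_< ε * ½ * ½) (∣p-q∣≡∣q-p∣ (seq x t) (seq y t)) (near t (ℕ.m⊔n≤o⇒n≤o N N′ ≤t)))
            (close t N (ℕ.m⊔n≤o⇒m≤o N N′ ≤t) ℕ.≤-refl)))

    -- F preserves Cauchy sequences, in particular the interleaving of x and y;
    -- hence it is continuous.
    pointwise-cong : ∀ (F : ℝ → ℝ) (φ : ℚ → ℚ) → (∀ z t → seq (F z) t ≡ φ (seq z t)) →
      F x Real.≃ F y
    pointwise-cong F φ pointwise ε 0<ε =
      let N , close = cauchy (F z) ε 0<ε
      in N , λ t N≤t → subst₂ (λ p q → ∣ p - q ∣ < ε)
        (trans (pointwise z (t ℕ.+ t)) (trans (cong φ (interleave-even (seq x) (seq y) t)) (sym (pointwise x t))))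
        (trans (pointwise z (suc (t ℕ.+ t))) (trans (cong φ (interleave-odd (seq x) (seq y) t)) (sym (pointwise y t))))
        (close (t ℕ.+ t) (suc (t ℕ.+ t)) (ℕ.≤-trans N≤t (ℕ.m≤m+n t t)) (ℕ.m≤n⇒m≤1+n (ℕ.≤-trans N≤t (ℕ.m≤m+n t t))))
      where
      z : ℝ
      z = mkℝ (interleave (seq x) (seq y)) interleave-cauchy

  ½^ : ℕ → ℚ
  ½^ zero    = 1ℚ
  ½^ (suc n) = ½^ n * ½

  ½^-pos : ∀ n → 0ℚ < ½^ n
  ½^-pos zero    = positive⁻¹ 1ℚ
  ½^-pos (suc n) = Real.half-pos (½^-pos n)

  ½^*2^ : ∀ n → ½^ n * ι (2 ℕ.^ n) ≡ 1ℚ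
  ½^*2^ zero    = refl
  ½^*2^ (suc n) = begin
    ½^ n * ½ * ι (2 ℕ.* 2 ℕ.^ n)      ≡⟨ cong (½^ n * ½ *_) (ι-* 2 (2 ℕ.^ n)) ⟩
    ½^ n * ½ * (ι 2 * ι (2 ℕ.^ n))    ≡⟨ solve 2 (λ a b → a :* con ½ :* (con (ι 2) :* b) := a :* b) refl (½^ n) (ι (2 ℕ.^ n)) ⟩
    ½^ n * ι (2 ℕ.^ n)                ≡⟨ ½^*2^ n ⟩
    1ℚ                                ∎
    where open ≡-Reasoning

  -- A positive rational has numerator at least 1, hence is at least the reciprocal of its
  -- denominator. This makes the denominator of `ε` an explicit modulus of convergence for the
  -- powers of `½`.
  1≤p*↧p : ∀ p → 0ℚ < p → 1ℚ ≤ p * ι (↧ₙ p)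
  1≤p*↧p p@(mkℚ (ℤ.+ suc n) d-1 _) 0<p = toℚᵘ-cancel-≤ (ℚᵘ.≤-respʳ-≃
    (ℚᵘ.≃-sym (ℚᵘ.≃-trans (toℚᵘ-homo-* p (ι (suc d-1))) (ℚᵘ.*-congˡ {toℚᵘ p} (toℚᵘ-ι (suc d-1)))))
    (ℚᵘ.*≤* (ℤ.+≤+ (ℕ.≤-trans (ℕ.≤-reflexive (trans (ℕ.*-identityˡ _) (ℕ.*-identityʳ _)))
      (ℕ.≤-trans (ℕ.m≤m+n (suc d-1) _) (ℕ.≤-reflexive (sym (ℕ.*-identityʳ _))))))))
  1≤p*↧p (mkℚ (ℤ.+ zero) _ _)   0<p = contradiction (drop-*<* 0<p) λ { (ℤ.+<+ ()) }
  1≤p*↧p (mkℚ ℤ.-[1+ _ ] _ _)   0<p = contradiction (drop-*<* 0<p) λ ()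

  n<2^n : ∀ n → n ℕ.< 2 ℕ.^ n
  n<2^n zero    = ℕ.s≤s ℕ.z≤n
  n<2^n (suc n) = ℕ.≤-trans (ℕ.+-mono-≤ (ℕ.≤-trans (ℕ.s≤s ℕ.z≤n) (n<2^n n)) (n<2^n n))
    (ℕ.+-monoʳ-≤ (2 ℕ.^ n) (ℕ.m≤m+n (2 ℕ.^ n) 0))

  ½^-small : ∀ ε → 0ℚ < ε → ½^ (↧ₙ ε) < ε
  ½^-small ε 0<ε = *-cancelʳ-<-nonNeg (ι (2 ℕ.^ ↧ₙ ε)) {{nonNegative (ι-nonNeg (2 ℕ.^ ↧ₙ ε))}} (begin-strict
    ½^ (↧ₙ ε) * ι (2 ℕ.^ ↧ₙ ε)  ≡⟨ ½^*2^ (↧ₙ ε) ⟩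
    1ℚ                          ≤⟨ 1≤p*↧p ε 0<ε ⟩
    ε * ι (↧ₙ ε)                <⟨ *-monoʳ-<-pos ε {{positive 0<ε}} (ι-mono-< (↧ₙ ε) (2 ℕ.^ ↧ₙ ε) (n<2^n (↧ₙ ε))) ⟩
    ε * ι (2 ℕ.^ ↧ₙ ε)          ∎)
    where open ≤-Reasoning

  module Bisection (F : ℝ → ℝ) (φ : ℚ → ℚ) (pointwise : ∀ z t → seq (F z) t ≡ φ (seq z t))
                   (lo : ℚ) (φlo<0 : φ lo < 0ℚ) (0≤φhi : 0ℚ ≤ φ (lo + 1ℚ)) where

    -- The sign test is made at rational points, where it is decidable. Its outcome is an argument,
    -- so that each invariant is proved by matching on a variable `d` instead of on the test inside
    -- the recursion.
    step : ∀ a w → Dec (φ (a + w) < 0ℚ) → ℚ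
    step a w (yes _) = a + w
    step a w (no  _) = a

    lower upper : ℕ → ℚ
    sign? : ∀ n → Dec (φ (lower n + ½^ (suc n)) < 0ℚ)
    lower zero    = lo
    lower (suc n) = step (lower n) (½^ (suc n)) (sign? n)
    upper n = lower n + ½^ n
    sign? n = φ (lower n + ½^ (suc n)) <? 0ℚ

    a+w+w : ∀ a w → a + w * ½ + w * ½ ≡ a + w
    a+w+w = solve 2 (λ a w → a :+ w :* con ½ :+ w :* con ½ := a :+ w) refl

    a≤a+w : ∀ a {w} → 0ℚ < w → a ≤ a + w
    a≤a+w a {w} 0<w = subst (_≤ a + w) (+-identityʳ a) (+-monoʳ-≤ a (<⇒≤ 0<w))

    step-neg : ∀ a w d → φ a < 0ℚ → φ (step a w d) < 0ℚ
    step-neg a w (yes φ<0) _ = φ<0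
    step-neg a w (no  _)   h = h

    step-upper : ∀ a w d → 0ℚ ≤ φ (a + w) → 0ℚ ≤ φ (step a (w * ½) d + w * ½)
    step-upper a w (yes _)   h = subst (λ p → 0ℚ ≤ φ p) (sym (a+w+w a w)) h
    step-upper a w (no φ≮0)  _ = ≮⇒≥ φ≮0

    step-mono : ∀ a w d → 0ℚ < w → a ≤ step a w d
    step-mono a w (yes _) 0<w = a≤a+w a 0<w
    step-mono a w (no  _) 0<w = ≤-refl

    step-anti : ∀ a w d → 0ℚ < w → step a (w * ½) d + w * ½ ≤ a + w
    step-anti a w (yes _) 0<w = ≤-reflexive (a+w+w a w)
    step-anti a w (no  _) 0<w = +-monoʳ-≤ a (<⇒≤ (½e<e 0<w))

    φlower<0 : ∀ n → φ (lower n) < 0ℚ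
    φlower<0 zero    = φlo<0
    φlower<0 (suc n) = step-neg (lower n) (½^ (suc n)) (sign? n) (φlower<0 n)

    0≤φupper : ∀ n → 0ℚ ≤ φ (upper n)
    0≤φupper zero    = 0≤φhi
    0≤φupper (suc n) = step-upper (lower n) (½^ n) (sign? n) (0≤φupper n)

    lower-mono : ∀ n d → lower n ≤ lower (d ℕ.+ n)
    lower-mono n zero    = ≤-refl
    lower-mono n (suc d) = ≤-trans (lower-mono n d)
      (step-mono (lower (d ℕ.+ n)) (½^ (suc (d ℕ.+ n))) (sign? (d ℕ.+ n)) (½^-pos (suc (d ℕ.+ n))))

    upper-anti : ∀ n d → upper (d ℕ.+ n) ≤ upper n
    upper-anti n zero    = ≤-refl
    upper-anti n (suc d) = ≤-trans (step-anti (lower (d ℕ.+ n)) (½^ (d ℕ.+ n)) (sign? (d ℕ.+ n)) (½^-pos (d ℕ.+ n)))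
      (upper-anti n d)

    lower≤upper : ∀ n → lower n ≤ upper n
    lower≤upper n = a≤a+w (lower n) (½^-pos n)

    ≤lower : ∀ n t → n ℕ.≤ t → lower n ≤ lower t
    ≤lower n t n≤t = subst (λ s → lower n ≤ lower s) (ℕ.m∸n+n≡m n≤t) (lower-mono n (t ℕ.∸ n))

    upper≤ : ∀ n t → n ℕ.≤ t → upper t ≤ upper n
    upper≤ n t n≤t = subst (λ s → upper s ≤ upper n) (ℕ.m∸n+n≡m n≤t) (upper-anti n (t ℕ.∸ n))

    private
      within : ∀ {a w ε p q} → w < ε → a ≤ p → p ≤ a + w → a ≤ q → q ≤ a + w → ∣ p - q ∣ < ε
      within {a} {w} {ε} {p} {q} w<ε a≤p p≤ a≤q q≤ = ∣p∣<e
        (0<q-p⇒p<q (subst (0ℚ <_)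
          (solve 5 (λ a w e p q → (e :- w) :+ ((p :- a) :+ (a :+ w :- q)) := p :- q :- :- e) refl a w ε p q)
          (+-mono-<-≤ (p<q⇒0<q-p {w} {ε} w<ε) (+-nonNeg (p≤q⇒0≤q-p {a} {p} a≤p) (p≤q⇒0≤q-p {q} {a + w} q≤)))))
        (0<q-p⇒p<q (subst (0ℚ <_)
          (solve 5 (λ a w e p q → (e :- w) :+ ((q :- a) :+ (a :+ w :- p)) := e :- (p :- q)) refl a w ε p q)
          (+-mono-<-≤ (p<q⇒0<q-p {w} {ε} w<ε) (+-nonNeg (p≤q⇒0≤q-p {a} {q} a≤q) (p≤q⇒0≤q-p {p} {a + w} p≤)))))

      lower-close : ∀ ε → 0ℚ < ε → ∀ i j → ↧ₙ ε ℕ.≤ i → ↧ₙ ε ℕ.≤ j → ∣ lower i - lower j ∣ < ε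
      lower-close ε 0<ε i j ≤i ≤j = within {lower (↧ₙ ε)} {½^ (↧ₙ ε)} {ε} {lower i} {lower j}
        (½^-small ε 0<ε)
        (≤lower _ i ≤i) (≤-trans (lower≤upper i) (upper≤ _ i ≤i))
        (≤lower _ j ≤j) (≤-trans (lower≤upper j) (upper≤ _ j ≤j))

      upper-close : ∀ ε → 0ℚ < ε → ∀ i j → ↧ₙ ε ℕ.≤ i → ↧ₙ ε ℕ.≤ j → ∣ upper i - upper j ∣ < ε
      upper-close ε 0<ε i j ≤i ≤j = within {lower (↧ₙ ε)} {½^ (↧ₙ ε)} {ε} {upper i} {upper j}
        (½^-small ε 0<ε)
        (≤-trans (≤lower _ i ≤i) (lower≤upper i)) (upper≤ _ i ≤i)
        (≤-trans (≤lower _ j ≤j) (lower≤upper j)) (upper≤ _ j ≤j)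

      lower-upper-close : ∀ ε → 0ℚ < ε → ∀ i → ↧ₙ ε ℕ.≤ i → ∣ lower i - upper i ∣ < ε
      lower-upper-close ε 0<ε i ≤i = within {lower (↧ₙ ε)} {½^ (↧ₙ ε)} {ε} {lower i} {upper i}
        (½^-small ε 0<ε)
        (≤lower _ i ≤i) (≤-trans (lower≤upper i) (upper≤ _ i ≤i))
        (≤-trans (≤lower _ i ≤i) (lower≤upper i)) (upper≤ _ i ≤i)

    root upperℝ : ℝ
    root   = mkℝ lower λ ε 0<ε → ↧ₙ ε , lower-close ε 0<ε
    upperℝ = mkℝ upper λ ε 0<ε → ↧ₙ ε , upper-close ε 0<ε

    root≃upper : root Real.≃ upperℝ
    root≃upper ε 0<ε = ↧ₙ ε , lower-upper-close ε 0<ε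

    -- The values at the lower endpoints are negative and those at the upper endpoints are not,
    -- while continuity makes the two sequences close. A negative number close to a non-negative one
    -- is close to zero.
    root-isRoot : F root Real.≃ Real.0ℝ
    root-isRoot ε 0<ε =
      let N , close = pointwise-cong root upperℝ root≃upper F φ pointwise ε 0<ε
      in N , λ t N≤t → subst (λ p → ∣ p - 0ℚ ∣ < ε) (sym (pointwise root t))
        (signs (φ (lower t)) (φ (upper t)) (φlower<0 t) (0≤φupper t)
          (subst₂ (λ p q → ∣ p - q ∣ < ε) (pointwise root t) (pointwise upperℝ t) (close t N≤t)))
      where
      signs : ∀ p q → p < 0ℚ → 0ℚ ≤ q → ∣ p - q ∣ < ε → ∣ p - 0ℚ ∣ < ε
      signs p q p<0 0≤q p-q = subst (λ s → ∣ s ∣ < ε) (sym (p-0≡p p)) (∣p∣<e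
        (0<q-p⇒p<q (subst (0ℚ <_) (solve 3 (λ p q e → q :+ (p :+ e :- q) := p :- :- e) refl p q ε)
          (+-mono-≤-< 0≤q (p<q⇒0<q-p {q} {p + ε} (∣p-q∣<e⇒q<p+e {p} {q} p-q)))))
        (<-trans p<0 0<ε))

    lo≤root : Real.fromℚ lo Real.≤ root
    lo≤root ε 0<ε = 0 , λ t _ → ≤-<-trans (≤lower 0 t ℕ.z≤n)
      (subst (_< lower t + ε) (+-identityʳ (lower t)) (+-monoʳ-< (lower t) 0<ε))

    -- Once `½^ n < ε/2`, an upper endpoint exceeds the lower one by less than `ε/2`, and the lower
    -- endpoints increase. This lets bounds known only at rational points reach the root itself.
    ≤root : ∀ q → (∀ n → q Real.≤ Real.fromℚ (upper n)) → q Real.≤ root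
    ≤root q q≤upper ε 0<ε =
      let 0<½ε   = Real.half-pos 0<ε
          n      = ↧ₙ (ε * ½)
          N , q< = q≤upper n (ε * ½) 0<½ε
      in N ℕ.⊔ n , λ t ≤t → begin-strict
        seq q t                             <⟨ q< t (ℕ.m⊔n≤o⇒m≤o N n ≤t) ⟩
        lower n + ½^ n + ε * ½              <⟨ +-monoˡ-< (ε * ½) (+-monoʳ-< (lower n) (½^-small (ε * ½) 0<½ε)) ⟩
        lower n + ε * ½ + ε * ½             ≡⟨ a+w+w (lower n) ε ⟩
        lower n + ε                         ≤⟨ +-monoˡ-≤ ε (≤lower n t (ℕ.m⊔n≤o⇒n≤o N n ≤t)) ⟩
        lower t + ε                         ∎
      where open ≤-Reasoning

  -- Copies `quartic` term by term, including the factor `1ℚ` that unfolding `_^_` leaves behind, so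
  -- that the two agree by computation.
  quarticℚ : ℕ → ℚ → ℚ
  quarticℚ m x =
      x * (x * (x * (x * 1ℚ)))
    - (ℤ.+ 2 / 3) * (ι m + ι 10) * (x * (x * (x * 1ℚ)))
    + (ℤ.+ 2 / 3) * (ι 7 * ι m + ι 16) * (x * (x * 1ℚ))
    - (ι 10 * ι m - ι 7) * x
    + (ℤ.+ 4 / 3) * (ι 5 * ι m - ι 16)

  quartic-pointwise : ∀ m z t → seq (quartic m z) t ≡ quarticℚ m (seq z t)
  quartic-pointwise m z t = refl

-- Integer certificates for bounds on the signless Laplacian radius

module SignlessLaplacian where

  open CollatzWielandt
  open import Data.Rational.Base
  open import Data.Rational.Properties
  open import Algebra.Properties.CommutativeMonoid.Sum +-0-commutativeMonoid
    using () renaming (sum to sumℚ; sum-cong-≗ to sumℚ-cong; ∑-distrib-+ to sumℚ-distrib-+)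
  open import Algebra.Properties.CommutativeMonoid.Sum ℕ.+-0-commutativeMonoid
    using () renaming (sum to sumℕ)

  open Real using (ℝ; seq)

  sumℚ-0 : ∀ {n} (f : Fin n → ℚ) → (∀ i → f i ≡ 0ℚ) → sumℚ f ≡ 0ℚ
  sumℚ-0 {zero}  f h = refl
  sumℚ-0 {suc n} f h = trans (cong₂ _+_ (h zero) (sumℚ-0 (λ i → f (suc i)) (λ i → h (suc i)))) (+-identityʳ 0ℚ)

  sumℚ-diagonal : ∀ {n} (u : Fin n) a (y : Fin n → ℚ) →
    sumℚ (λ v → (if does (u Fin.≟ v) then a else 0ℚ) * y v) ≡ a * y u
  sumℚ-diagonal zero    a y = trans
    (cong (a * y zero +_) (sumℚ-0 (λ v → 0ℚ * y (suc v)) (λ v → *-zeroˡ (y (suc v)))))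
    (+-identityʳ (a * y zero))
  sumℚ-diagonal (suc u) a y = trans
    (cong₂ _+_ (*-zeroˡ (y zero)) (sumℚ-diagonal u a (λ v → y (suc v))))
    (+-identityˡ (a * y (suc u)))

  sumℚ-ι : ∀ {n} (f : Fin n → ℕ) → sumℚ (λ v → ι (f v)) ≡ ι (sumℕ f)
  sumℚ-ι {zero}  f = refl
  sumℚ-ι {suc n} f = trans (cong (ι (f zero) +_) (sumℚ-ι (λ v → f (suc v))))
    (sym (ι-+ (f zero) (sumℕ (λ v → f (suc v)))))

  module _ (G : FiniteGraph) where
    open FiniteGraph G

    signlessLaplacianℚ : Fin order → Fin order → ℚ
    signlessLaplacianℚ u v = (if does (u Fin.≟ v) then ι (degree u) else 0ℚ) + ι (adjacency u v)

    signlessLaplacian-entries : ∀ u v t → seq (signlessLaplacian u v) t ≡ signlessLaplacianℚ u v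
    signlessLaplacian-entries u v t = cong (_+ ι (adjacency u v)) (seq-if (does (u Fin.≟ v)))
      where
      seq-if : ∀ b → seq (if b then Real.fromℕ (degree u) else Real.0ℝ) t ≡ (if b then ι (degree u) else 0ℚ)
      seq-if true  = refl
      seq-if false = refl

    signlessLaplacianℚ-nonNeg : ∀ u v → 0ℚ ≤ signlessLaplacianℚ u v
    signlessLaplacianℚ-nonNeg u v = +-nonNeg (if-nonNeg (does (u Fin.≟ v))) (ι-nonNeg (adjacency u v))
      where
      if-nonNeg : ∀ b → 0ℚ ≤ (if b then ι (degree u) else 0ℚ)
      if-nonNeg true  = ι-nonNeg (degree u)
      if-nonNeg false = ≤-refl

    signlessLaplacianℚ-apply : ∀ (y : Fin order → ℚ) u →
      sumℚ (λ v → signlessLaplacianℚ u v * y v) ≡ ι (degree u) * y u + sumℚ (λ v → ι (adjacency u v) * y v)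
    signlessLaplacianℚ-apply y u = begin
      sumℚ (λ v → signlessLaplacianℚ u v * y v)
        ≡⟨ sumℚ-cong (λ v → *-distribʳ-+ (y v) (diagonal v) (ι (adjacency u v))) ⟩
      sumℚ (λ v → diagonal v * y v + ι (adjacency u v) * y v)
        ≡⟨ sumℚ-distrib-+ (λ v → diagonal v * y v) (λ v → ι (adjacency u v) * y v) ⟩
      sumℚ (λ v → diagonal v * y v) + sumℚ (λ v → ι (adjacency u v) * y v)
        ≡⟨ cong (_+ sumℚ (λ v → ι (adjacency u v) * y v)) (sumℚ-diagonal u (ι (degree u)) y) ⟩
      ι (degree u) * y u + sumℚ (λ v → ι (adjacency u v) * y v) ∎
      where
      open ≡-Reasoning
      diagonal : Fin order → ℚ
      diagonal v = if does (u Fin.≟ v) then ι (degree u) else 0ℚ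

    spectralRadius≤ : ∀ (y : Fin order → ℚ) → (∀ u → 0ℚ < y u) → ∀ μ → 0ℚ ≤ μ →
      (∀ u → ι (degree u) * y u + sumℚ (λ v → ι (adjacency u v) * y v) ≤ μ * y u) →
      ∀ q → IsSignlessLaplacianSpectralRadius q → q Real.≤ Real.fromℚ μ
    spectralRadius≤ y y>0 μ 0≤μ bound q (eigen , _) =
      collatz-wielandt signlessLaplacian signlessLaplacianℚ signlessLaplacian-entries
        signlessLaplacianℚ-nonNeg y y>0 μ 0≤μ
        (λ u → subst (_≤ μ * y u) (sym (signlessLaplacianℚ-apply y u)) (bound u)) q eigen

    -- This is `Q y ≤ (N / D) y` with the denominator cleared, so that a certificate for an upper
    -- bound is a statement about natural numbers only.
    Subinvariant : ℕ → ℕ → (Fin order → ℕ) → Set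
    Subinvariant N D y = ∀ u →
      D ℕ.* (degree u ℕ.* y u ℕ.+ sumℕ (λ v → adjacency u v ℕ.* y v)) ℕ.≤ N ℕ.* y u

    subinvariant⇒spectralRadius≤ : ∀ N D μ → 0 ℕ.< D → ι D * μ ≡ ι N →
      ∀ y → (∀ u → 0 ℕ.< y u) → Subinvariant N D y →
      ∀ q → IsSignlessLaplacianSpectralRadius q → q Real.≤ Real.fromℚ μ
    subinvariant⇒spectralRadius≤ N D μ 0<D Dμ≡N y y>0 sub =
      spectralRadius≤ (λ v → ι (y v)) (λ v → ι-pos (y v) (y>0 v)) μ 0≤μ bound
      where
      instance
        D-pos : Positive (ι D)
        D-pos = positive (ι-pos D 0<D)
      0≤μ : 0ℚ ≤ μ
      0≤μ = *-cancelˡ-≤-pos (ι D) (subst₂ _≤_ (sym (*-zeroʳ (ι D))) (sym Dμ≡N) (ι-nonNeg N))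
      bound : ∀ u → ι (degree u) * ι (y u) + sumℚ (λ v → ι (adjacency u v) * ι (y v)) ≤ μ * ι (y u)
      bound u = *-cancelˡ-≤-pos (ι D) (begin
        ι D * (ι (degree u) * ι (y u) + sumℚ (λ v → ι (adjacency u v) * ι (y v)))
          ≡⟨ cong (λ s → ι D * s) (cong₂ _+_ (sym (ι-* (degree u) (y u)))
               (trans (sumℚ-cong (λ v → sym (ι-* (adjacency u v) (y v))))
                      (sumℚ-ι (λ v → adjacency u v ℕ.* y v)))) ⟩
        ι D * (ι (degree u ℕ.* y u) + ι (sumℕ (λ v → adjacency u v ℕ.* y v)))
          ≡⟨ cong (ι D *_) (ι-+ (degree u ℕ.* y u) (sumℕ (λ v → adjacency u v ℕ.* y v))) ⟨
        ι D * ι (degree u ℕ.* y u ℕ.+ sumℕ (λ v → adjacency u v ℕ.* y v))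
          ≡⟨ ι-* D (degree u ℕ.* y u ℕ.+ sumℕ (λ v → adjacency u v ℕ.* y v)) ⟨
        ι (D ℕ.* (degree u ℕ.* y u ℕ.+ sumℕ (λ v → adjacency u v ℕ.* y v)))
          ≤⟨ ι-mono-≤ (D ℕ.* (degree u ℕ.* y u ℕ.+ sumℕ (λ v → adjacency u v ℕ.* y v))) (N ℕ.* y u) (sub u) ⟩
        ι (N ℕ.* y u)
          ≡⟨ ι-* N (y u) ⟩
        ι N * ι (y u)
          ≡⟨ cong (_* ι (y u)) Dμ≡N ⟨
        ι D * μ * ι (y u)
          ≡⟨ *-assoc (ι D) μ (ι (y u)) ⟩
        ι D * (μ * ι (y u)) ∎)
        where open ≤-Reasoning

  infixl 6 _⊕_
  infixl 7 _⊗_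

  -- One syntax with values in both `ℕ` and `ℚ`: inequalities are settled among natural numbers and
  -- carried over to the rationals by `ι-eval`.
  data Poly (n : ℕ) : Set where
    lit     : ℕ → Poly n
    var     : Fin n → Poly n
    _⊕_ _⊗_ : Poly n → Poly n → Poly n

  evalℕ : ∀ {n} → Poly n → Vec ℕ n → ℕ
  evalℕ (lit c) ρ = c
  evalℕ (var i) ρ = Vec.lookup ρ i
  evalℕ (p ⊕ q) ρ = evalℕ p ρ ℕ.+ evalℕ q ρ
  evalℕ (p ⊗ q) ρ = evalℕ p ρ ℕ.* evalℕ q ρ

  evalℚ : ∀ {n} → Poly n → Vec ℚ n → ℚ
  evalℚ (lit c) ρ = ι c
  evalℚ (var i) ρ = Vec.lookup ρ i
  evalℚ (p ⊕ q) ρ = evalℚ p ρ + evalℚ q ρ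
  evalℚ (p ⊗ q) ρ = evalℚ p ρ * evalℚ q ρ

  ι-eval : ∀ {n} (p : Poly n) ρ → ι (evalℕ p ρ) ≡ evalℚ p (Vec.map ι ρ)
  ι-eval (lit c) ρ = refl
  ι-eval (var i) ρ = sym (Vec.lookup-map i ι ρ)
  ι-eval (p ⊕ q) ρ = trans (ι-+ (evalℕ p ρ) (evalℕ q ρ)) (cong₂ _+_ (ι-eval p ρ) (ι-eval q ρ))
  ι-eval (p ⊗ q) ρ = trans (ι-* (evalℕ p ρ) (evalℕ q ρ)) (cong₂ _*_ (ι-eval p ρ) (ι-eval q ρ))

-- Polynomial inequalities behind the threshold and the weights

module Inequalities where

  open SignlessLaplacian
  open import Data.Nat.Base
  open import Data.Nat.Properties
  open import Data.Nat.Solver using (module +-*-Solver)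
  open +-*-Solver

  -- Turns a polynomial inequality into an identity for the ring solver. In terms of `j = k − 6` the
  -- differences needed below have natural coefficients, so they can be given outright as `e`, in
  -- Horner form.
  ≡+⇒≤ : ∀ {m n} e → m + e ≡ n → m ≤ n
  ≡+⇒≤ {m} e refl = m≤m+n m e

  -- For `m = 3κ + 2` and `x = n / d`, the quartic times `d⁴` equals `quartic⁺ − quartic⁻`;
  -- separating the signs avoids subtraction in `ℕ`.
  quartic⁺ quartic⁻ : Poly 3
  quartic⁺ = n ⊗ n ⊗ n ⊗ n ⊕ (lit 14 ⊗ κ ⊕ lit 20) ⊗ n ⊗ n ⊗ d ⊗ d ⊕ lit 20 ⊗ κ ⊗ d ⊗ d ⊗ d ⊗ d
    where κ = var 0F ; d = var 1F ; n = var 2F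
  quartic⁻ = (lit 2 ⊗ κ ⊕ lit 8) ⊗ n ⊗ n ⊗ n ⊗ d ⊕ (lit 30 ⊗ κ ⊕ lit 13) ⊗ n ⊗ d ⊗ d ⊗ d ⊕ lit 8 ⊗ d ⊗ d ⊗ d ⊗ d
    where κ = var 0F ; d = var 1F ; n = var 2F

  -- The threshold num k / den k = 2k + 1 + 5/(5k + 1) separates the spectral
  -- radius of the extremal graph from those of its competitors.
  den num : ℕ → ℕ
  den k = 5 * k + 1
  num k = (2 * k + 1) * den k + 5

  private
    module _ {n : ℕ} where
      den′ num′ : Polynomial n → Polynomial n
      den′ k = con 5 :* k :+ con 1
      num′ k = (con 2 :* k :+ con 1) :* den′ k :+ con 5

      pos′ neg′ : Polynomial n → Polynomial n → Polynomial n → Polynomial n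
      pos′ κ d n = n :* n :* n :* n :+ (con 14 :* κ :+ con 20) :* n :* n :* d :* d :+ con 20 :* κ :* d :* d :* d :* d
      neg′ κ d n = (con 2 :* κ :+ con 8) :* n :* n :* n :* d :+ (con 30 :* κ :+ con 13) :* n :* d :* d :* d :+ con 8 :* d :* d :* d :* d

  quartic-negative-at-threshold : ∀ j → let k = j + 6 in
    evalℕ quartic⁺ (k ∷ den k ∷ num k ∷ []) < evalℕ quartic⁻ (k ∷ den k ∷ num k ∷ [])
  quartic-negative-at-threshold j = ≡+⇒≤
    (j * (j * (j * (j * (j * 1000 + 26100) + 271945) + 1414453) + 3675045) + 3820279)
    (solve 1 (λ j → let k = j :+ con 6 in
      (con 1 :+ pos′ k (den′ k) (num′ k)) :+
      (j :* (j :* (j :* (j :* (j :* con 1000 :+ con 26100) :+ con 271945) :+ con 1414453) :+ con 3675045) :+ con 3820279)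
      := neg′ k (den′ k) (num′ k)) refl j)

  -- The fraction `(num k + den k) / den k` is the threshold plus 1, the other end of the bisection
  -- interval.
  quartic-nonNegative-beyond-threshold : ∀ j → let k = j + 6 in
    evalℕ quartic⁻ (k ∷ den k ∷ num k + den k ∷ []) ≤ evalℕ quartic⁺ (k ∷ den k ∷ num k + den k ∷ [])
  quartic-nonNegative-beyond-threshold j = ≡+⇒≤
    (j * (j * (j * (j * (j * (j * (j * 5000 + 211500) + 3840950) + 38820960) + 235842223) + 861206627) + 1750256801) + 1527221980)
    (solve 1 (λ j → let k = j :+ con 6 in
      neg′ k (den′ k) (num′ k :+ den′ k) :+
      (j :* (j :* (j :* (j :* (j :* (j :* (j :* con 5000 :+ con 211500) :+ con 3840950) :+ con 38820960) :+ con 235842223) :+ con 861206627) :+ con 1750256801) :+ con 1527221980)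
      := pos′ k (den′ k) (num′ k :+ den′ k)) refl j)

  -- With D = den k and num k = 6 D + E, these weights satisfy the eigenvalue
  -- equation for num k / den k away from the centre.
  module SquareWeights (D E : ℕ) where
    -- Put `q = 6 + E / D`. Divided by `D³`, the weights are `(q − 3)((q − 2)(q − 4) − 4)` at the
    -- centre, `(q − 2)(q − 4) − 4` on triangles, `(q − 4)(q − 3)` on squares and `4(q − 3)` at a
    -- far vertex. They come from solving the equations outwards from the centre, with a far vertex
    -- adjacent to four square vertices. Writing the threshold as `6 D + E` keeps `q − 2`, `q − 3`
    -- and `q − 4` free of subtraction.
    common centreW triangleW squareW farW : ℕ
    common    = E * E + 6 * D * E + 4 * D * D
    centreW   = (E + 3 * D) * common
    triangleW = D * common
    squareW   = D * (E + 2 * D) * (E + 3 * D)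
    farW      = 4 * D * D * (E + 3 * D)

    triangle-identity : D * (2 * triangleW + (centreW + triangleW)) ≡ (6 * D + E) * triangleW
    triangle-identity = solve 2 (λ D E →
        let c = E :* E :+ con 6 :* D :* E :+ con 4 :* D :* D ; t = D :* c in
        D :* (con 2 :* t :+ ((E :+ con 3 :* D) :* c :+ t)) := (con 6 :* D :+ E) :* t) refl D E

    square-identity : D * (2 * squareW + (centreW + farW)) ≡ (6 * D + E) * squareW
    square-identity = solve 2 (λ D E →
        let c = E :* E :+ con 6 :* D :* E :+ con 4 :* D :* D
            s = D :* (E :+ con 2 :* D) :* (E :+ con 3 :* D) in
        D :* (con 2 :* s :+ ((E :+ con 3 :* D) :* c :+ con 4 :* D :* D :* (E :+ con 3 :* D)))
          := (con 6 :* D :+ E) :* s) refl D E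

    far-identity : D * (4 * farW + 4 * squareW) ≡ (6 * D + E) * farW
    far-identity = solve 2 (λ D E →
        let f = con 4 :* D :* D :* (E :+ con 3 :* D)
            s = D :* (E :+ con 2 :* D) :* (E :+ con 3 :* D) in
        D :* (con 4 :* f :+ con 4 :* s) := (con 6 :* D :+ E) :* f) refl D E

  excess : ℕ → ℕ
  excess j = (2 * j + 7) * den (j + 6) + 5

  num≡ : ∀ j → num (j + 6) ≡ 6 * den (j + 6) + excess j
  num≡ = solve 1 (λ j → let D = den′ (j :+ con 6) in
    num′ (j :+ con 6) := con 6 :* D :+ ((con 2 :* j :+ con 7) :* D :+ con 5)) refl

  module _ (j : ℕ) where
    private
      k = j + 6
      D = den k
      E = excess j
    open SquareWeights D E

    squareWeights-triangle : ∀ {w} → w ≤ centreW + triangleW →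
      D * (2 * triangleW + w) ≤ num k * triangleW
    squareWeights-triangle {w} w≤ = begin
      D * (2 * triangleW + w)                     ≤⟨ *-monoʳ-≤ D (+-monoʳ-≤ (2 * triangleW) w≤) ⟩
      D * (2 * triangleW + (centreW + triangleW)) ≡⟨ triangle-identity ⟩
      (6 * D + E) * triangleW                     ≡⟨ cong (_* triangleW) (num≡ j) ⟨
      num k * triangleW                           ∎
      where open ≤-Reasoning

    squareWeights-square : ∀ {w} → w ≤ centreW + farW →
      D * (2 * squareW + w) ≤ num k * squareW
    squareWeights-square {w} w≤ = begin
      D * (2 * squareW + w)                  ≤⟨ *-monoʳ-≤ D (+-monoʳ-≤ (2 * squareW) w≤) ⟩
      D * (2 * squareW + (centreW + farW))   ≡⟨ square-identity ⟩
      (6 * D + E) * squareW                  ≡⟨ cong (_* squareW) (num≡ j) ⟨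
      num k * squareW                        ∎
      where open ≤-Reasoning

    squareWeights-far : ∀ {d w} → d ≤ 4 → w ≤ d * squareW →
      D * (d * farW + w) ≤ num k * farW
    squareWeights-far {d} {w} d≤4 w≤ = begin
      D * (d * farW + w)              ≤⟨ *-monoʳ-≤ D (+-mono-≤ (*-monoˡ-≤ farW d≤4) (≤-trans w≤ (*-monoˡ-≤ squareW d≤4))) ⟩
      D * (4 * farW + 4 * squareW)    ≡⟨ far-identity ⟩
      (6 * D + E) * farW              ≡⟨ cong (_* farW) (num≡ j) ⟨
      num k * farW                    ∎
      where open ≤-Reasoning

    -- The one row that holds with slack rather than by construction. The centre has `2k = 2j + 12`
    -- neighbours, of which `2k − 4` lie on triangles and 4 on squares.
    squareWeights-centre : ∀ {w} → w ≤ (2 * j + 8) * triangleW + 4 * squareW →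
      D * ((2 * j + 12) * centreW + w) ≤ num k * centreW
    squareWeights-centre {w} w≤ = ≤-trans
      (*-monoʳ-≤ D (+-monoʳ-≤ ((2 * j + 12) * centreW) w≤))
      (≡+⇒≤ (j * (j * (j * (j * (j * 1500 + 38900) + 380455) + 1686662) + 3038248) + 937600)
        (solve 1 (λ j →
          let k = j :+ con 6 ; D = den′ k ; E = (con 2 :* j :+ con 7) :* D :+ con 5
              c = E :* E :+ con 6 :* D :* E :+ con 4 :* D :* D
              y = (E :+ con 3 :* D) :* c
              s = D :* (E :+ con 2 :* D) :* (E :+ con 3 :* D) in
          D :* ((con 2 :* j :+ con 12) :* y :+ ((con 2 :* j :+ con 8) :* (D :* c) :+ con 4 :* s)) :+
          (j :* (j :* (j :* (j :* (j :* con 1500 :+ con 38900) :+ con 380455) :+ con 1686662) :+ con 3038248) :+ con 937600)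
          := num′ k :* y) refl j))

    private
      1≤D : 1 ≤ D
      1≤D = m≤n+m 1 (5 * k)
      0<E+nD : ∀ n → 0 < E + suc n * D
      0<E+nD n = ≤-trans 1≤D (≤-trans (m≤m+n D (n * D)) (m≤n+m (suc n * D) E))

    0<common : 0 < common
    0<common = ≤-trans (*-mono-≤ {1} {4 * D} {1} {D} (≤-trans 1≤D (m≤n*m D 4)) 1≤D)
      (m≤n+m (4 * D * D) (E * E + 6 * D * E))

    0<centreW : 0 < centreW
    0<centreW = *-mono-≤ {1} {E + 3 * D} {1} {common} (0<E+nD 2) 0<common

    0<triangleW : 0 < triangleW
    0<triangleW = *-mono-≤ {1} {D} {1} {common} 1≤D 0<common

    0<squareW : 0 < squareW
    0<squareW = *-mono-≤ {1} {D * (E + 2 * D)} {1} {E + 3 * D}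
      (*-mono-≤ {1} {D} {1} {E + 2 * D} 1≤D (0<E+nD 1)) (0<E+nD 2)

    0<farW : 0 < farW
    0<farW = *-mono-≤ {1} {4 * D * D} {1} {E + 3 * D}
      (*-mono-≤ {1} {4 * D} {1} {D} (≤-trans 1≤D (m≤n*m D 4)) 1≤D) (0<E+nD 2)

  module _ (j : ℕ) where
    private
      k = j + 6
      D = den k

    -- t is the sum of 7 d(v) ∸ 1 and s the sum of d(v) over the d neighbours v.
    module _ (s t : ℕ) where

      -- The smallest degree, with weight `13 = 7 · 2 − 1`. At `k = 6` this case bounds the shift of
      -- the weights from above, with a final slack of only 3.
      degreeWeight-two : 2 * s ≤ 2 * (3 * k + 2) + 2 → t + 2 ≡ 7 * s → D * (2 * 13 + t) ≤ num k * 13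
      degreeWeight-two 2s≤ t+2≡ = begin
        D * (26 + t)                   ≤⟨ *-monoʳ-≤ D (+-monoʳ-≤ 26 t≤) ⟩
        D * (26 + (21 * k + 19))       ≤⟨ ≡+⇒≤ (j * (j * 25 + 145) + 3) (solve 1 (λ j → let k = j :+ con 6 in
                                            den′ k :* (con 26 :+ (con 21 :* k :+ con 19)) :+ (j :* (j :* con 25 :+ con 145) :+ con 3)
                                            := num′ k :* con 13) refl j) ⟩
        num k * 13                     ∎
        where
        open ≤-Reasoning
        s≤ : s ≤ 3 * k + 3
        s≤ = *-cancelˡ-≤ 2 (≤-trans 2s≤ (≤-reflexive (solve 1 (λ k →
          con 2 :* (con 3 :* k :+ con 2) :+ con 2 := con 2 :* (con 3 :* k :+ con 3)) refl k)))
        t≤ : t ≤ 21 * k + 19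
        t≤ = +-cancelʳ-≤ 2 t _ (begin
          t + 2             ≡⟨ t+2≡ ⟩
          7 * s             ≤⟨ *-monoʳ-≤ 7 s≤ ⟩
          7 * (3 * k + 3)   ≡⟨ solve 1 (λ k → con 7 :* (con 3 :* k :+ con 3) := con 21 :* k :+ con 19 :+ con 2) refl k ⟩
          21 * k + 19 + 2   ∎)

      -- The case `d = 2k − 1`, with weight `7d − 1`. Integrality matters: `2s ≤ 8k + 3` is rounded
      -- to `s ≤ 4k + 1`, and the value `4k + 3/2` would already be too large at `k = 6`.
      degreeWeight-large : let d = 2 * j + 11 ; y = 14 * j + 76 in
        2 * s ≤ 2 * (3 * k + 2) + d → t + d ≡ 7 * s → D * (d * y + t) ≤ num k * y
      degreeWeight-large 2s≤ t+d≡ = begin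
        D * (d * y + t)                ≤⟨ *-monoʳ-≤ D (+-monoʳ-≤ (d * y) t≤) ⟩
        D * (d * y + (26 * k + 8))     ≤⟨ ≡+⇒≤ (j * (j * 10 + 72) + 8) (solve 1 (λ j →
                                            let k = j :+ con 6 ; d = con 2 :* j :+ con 11 ; y = con 14 :* j :+ con 76 in
                                            den′ k :* (d :* y :+ (con 26 :* k :+ con 8)) :+ (j :* (j :* con 10 :+ con 72) :+ con 8)
                                            := num′ k :* y) refl j) ⟩
        num k * y                      ∎
        where
        open ≤-Reasoning
        d = 2 * j + 11
        y = 14 * j + 76
        s≤ : s ≤ 4 * k + 1
        s≤ = ≤-pred (*-cancelˡ-< 2 s (suc (4 * k + 1)) (begin-strict
          2 * s                        ≤⟨ 2s≤ ⟩
          2 * (3 * k + 2) + d          <⟨ n<1+n _ ⟩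
          1 + (2 * (3 * k + 2) + d)    ≡⟨ solve 1 (λ j → let k = j :+ con 6 in
            con 1 :+ (con 2 :* (con 3 :* k :+ con 2) :+ (con 2 :* j :+ con 11))
            := con 2 :* (con 1 :+ (con 4 :* k :+ con 1))) refl j ⟩
          2 * suc (4 * k + 1)          ∎))
        t≤ : t ≤ 26 * k + 8
        t≤ = +-cancelʳ-≤ d t _ (begin
          t + d              ≡⟨ t+d≡ ⟩
          7 * s              ≤⟨ *-monoʳ-≤ 7 s≤ ⟩
          7 * (4 * k + 1)    ≡⟨ solve 1 (λ j → let k = j :+ con 6 in
            con 7 :* (con 4 :* k :+ con 1) := con 26 :* k :+ con 8 :+ (con 2 :* j :+ con 11)) refl j ⟩
          26 * k + 8 + d     ∎)

      -- For `3 ≤ d ≤ 2k − 2` even the value `2k + 1` is large enough: since `d + (b + 3) = 2k + 1`,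
      -- the claim becomes `t ≤ (b + 3) y`.
      degreeWeight-middle : ∀ a b → 2 * k ≡ 5 + a + b → let d = 3 + a ; y = 20 + 7 * a in
        2 * s ≤ 2 * (3 * k + 2) + d → t + d ≡ 7 * s → D * (d * y + t) ≤ num k * y
      degreeWeight-middle a b 2k≡ 2s≤ t+d≡ = begin
        D * (d * y + t)              ≤⟨ *-monoʳ-≤ D (+-monoʳ-≤ (d * y) t≤) ⟩
        D * (d * y + (b + 3) * y)    ≡⟨ solve 3 (λ D a b → let y = con 20 :+ con 7 :* a in
                                          D :* ((con 3 :+ a) :* y :+ (b :+ con 3) :* y)
                                          := (con 5 :+ a :+ b :+ con 1) :* D :* y) refl D a b ⟩
        (5 + a + b + 1) * D * y      ≡⟨ cong (λ 2k → (2k + 1) * D * y) 2k≡ ⟨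
        (2 * k + 1) * D * y          ≤⟨ *-monoˡ-≤ y (m≤m+n ((2 * k + 1) * D) 5) ⟩
        num k * y                    ∎
        where
        open ≤-Reasoning
        d = 3 + a
        y = 20 + 7 * a
        -- Inserting the bound on `s`, the gap between `2 (b + 3) y` and `2t` is at least
        -- `14ab + 16a + 19b − 28`. As `a + b = 2k − 5 ≥ 7`, the linear terms alone outweigh the
        -- constant.
        28≤ : 28 ≤ 16 * a + 19 * b
        28≤ = begin
          28                        ≤⟨ m≤m+n 28 _ ⟩
          28 + (84 + 32 * j)        ≡⟨ solve 1 (λ j → con 28 :+ (con 84 :+ con 32 :* j) :=
                                         con 16 :* (con 2 :* j :+ con 7)) refl j ⟩
          16 * (2 * j + 7)          ≡⟨ cong (16 *_) (+-cancelˡ-≡ 5 (2 * j + 7) (a + b)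
                                         (trans (solve 1 (λ j → con 5 :+ (con 2 :* j :+ con 7) := con 2 :* (j :+ con 6)) refl j) 2k≡)) ⟩
          16 * (a + b)              ≤⟨ ≡+⇒≤ (3 * b) (solve 2 (λ a b → con 16 :* (a :+ b) :+ con 3 :* b
                                         := con 16 :* a :+ con 19 :* b) refl a b) ⟩
          16 * a + 19 * b           ∎
        t≤ : t ≤ (b + 3) * y
        t≤ = *-cancelˡ-≤ 2 (+-cancelʳ-≤ (6 + 2 * a + 28) (2 * t) _ (begin
          2 * t + (6 + 2 * a + 28)
            ≡⟨ solve 2 (λ t a → con 2 :* t :+ (con 6 :+ con 2 :* a :+ con 28) := con 2 :* (t :+ (con 3 :+ a)) :+ con 28) refl t a ⟩
          2 * (t + d) + 28
            ≡⟨ cong (λ x → 2 * x + 28) t+d≡ ⟩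
          2 * (7 * s) + 28
            ≡⟨ solve 1 (λ s → con 2 :* (con 7 :* s) :+ con 28 := con 7 :* (con 2 :* s) :+ con 28) refl s ⟩
          7 * (2 * s) + 28
            ≤⟨ +-mono-≤ (*-monoʳ-≤ 7 2s≤) 28≤ ⟩
          7 * (2 * (3 * k + 2) + d) + (16 * a + 19 * b)
            ≡⟨ solve 3 (λ k a b → con 7 :* (con 2 :* (con 3 :* k :+ con 2) :+ (con 3 :+ a)) :+ (con 16 :* a :+ con 19 :* b)
               := con 21 :* (con 2 :* k) :+ (con 49 :+ con 23 :* a :+ con 19 :* b)) refl k a b ⟩
          21 * (2 * k) + (49 + 23 * a + 19 * b)
            ≡⟨ cong (λ 2k → 21 * 2k + (49 + 23 * a + 19 * b)) 2k≡ ⟩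
          21 * (5 + a + b) + (49 + 23 * a + 19 * b)
            ≤⟨ ≡+⇒≤ (14 * a * b) (solve 2 (λ a b →
               con 21 :* (con 5 :+ a :+ b) :+ (con 49 :+ con 23 :* a :+ con 19 :* b) :+ con 14 :* a :* b
               := con 2 :* ((b :+ con 3) :* (con 20 :+ con 7 :* a)) :+ (con 6 :+ con 2 :* a :+ con 28)) refl a b) ⟩
          2 * ((b + 3) * y) + (6 + 2 * a + 28) ∎))

    -- The weights are proportional to `d − c` with `c = 1/7`. Plain degrees, `c = 0`, fail at
    -- `d = 2k − 1`, where `s = 4k + 1` would give `2k + 1 + 3/(2k − 1)`. At `k = 6` the cases
    -- `d = 11` (with `s ≤ 25`) and `d = 2` (with `s ≤ 21`) demand `38/274 ≤ c ≤ 41/284`, an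
    -- interval that contains `1/7`.
    degreeWeight-bound : ∀ d s t → 2 ≤ d → d < 2 * k →
      2 * s ≤ 2 * (3 * k + 2) + d → t + d ≡ 7 * s → D * (d * (7 * d ∸ 1) + t) ≤ num k * (7 * d ∸ 1)
    degreeWeight-bound (suc zero) s t (s≤s ())
    degreeWeight-bound (suc (suc zero)) s t _ _ 2s≤ t+d≡ = degreeWeight-two s t 2s≤ t+d≡
    degreeWeight-bound (suc (suc (suc a))) s t _ d<2k 2s≤ t+d≡ = helper (m≤n⇒∃[o]m+o≡n d<2k)
      where
      Goal : ℕ → ℕ → Set
      Goal d y = D * (d * y + t) ≤ num k * y
      y≡ : 20 + 7 * a ≡ 7 * (3 + a) ∸ 1
      y≡ = sym (cong (_∸ 1) (solve 1 (λ a → con 7 :* (con 3 :+ a) := con 1 :+ (con 20 :+ con 7 :* a)) refl a))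
      helper : ∃[ b ] suc (3 + a) + b ≡ 2 * k → Goal (3 + a) (7 * (3 + a) ∸ 1)
      helper (suc b , eq) = subst (Goal (3 + a)) y≡ (degreeWeight-middle s t a b
        (trans (sym eq) (solve 2 (λ a b → con 4 :+ a :+ (con 1 :+ b) := con 5 :+ a :+ b) refl a b)) 2s≤ t+d≡)
      helper (zero  , eq) = subst₂ Goal d≡ (trans (trans
          (solve 1 (λ j → con 14 :* j :+ con 76 := con 20 :+ con 7 :* (con 2 :* j :+ con 8)) refl j)
          (cong (λ a → 20 + 7 * a) (+-cancelˡ-≡ 3 (2 * j + 8) a (trans (sym (11≡3+8 j)) d≡)))) y≡)
        (degreeWeight-large s t (subst (λ d → 2 * s ≤ 2 * (3 * k + 2) + d) (sym d≡) 2s≤)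
                                (subst (λ d → t + d ≡ 7 * s) (sym d≡) t+d≡))
        where
        11≡3+8 : ∀ j → 2 * j + 11 ≡ 3 + (2 * j + 8)
        11≡3+8 = solve 1 (λ j → con 2 :* j :+ con 11 := con 3 :+ (con 2 :* j :+ con 8)) refl
        d≡ : 2 * j + 11 ≡ 3 + a
        d≡ = +-cancelˡ-≡ 1 _ _ (sym (trans (sym (+-identityʳ (4 + a))) (trans eq
          (solve 1 (λ j → con 2 :* (j :+ con 6) := con 1 :+ (con 2 :* j :+ con 11)) refl j))))

-- Finite sums and degree counting

module Counting where

  open import Data.Nat.Base
  open import Data.Nat.Properties
  open import Data.Nat.Solver using (module +-*-Solver)
  open import Algebra.Properties.Semiring.Sum +-*-semiring using (*-distribˡ-sum)
  open import Algebra.Properties.CommutativeMonoid.Sum +-0-commutativeMonoid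
    using (sum; sum-cong-≗; ∑-distrib-+; ∑-comm)

  -- Over an arbitrary commutative monoid, because explicit lists of vertices serve both to count in
  -- `ℕ` and to evaluate rows of the eigenvalue equation in `ℚ`.
  module ListSum {c ℓ} (M : CommutativeMonoid c ℓ) where
    open CommutativeMonoid M renaming (refl to ≈-refl; sym to ≈-sym; trans to ≈-trans)
    open import Algebra.Properties.CommutativeMonoid.Sum M using () renaming (sum to ∑)
    open import Relation.Binary.Reasoning.Setoid setoid

    sumL : ∀ {A : Set} → (A → Carrier) → List A → Carrier
    sumL f = foldr (λ v s → f v ∙ s) ε

    erase : ∀ {n} → Fin n → (Fin n → Carrier) → Fin n → Carrier
    erase v f w = if does (w Fin.≟ v) then ε else f w

    erase-self : ∀ {n} (v : Fin n) f → erase v f v ≡ ε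
    erase-self v f rewrite dec-true (v Fin.≟ v) refl = refl

    erase-other : ∀ {n} {v w : Fin n} f → w ≢ v → erase v f w ≡ f w
    erase-other {v = v} {w} f w≢v rewrite dec-false (w Fin.≟ v) w≢v = refl

    ∑-erase : ∀ {n} (v : Fin n) f → ∑ f ≈ f v ∙ ∑ (erase v f)
    ∑-erase zero    f = ∙-congˡ (≈-sym (identityˡ _))
    ∑-erase (suc v) f = begin
      f zero ∙ ∑ (f ∘ suc)                                ≈⟨ ∙-congˡ (∑-erase v (f ∘ suc)) ⟩
      f zero ∙ (f (suc v) ∙ ∑ (erase v (f ∘ suc)))        ≈⟨ assoc _ _ _ ⟨
      (f zero ∙ f (suc v)) ∙ ∑ (erase v (f ∘ suc))        ≈⟨ ∙-congʳ (comm _ _) ⟩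
      (f (suc v) ∙ f zero) ∙ ∑ (erase v (f ∘ suc))        ≈⟨ assoc _ _ _ ⟩
      f (suc v) ∙ (f zero ∙ ∑ (erase v (f ∘ suc)))        ∎

    eraseAll : ∀ {n} → List (Fin n) → (Fin n → Carrier) → Fin n → Carrier
    eraseAll L f = foldr erase f L

    eraseAll-∉ : ∀ {n} (L : List (Fin n)) f {w} → All (w ≢_) L → eraseAll L f w ≡ f w
    eraseAll-∉ []      f []          = refl
    eraseAll-∉ (v ∷ L) f (w≢v ∷ w≢L) = trans (erase-other (eraseAll L f) w≢v) (eraseAll-∉ L f w≢L)

    eraseAll-∈ : ∀ {n} (L : List (Fin n)) f {w} → w ∈ L → eraseAll L f w ≡ ε
    eraseAll-∈ (v ∷ L) f (here refl) = erase-self v (eraseAll L f)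
    eraseAll-∈ (v ∷ L) f {w} (there w∈L) with does (w Fin.≟ v)
    ... | true  = refl
    ... | false = eraseAll-∈ L f w∈L

    ∑-split : ∀ {n} (L : List (Fin n)) f → Unique L → ∑ f ≈ sumL f L ∙ ∑ (eraseAll L f)
    ∑-split []      f _         = ≈-sym (identityˡ _)
    ∑-split (v ∷ L) f (v∉L ∷ u) = begin
      ∑ f                                                          ≈⟨ ∑-split L f u ⟩
      sumL f L ∙ ∑ (eraseAll L f)                                  ≈⟨ ∙-congˡ (∑-erase v (eraseAll L f)) ⟩
      sumL f L ∙ (eraseAll L f v ∙ ∑ (eraseAll (v ∷ L) f))         ≈⟨ ∙-congˡ (∙-congʳ (reflexive (eraseAll-∉ L f v∉L))) ⟩
      sumL f L ∙ (f v ∙ ∑ (eraseAll (v ∷ L) f))                    ≈⟨ assoc _ _ _ ⟨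
      (sumL f L ∙ f v) ∙ ∑ (eraseAll (v ∷ L) f)                    ≈⟨ ∙-congʳ (comm _ _) ⟩
      (f v ∙ sumL f L) ∙ ∑ (eraseAll (v ∷ L) f)                    ∎

    ∑-ε : ∀ {n} (f : Fin n → Carrier) → (∀ i → f i ≈ ε) → ∑ f ≈ ε
    ∑-ε {zero}  f h = ≈-refl
    ∑-ε {suc n} f h = ≈-trans (∙-cong (h zero) (∑-ε (f ∘ suc) (h ∘ suc))) (identityˡ ε)

    ∑-support : ∀ {n} (L : List (Fin n)) f → Unique L → (∀ w → w ∈ L ⊎ f w ≈ ε) → ∑ f ≈ sumL f L
    ∑-support L f u supp = begin
      ∑ f                           ≈⟨ ∑-split L f u ⟩
      sumL f L ∙ ∑ (eraseAll L f)   ≈⟨ ∙-congˡ (∑-ε (eraseAll L f) vanish) ⟩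
      sumL f L ∙ ε                  ≈⟨ identityʳ _ ⟩
      sumL f L                      ∎
      where
      erase-ε : ∀ L w → f w ≈ ε → eraseAll L f w ≈ ε
      erase-ε []      w fw = fw
      erase-ε (v ∷ L) w fw with does (w Fin.≟ v)
      ... | true  = ≈-refl
      ... | false = erase-ε L w fw
      vanish : ∀ w → eraseAll L f w ≈ ε
      vanish w = [ (λ w∈L → reflexive (eraseAll-∈ L f w∈L)) , erase-ε L w ]′ (supp w)

  open ListSum +-0-commutativeMonoid using (∑-erase; erase; erase-self; erase-other; ∑-ε; ∑-split; sumL)

  sum-mono : ∀ {n} {f g : Fin n → ℕ} → (∀ i → f i ≤ g i) → sum f ≤ sum g
  sum-mono {zero}  h = z≤n
  sum-mono {suc n} h = +-mono-≤ (h zero) (sum-mono (h ∘ suc))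

  term≤sum : ∀ {n} (f : Fin n → ℕ) i → f i ≤ sum f
  term≤sum f i = ≤-trans (m≤m+n (f i) _) (≤-reflexive (sym (∑-erase i f)))

  two-terms≤sum : ∀ {n} (f : Fin n → ℕ) {i j} → i ≢ j → f i + f j ≤ sum f
  two-terms≤sum f {i} {j} i≢j = ≤-trans
    (+-monoʳ-≤ (f i) (≤-trans (≤-reflexive (sym (erase-other f (i≢j ∘ sym)))) (term≤sum (erase i f) j)))
    (≤-reflexive (sym (∑-erase i f)))

  sum>0⇒∃ : ∀ {n} (f : Fin n → ℕ) → 0 < sum f → ∃[ i ] 0 < f i
  sum>0⇒∃ {suc n} f 0<Σ with f zero in eq
  ... | suc _ = zero , subst (0 <_) (sym eq) (s≤s z≤n)
  ... | zero  with sum>0⇒∃ (f ∘ suc) 0<Σ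
  ...   | i , 0<fi = suc i , 0<fi

  -- The form in which a degree or a neighbour count of at least 2 yields a neighbour different from
  -- a given one.
  sum>term⇒∃ : ∀ {n} (f : Fin n → ℕ) i → f i < sum f → ∃[ j ] j ≢ i × 0 < f j
  sum>term⇒∃ f i fi<Σ with sum>0⇒∃ (erase i f) (+-cancelˡ-< (f i) 0 _
    (subst₂ _<_ (sym (+-identityʳ (f i))) (∑-erase i f) fi<Σ))
  ... | j , 0<ej with j Fin.≟ i
  ...   | no j≢i = j , j≢i , 0<ej

  module GraphFacts (G : FiniteGraph) where
    open FiniteGraph G public renaming (symmetric to Adj-sym; irreflexive to Adj-irr)

    adjacency-1 : ∀ {v w} → Adj v w → adjacency v w ≡ 1
    adjacency-1 {v} {w} vw rewrite dec-true (adj? v w) vw = refl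

    adjacency-0 : ∀ {v w} → ¬ Adj v w → adjacency v w ≡ 0
    adjacency-0 {v} {w} ¬vw rewrite dec-false (adj? v w) ¬vw = refl

    adjacency>0⇒Adj : ∀ {v w} → 0 < adjacency v w → Adj v w
    adjacency>0⇒Adj {v} {w} 0<A with adj? v w
    ... | yes vw = vw

    adjacency≤1 : ∀ v w → adjacency v w ≤ 1
    adjacency≤1 v w with adj? v w
    ... | yes _ = ≤-refl
    ... | no  _ = z≤n

    adjacency-sym : ∀ v w → adjacency v w ≡ adjacency w v
    adjacency-sym v w with adj? v w
    ... | yes vw = sym (adjacency-1 (Adj-sym vw))
    ... | no ¬vw = sym (adjacency-0 (¬vw ∘ Adj-sym))

    Adj⇒≢ : ∀ {v w} → Adj v w → v ≢ w
    Adj⇒≢ vw v≡w = Adj-irr v≡w vw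

    other-neighbour : ∀ {v x} → 2 ≤ degree v → ∃[ y ] y ≢ x × Adj v y
    other-neighbour {v} {x} 2≤d with sum>term⇒∃ (adjacency v) x (≤-trans (s≤s (adjacency≤1 v x)) 2≤d)
    ... | y , y≢x , 0<A = y , y≢x , adjacency>0⇒Adj 0<A

    handshake : sum degree ≡ 2 * size
    handshake = begin
      sum (λ v → sum (λ w → adjacency v w))
        ≡⟨ sum-cong-≗ (λ v → trans (sum-cong-≗ (split v)) (∑-distrib-+ (up v) (λ w → up w v))) ⟩
      sum (λ v → sum (up v) + sum (λ w → up w v))
        ≡⟨ ∑-distrib-+ (λ v → sum (up v)) (λ v → sum (λ w → up w v)) ⟩
      size + sum (λ v → sum (λ w → up w v))
        ≡⟨ cong (size +_) (∑-comm (λ v w → up w v)) ⟩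
      size + size
        ≡⟨ cong (size +_) (sym (+-identityʳ size)) ⟩
      2 * size ∎
      where
      open ≡-Reasoning
      up : Fin order → Fin order → ℕ
      up v w = if does (v Fin.<? w) then adjacency v w else 0
      split : ∀ v w → adjacency v w ≡ up v w + up w v
      split v w with Fin.<-cmp v w
      ... | tri< v<w _ w≮v rewrite dec-true (v Fin.<? w) v<w | dec-false (w Fin.<? v) w≮v = sym (+-identityʳ _)
      ... | tri≈ v≮w refl w≮v rewrite dec-false (v Fin.<? w) v≮w = adjacency-0 (Adj-irr refl)
      ... | tri> v≮w _ w<v rewrite dec-false (v Fin.<? w) v≮w | dec-true (w Fin.<? v) w<v = adjacency-sym v w

  -- Charges of the vertices around a fixed vertex

  module Charges (G : FiniteGraph) (u : Fin (FiniteGraph.order G)) where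
    open GraphFacts G

    data Position (v : Fin order) : Set where
      centre : v ≡ u → Position v
      near   : Adj u v → Position v
      far    : v ≢ u → ¬ Adj u v → Position v

    position : ∀ v → Position v
    position v with v Fin.≟ u | adj? u v
    ... | yes v≡u | _      = centre v≡u
    ... | no  v≢u | yes uv = near uv
    ... | no  v≢u | no ¬uv = far v≢u ¬uv

    Far : Fin order → Set
    Far v = v ≢ u × ¬ Adj u v

    farness : Fin order → ℕ
    farness v with position v
    ... | centre _ = 0
    ... | near _   = 0
    ... | far _ _  = 1

    farness-1 : ∀ {v} → Far v → farness v ≡ 1
    farness-1 {v} (v≢u , ¬uv) with position v
    ... | centre v≡u = contradiction v≡u v≢u
    ... | near uv    = contradiction uv ¬uv
    ... | far _ _    = refl

    farness-near : ∀ {v} → Adj u v → farness v ≡ 0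
    farness-near {v} uv with position v
    ... | centre _  = refl
    ... | near _    = refl
    ... | far _ ¬uv = contradiction uv ¬uv

    farness-centre : farness u ≡ 0
    farness-centre with position u
    ... | centre _  = refl
    ... | near _    = refl
    ... | far u≢u _ = contradiction refl u≢u

    farness>0⇒Far : ∀ {v} → 0 < farness v → Far v
    farness>0⇒Far {v} 0<ω with position v
    ... | far v≢u ¬uv = v≢u , ¬uv

    nearNeighbours farNeighbours : Fin order → ℕ
    nearNeighbours v = sum λ x → adjacency v x * adjacency u x
    farNeighbours  v = sum λ x → adjacency v x * farness x

    degree-split : ∀ v → degree v ≡ adjacency u v + (nearNeighbours v + farNeighbours v)
    degree-split v = begin
      sum (adjacency v)
        ≡⟨ ∑-erase u (adjacency v) ⟩
      adjacency v u + sum (erase u (adjacency v))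
        ≡⟨ cong₂ _+_ (adjacency-sym v u) (sum-cong-≗ split) ⟩
      adjacency u v + sum (λ x → adjacency v x * adjacency u x + adjacency v x * farness x)
        ≡⟨ cong (adjacency u v +_) (∑-distrib-+ (λ x → adjacency v x * adjacency u x) (λ x → adjacency v x * farness x)) ⟩
      adjacency u v + (nearNeighbours v + farNeighbours v) ∎
      where
      open ≡-Reasoning
      split : ∀ x → erase u (adjacency v) x ≡ adjacency v x * adjacency u x + adjacency v x * farness x
      split x with position x
      ... | centre refl rewrite erase-self u (adjacency v) | adjacency-0 {u} {u} (Adj-irr refl)
        = sym (cong₂ _+_ (*-zeroʳ (adjacency v u)) (*-zeroʳ (adjacency v u)))
      ... | near ux rewrite erase-other (adjacency v) (Adj⇒≢ (Adj-sym ux)) | adjacency-1 ux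
        = sym (trans (cong₂ _+_ (*-identityʳ (adjacency v x)) (*-zeroʳ (adjacency v x))) (+-identityʳ _))
      ... | far x≢u ¬ux rewrite erase-other (adjacency v) x≢u | adjacency-0 ¬ux
        = sym (cong₂ _+_ (*-zeroʳ (adjacency v x)) (*-identityʳ (adjacency v x)))

    degree-near : ∀ {v} → Adj u v → degree v ≡ 1 + (nearNeighbours v + farNeighbours v)
    degree-near {v} uv = trans (degree-split v) (cong (_+ (nearNeighbours v + farNeighbours v)) (adjacency-1 uv))

    degree-far : ∀ {v} → Far v → degree v ≡ nearNeighbours v + farNeighbours v
    degree-far {v} (_ , ¬uv) = trans (degree-split v) (cong (_+ (nearNeighbours v + farNeighbours v)) (adjacency-0 ¬uv))

    farNeighbours-centre : farNeighbours u ≡ 0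
    farNeighbours-centre = ∑-ε _ vanish
      where
      vanish : ∀ x → adjacency u x * farness x ≡ 0
      vanish x with position x
      ... | centre _  = *-zeroʳ (adjacency u x)
      ... | near _    = *-zeroʳ (adjacency u x)
      ... | far _ ¬ux rewrite adjacency-0 ¬ux = refl

    near-neighbour : ∀ {v x} → Adj v x → Adj u x → 1 ≤ nearNeighbours v
    near-neighbour {v} {x} vx ux = ≤-trans
      (≤-reflexive (sym (cong₂ _*_ (adjacency-1 vx) (adjacency-1 ux))))
      (term≤sum (λ x → adjacency v x * adjacency u x) x)

    far-neighbour : ∀ {v x} → Adj v x → Far x → 1 ≤ farNeighbours v
    far-neighbour {v} {x} vx fx = ≤-trans
      (≤-reflexive (sym (cong₂ _*_ (adjacency-1 vx) (farness-1 fx))))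
      (term≤sum (λ x → adjacency v x * farness x) x)

    two-far-neighbours : ∀ {v x y} → x ≢ y → Adj v x → Far x → Adj v y → Far y → 2 ≤ farNeighbours v
    two-far-neighbours {v} {x} {y} x≢y vx fx vy fy = ≤-trans
      (≤-reflexive (sym (cong₂ _+_ (cong₂ _*_ (adjacency-1 vx) (farness-1 fx)) (cong₂ _*_ (adjacency-1 vy) (farness-1 fy)))))
      (two-terms≤sum (λ x → adjacency v x * farness x) x≢y)

    private
      product>0 : ∀ m n → 0 < m * n → 0 < m × 0 < n
      product>0 (suc m) (suc n) _ = s≤s z≤n , s≤s z≤n
      product>0 (suc m) zero    h = contradiction (subst (0 <_) (*-zeroʳ m) h) λ ()

    ∃-near-neighbour : ∀ {v} → 1 ≤ nearNeighbours v → ∃[ x ] Adj v x × Adj u x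
    ∃-near-neighbour {v} 1≤c with sum>0⇒∃ _ 1≤c
    ... | x , 0<Ax with product>0 (adjacency v x) (adjacency u x) 0<Ax
    ...   | 0<A , 0<n = x , adjacency>0⇒Adj 0<A , adjacency>0⇒Adj 0<n

    ∃-far-neighbour : ∀ {v} → 1 ≤ farNeighbours v → ∃[ x ] Adj v x × Far x
    ∃-far-neighbour {v} 1≤r with sum>0⇒∃ _ 1≤r
    ... | x , 0<Ax with product>0 (adjacency v x) (farness x) 0<Ax
    ...   | 0<A , 0<ω = x , adjacency>0⇒Adj 0<A , farness>0⇒Far 0<ω

    ∃-other-near-neighbour : ∀ {v} x → 2 ≤ nearNeighbours v → ∃[ y ] y ≢ x × Adj v y × Adj u y
    ∃-other-near-neighbour {v} x 2≤c
      with sum>term⇒∃ (λ x → adjacency v x * adjacency u x) x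
             (≤-trans (s≤s (*-mono-≤ (adjacency≤1 v x) (adjacency≤1 u x))) 2≤c)
    ... | y , y≢x , 0<Ay with product>0 (adjacency v y) (adjacency u y) 0<Ay
    ...   | 0<A , 0<n = y , y≢x , adjacency>0⇒Adj 0<A , adjacency>0⇒Adj 0<n

    farness≤1 : ∀ v → farness v ≤ 1
    farness≤1 v with position v
    ... | centre _ = z≤n
    ... | near _   = z≤n
    ... | far _ _  = ≤-refl

    ∃-other-far-neighbour : ∀ {v} x → 2 ≤ farNeighbours v → ∃[ y ] y ≢ x × Adj v y × Far y
    ∃-other-far-neighbour {v} x 2≤r
      with sum>term⇒∃ (λ x → adjacency v x * farness x) x
             (≤-trans (s≤s (*-mono-≤ (adjacency≤1 v x) (farness≤1 x))) 2≤r)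
    ... | y , y≢x , 0<Ay with product>0 (adjacency v y) (farness y) 0<Ay
    ...   | 0<A , 0<ω = y , y≢x , adjacency>0⇒Adj 0<A , farness>0⇒Far 0<ω

    sum-nearNeighbours : sum nearNeighbours ≡ sum (λ v → adjacency u v * degree v)
    sum-nearNeighbours = begin
      sum (λ v → sum (λ x → adjacency v x * adjacency u x))   ≡⟨ ∑-comm (λ v x → adjacency v x * adjacency u x) ⟩
      sum (λ x → sum (λ v → adjacency v x * adjacency u x))   ≡⟨ sum-cong-≗ (λ x → sum-cong-≗ (λ v →
        trans (*-comm (adjacency v x) (adjacency u x)) (cong (adjacency u x *_) (adjacency-sym v x)))) ⟩
      sum (λ x → sum (λ v → adjacency u x * adjacency x v))   ≡⟨ sum-cong-≗ (λ x → *-distribˡ-sum (adjacency u x) (adjacency x)) ⟨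
      sum (λ x → adjacency u x * degree x)                    ∎
      where open ≡-Reasoning

    -- The charge of v counts, up to normalisation, the contribution of v to
    -- 2 size − 3 degree u.
    charge : Fin order → ℕ
    charge v = adjacency u v * (nearNeighbours v + 2 * farNeighbours v ∸ 1) + farness v * farNeighbours v

    charge-near : ∀ {v} → Adj u v → charge v ≡ nearNeighbours v + 2 * farNeighbours v ∸ 1
    charge-near uv rewrite adjacency-1 uv | farness-near uv = trans (+-identityʳ _) (+-identityʳ _)

    charge-far : ∀ {v} → Far v → charge v ≡ farNeighbours v
    charge-far {v} fv rewrite adjacency-0 (proj₂ fv) | farness-1 fv = +-identityʳ _

    charge-centre : charge u ≡ 0
    charge-centre rewrite adjacency-0 {u} {u} (Adj-irr refl) | farness-centre = refl

    sum-degree : sum degree ≡ degree u + (sum (λ v → adjacency u v * degree v) + sum farNeighbours)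
    sum-degree = begin
      sum degree
        ≡⟨ sum-cong-≗ degree-split ⟩
      sum (λ v → adjacency u v + (nearNeighbours v + farNeighbours v))
        ≡⟨ ∑-distrib-+ (adjacency u) (λ v → nearNeighbours v + farNeighbours v) ⟩
      degree u + sum (λ v → nearNeighbours v + farNeighbours v)
        ≡⟨ cong (degree u +_) (trans (∑-distrib-+ nearNeighbours farNeighbours) (cong (_+ sum farNeighbours) sum-nearNeighbours)) ⟩
      degree u + (sum (λ v → adjacency u v * degree v) + sum farNeighbours) ∎
      where open ≡-Reasoning

    module _ (2≤degree : ∀ v → 2 ≤ degree v) where

      -- Distribute the ends of all edges. A neighbour of `u` receives both ends of its edge to `u`,
      -- its own end of each edge to another neighbour, and both ends of each edge to a far vertex;
      -- an edge between far vertices is split. A neighbour lying on one triangle and nothing else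
      -- receives 3, and the charge is the excess over that.
      sum-charge : sum degree ≡ 3 * degree u + sum charge
      sum-charge = begin
        sum degree
          ≡⟨ sum-degree ⟩
        degree u + (sum (λ v → adjacency u v * degree v) + sum farNeighbours)
          ≡⟨ cong (degree u +_) (∑-distrib-+ (λ v → adjacency u v * degree v) farNeighbours) ⟨
        degree u + sum (λ v → adjacency u v * degree v + farNeighbours v)
          ≡⟨ cong (degree u +_) (trans (sum-cong-≗ local) (∑-distrib-+ (λ v → 2 * adjacency u v) charge)) ⟩
        degree u + (sum (λ v → 2 * adjacency u v) + sum charge)
          ≡⟨ cong (λ s → degree u + (s + sum charge)) (*-distribˡ-sum 2 (adjacency u)) ⟨
        degree u + (2 * degree u + sum charge)
          ≡⟨ +-assoc (degree u) _ _ ⟨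
        3 * degree u + sum charge ∎
        where
        open ≡-Reasoning
        local : ∀ v → adjacency u v * degree v + farNeighbours v ≡ 2 * adjacency u v + charge v
        local v with position v
        ... | centre refl rewrite adjacency-0 {u} {u} (Adj-irr refl) | farNeighbours-centre = refl
        ... | far v≢u ¬uv rewrite adjacency-0 ¬uv = sym (+-identityʳ _)
        ... | near uv rewrite adjacency-1 uv = begin
            degree v + 0 + r              ≡⟨ cong (_+ r) (trans (+-identityʳ (degree v)) (degree-near uv)) ⟩
            1 + (c + r) + r               ≡⟨ solve 2 (λ c r → con 1 :+ (c :+ r) :+ r := con 1 :+ (c :+ con 2 :* r)) refl c r ⟩
            1 + (c + 2 * r)               ≡⟨ cong (1 +_) (m+[n∸m]≡n 1≤) ⟨
            2 + (c + 2 * r ∸ 1)           ≡⟨ cong (2 +_) (trans (+-identityʳ _) (+-identityʳ _)) ⟨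
            2 + (c + 2 * r ∸ 1 + 0 + 0)   ∎
          where
          open +-*-Solver
          c = nearNeighbours v
          r = farNeighbours v
          -- Minimum degree 2 gives a neighbour of `u` some further neighbour, so the truncated
          -- subtraction in `charge` is exact.
          1≤ : 1 ≤ c + 2 * r
          1≤ = ≤-trans (≤-pred (≤-trans (2≤degree v) (≤-reflexive (degree-near uv)))) (+-monoʳ-≤ c (m≤m+n r (r + 0)))

    -- The tool for all contradictions by overcharging: distinct vertices are listed, each with a
    -- proved lower bound for its charge.
    charges≤ : (L : List (∃[ v ] ∃[ b ] b ≤ charge v)) → Unique (map proj₁ L) →
      sumL (λ l → proj₁ (proj₂ l)) L ≤ sum charge
    charges≤ L unique = ≤-trans (lower L)
      (≤-trans (m≤m+n _ _) (≤-reflexive (sym (∑-split (map proj₁ L) charge unique))))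
      where
      lower : ∀ L → sumL (λ l → proj₁ (proj₂ l)) L ≤ sumL charge (map proj₁ L)
      lower []                = z≤n
      lower ((v , b , h) ∷ L) = +-mono-≤ h (lower L)

-- Local structure forced by the forbidden theta graphs

module Neighbourhood where

  open Counting
  open import Data.Nat.Base
  open import Data.Nat.Properties
  open import Data.Nat.Solver using (module +-*-Solver)
  open import Algebra.Properties.Semiring.Sum +-*-semiring using (*-distribˡ-sum)
  open import Algebra.Properties.CommutativeMonoid.Sum +-0-commutativeMonoid
    using (sum; sum-cong-≗; ∑-distrib-+)

  zero-or-pos : ∀ n → n ≡ 0 ⊎ 1 ≤ n
  zero-or-pos zero    = inj₁ refl
  zero-or-pos (suc n) = inj₂ (s≤s z≤n)

  module ThetaFree (G : FiniteGraph) where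
    open GraphFacts G

    -- `θ(1,2,2)` is `K₄` minus an edge, and its absence means that an edge lies on at most one
    -- triangle. `θ(1,2,3)` is the house: a triangle and a 4-cycle sharing the edge `ab`.
    NoDiamond NoHouse : Set
    NoDiamond = ∀ {a b x y} → Adj a b → Adj a x → Adj x b → Adj a y → Adj y b → x ≡ y
    NoHouse   = ∀ {a b w x y} → Adj a b → Adj a w → Adj w b → Adj a x → Adj x y → Adj y b →
      w ≢ x → w ≢ y → x ≢ b → y ≢ a → ⊥

    diamond : ∀ {a b x y} → Adj a b → Adj a x → Adj x b → Adj a y → Adj y b → x ≢ y →
      θ (1 ∷ 2 ∷ 2 ∷ []) ⊑ toGraph
    diamond {a} {b} {x} {y} ab ax xb ay yb x≢y = f , (λ {p} {q} → injective p q) , λ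
      { (fwd l) → link l ; (bwd l) → Adj-sym (link l) }
      where
      f : ThetaVertex (1 ∷ 2 ∷ 2 ∷ []) → Fin order
      f source       = a
      f target       = b
      f (inner 1F 0F) = x
      f (inner 2F 0F) = y
      injective : ∀ p q → f p ≡ f q → p ≡ q
      injective source        source        _ = refl
      injective source        target        e = contradiction e (Adj⇒≢ ab)
      injective source        (inner 1F 0F) e = contradiction e (Adj⇒≢ ax)
      injective source        (inner 2F 0F) e = contradiction e (Adj⇒≢ ay)
      injective target        source        e = contradiction (sym e) (Adj⇒≢ ab)
      injective target        target        _ = refl
      injective target        (inner 1F 0F) e = contradiction (sym e) (Adj⇒≢ xb)
      injective target        (inner 2F 0F) e = contradiction (sym e) (Adj⇒≢ yb)
      injective (inner 1F 0F) source        e = contradiction (sym e) (Adj⇒≢ ax)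
      injective (inner 1F 0F) target        e = contradiction e (Adj⇒≢ xb)
      injective (inner 1F 0F) (inner 1F 0F) _ = refl
      injective (inner 1F 0F) (inner 2F 0F) e = contradiction e x≢y
      injective (inner 2F 0F) source        e = contradiction (sym e) (Adj⇒≢ ay)
      injective (inner 2F 0F) target        e = contradiction e (Adj⇒≢ yb)
      injective (inner 2F 0F) (inner 1F 0F) e = contradiction (sym e) x≢y
      injective (inner 2F 0F) (inner 2F 0F) _ = refl
      link : ∀ {p q} → ThetaLink (1 ∷ 2 ∷ 2 ∷ []) p q → Adj (f p) (f q)
      link (direct 0F _)      = ab
      link (first 1F 0F _)    = ax
      link (first 2F 0F _)    = ay
      link (last 1F 0F _)     = xb
      link (last 2F 0F _)     = yb
      link (direct 1F ())
      link (direct 2F ())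
      link (next 1F 0F 0F ())
      link (next 2F 0F 0F ())

    house : ∀ {a b w x y} → Adj a b → Adj a w → Adj w b → Adj a x → Adj x y → Adj y b →
      w ≢ x → w ≢ y → x ≢ b → y ≢ a → θ (1 ∷ 2 ∷ 3 ∷ []) ⊑ toGraph
    house {a} {b} {w} {x} {y} ab aw wb ax xy yb w≢x w≢y x≢b y≢a = f , (λ {p} {q} → injective p q) , λ
      { (fwd l) → link l ; (bwd l) → Adj-sym (link l) }
      where
      f : ThetaVertex (1 ∷ 2 ∷ 3 ∷ []) → Fin order
      f source        = a
      f target        = b
      f (inner 1F 0F) = w
      f (inner 2F 0F) = x
      f (inner 2F 1F) = y
      injective : ∀ p q → f p ≡ f q → p ≡ q
      injective source        source        _ = refl
      injective source        target        e = contradiction e (Adj⇒≢ ab)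
      injective source        (inner 1F 0F) e = contradiction e (Adj⇒≢ aw)
      injective source        (inner 2F 0F) e = contradiction e (Adj⇒≢ ax)
      injective source        (inner 2F 1F) e = contradiction (sym e) y≢a
      injective target        source        e = contradiction (sym e) (Adj⇒≢ ab)
      injective target        target        _ = refl
      injective target        (inner 1F 0F) e = contradiction (sym e) (Adj⇒≢ wb)
      injective target        (inner 2F 0F) e = contradiction (sym e) x≢b
      injective target        (inner 2F 1F) e = contradiction (sym e) (Adj⇒≢ yb)
      injective (inner 1F 0F) source        e = contradiction (sym e) (Adj⇒≢ aw)
      injective (inner 1F 0F) target        e = contradiction e (Adj⇒≢ wb)
      injective (inner 1F 0F) (inner 1F 0F) _ = refl
      injective (inner 1F 0F) (inner 2F 0F) e = contradiction e w≢x
      injective (inner 1F 0F) (inner 2F 1F) e = contradiction e w≢y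
      injective (inner 2F 0F) source        e = contradiction (sym e) (Adj⇒≢ ax)
      injective (inner 2F 0F) target        e = contradiction e x≢b
      injective (inner 2F 0F) (inner 1F 0F) e = contradiction (sym e) w≢x
      injective (inner 2F 0F) (inner 2F 0F) _ = refl
      injective (inner 2F 0F) (inner 2F 1F) e = contradiction e (Adj⇒≢ xy)
      injective (inner 2F 1F) source        e = contradiction e y≢a
      injective (inner 2F 1F) target        e = contradiction e (Adj⇒≢ yb)
      injective (inner 2F 1F) (inner 1F 0F) e = contradiction (sym e) w≢y
      injective (inner 2F 1F) (inner 2F 0F) e = contradiction (sym e) (Adj⇒≢ xy)
      injective (inner 2F 1F) (inner 2F 1F) _ = refl
      link : ∀ {p q} → ThetaLink (1 ∷ 2 ∷ 3 ∷ []) p q → Adj (f p) (f q)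
      link (direct 0F _)      = ab
      link (first 1F 0F _)    = aw
      link (first 2F 0F _)    = ax
      link (next 2F 0F 1F _)  = xy
      link (last 1F 0F _)     = wb
      link (last 2F 1F _)     = yb
      link (direct 1F ())
      link (direct 2F ())
      link (first 2F 1F ())
      link (next 1F 0F 0F ())
      link (next 2F 0F 0F ())
      link (next 2F 1F 0F ())
      link (next 2F 1F 1F ())
      link (last 2F 0F ())

    noDiamond : ¬ θ (1 ∷ 2 ∷ 2 ∷ []) ⊑ toGraph → NoDiamond
    noDiamond ¬diamond {x = x} {y} ab ax xb ay yb with x Fin.≟ y
    ... | yes x≡y = x≡y
    ... | no  x≢y = contradiction (diamond ab ax xb ay yb x≢y) ¬diamond

    noHouse : ¬ θ (1 ∷ 2 ∷ 3 ∷ []) ⊑ toGraph → NoHouse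
    noHouse ¬house ab aw wb ax xy yb w≢x w≢y x≢b y≢a = ¬house (house ab aw wb ax xy yb w≢x w≢y x≢b y≢a)

  module Structure (G : FiniteGraph) (u : Fin (FiniteGraph.order G))
                   (2≤degree : ∀ v → 2 ≤ FiniteGraph.degree G v)
                   (noDiamond : ThetaFree.NoDiamond G) (noHouse : ThetaFree.NoHouse G) where
    open GraphFacts G
    open Charges G u

    nearNeighbours≤1 : ∀ {v} → Adj u v → nearNeighbours v ≤ 1
    nearNeighbours≤1 {v} uv with nearNeighbours v ≤? 1
    ... | yes ≤1 = ≤1
    ... | no  ≰1 with ∃-near-neighbour (≤-trans (s≤s z≤n) (≰⇒> ≰1))
    ...   | x , vx , ux with ∃-other-near-neighbour x (≰⇒> ≰1)
    ...     | y , y≢x , vy , uy = contradiction (noDiamond uv uy (Adj-sym vy) ux (Adj-sym vx)) y≢x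

    -- Without a diamond a neighbour `v` of `u` has at most one neighbour adjacent to `u`, so its
    -- degree is at most `2 + farNeighbours v`. The total of the far neighbours occurs with the
    -- opposite role in `sum-degree`, and combining the two eliminates it.
    neighbourhood-degrees : 2 * sum (λ v → adjacency u v * degree v) ≤ sum degree + degree u
    neighbourhood-degrees = begin
      2 * s                                 ≡⟨ cong (s +_) (+-identityʳ s) ⟩
      s + s                                 ≤⟨ +-monoʳ-≤ s s≤ ⟩
      s + (2 * degree u + sum farNeighbours)
        ≡⟨ solve 3 (λ s d r → s :+ (con 2 :* d :+ r) := d :+ (s :+ r) :+ d) refl s (degree u) (sum farNeighbours) ⟩
      degree u + (s + sum farNeighbours) + degree u   ≡⟨ cong (_+ degree u) sum-degree ⟨
      sum degree + degree u                 ∎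
      where
      open ≤-Reasoning
      open +-*-Solver
      s = sum (λ v → adjacency u v * degree v)
      local : ∀ v → adjacency u v * degree v ≤ 2 * adjacency u v + farNeighbours v
      local v with position v
      ... | centre refl rewrite adjacency-0 {u} {u} (Adj-irr refl) = z≤n
      ... | far _ ¬uv rewrite adjacency-0 ¬uv = z≤n
      ... | near uv rewrite adjacency-1 uv = begin
        degree v + 0                              ≡⟨ trans (+-identityʳ _) (degree-near uv) ⟩
        1 + (nearNeighbours v + farNeighbours v)  ≤⟨ +-monoʳ-≤ 1 (+-monoˡ-≤ (farNeighbours v) (nearNeighbours≤1 uv)) ⟩
        2 + farNeighbours v                       ∎
      s≤ : s ≤ 2 * degree u + sum farNeighbours
      s≤ = begin
        s                                                     ≤⟨ sum-mono local ⟩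
        sum (λ v → 2 * adjacency u v + farNeighbours v)       ≡⟨ ∑-distrib-+ (λ v → 2 * adjacency u v) farNeighbours ⟩
        sum (λ v → 2 * adjacency u v) + sum farNeighbours     ≡⟨ cong (_+ sum farNeighbours) (*-distribˡ-sum 2 (adjacency u)) ⟨
        2 * degree u + sum farNeighbours                      ∎

    -- Otherwise the 4-cycle u v w v₂ meets the triangle on u v, giving a house or a diamond.
    triangle-excludes : ∀ {v v₂ w} → Adj u v → 1 ≤ nearNeighbours v → Far w → Adj v w →
      Adj u v₂ → Adj v₂ w → v₂ ≢ v → ⊥
    triangle-excludes {v} {v₂} {w} uv 1≤c (w≢u , ¬uw) vw uv₂ v₂w v₂≢v with ∃-near-neighbour 1≤c
    ... | v′ , vv′ , uv′ with v′ Fin.≟ v₂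
    ...   | yes refl = w≢u (sym (noDiamond vv′ (Adj-sym uv) uv′ vw (Adj-sym v₂w)))
    ...   | no v′≢v₂ = noHouse uv uv′ (Adj-sym vv′) uv₂ v₂w (Adj-sym vw) v′≢v₂
                         (λ { refl → ¬uw uv′ }) v₂≢v w≢u

    near≢far : ∀ {v w} → Adj u v → Far w → v ≢ w
    near≢far uv (_ , ¬uw) refl = ¬uw uv

    far≢near : ∀ {v w} → Far v → Adj u w → v ≢ w
    far≢near fv uw = near≢far uw fv ∘ sym

    charge-near-lower : ∀ {v} r → Adj u v → r ≤ farNeighbours v → 2 * r ∸ 1 ≤ charge v
    charge-near-lower {v} r uv r≤ = ≤-trans
      (∸-monoˡ-≤ 1 (≤-trans (*-monoʳ-≤ 2 r≤) (m≤n+m (2 * farNeighbours v) (nearNeighbours v))))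
      (≤-reflexive (sym (charge-near uv)))

    charge-near-far : ∀ {v w} → Adj u v → Far w → Adj v w → 1 ≤ charge v
    charge-near-far uv fw vw = charge-near-lower 1 uv (far-neighbour vw fw)

    charge-far-far : ∀ {v w} → Far v → Far w → Adj v w → 1 ≤ charge v
    charge-far-far fv fw vw = ≤-trans (far-neighbour vw fw) (≤-reflexive (sym (charge-far fv)))

    far-neighbour-near : ∀ {w v} → Far w → farNeighbours w ≡ 0 → Adj w v → Adj u v
    far-neighbour-near {w} {v} fw r≡0 wv with position v
    ... | centre refl   = contradiction (Adj-sym wv) (proj₂ fw)
    ... | near uv       = uv
    ... | far v≢u ¬uv   = contradiction (subst (1 ≤_) r≡0 (far-neighbour wv (v≢u , ¬uv))) λ ()

    near-inactive : ∀ {v} → Adj u v → charge v ≡ 0 → nearNeighbours v ≡ 1 × farNeighbours v ≡ 0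
    near-inactive {v} uv e≡0 with zero-or-pos (farNeighbours v)
    ... | inj₁ r≡0 = ≤-antisym (nearNeighbours≤1 uv)
                       (≤-pred (≤-trans (2≤degree v) (≤-reflexive (trans (degree-near uv)
                         (cong suc (trans (cong (nearNeighbours v +_) r≡0) (+-identityʳ _))))))) , r≡0
    ... | inj₂ 1≤r = contradiction (subst (1 ≤_) e≡0 (charge-near-lower 1 uv 1≤r)) λ ()

    -- Charge always comes at least in pairs. A charged far vertex has a far neighbour, charged as
    -- well. A charged neighbour of `u` has a far neighbour `w`; either `w` is charged, or its
    -- second neighbour is adjacent to `u` and charged because of `w`.
    charge≢1 : sum charge ≢ 1
    charge≢1 Σ≡1 = absurd _ (proj₂ ∃v) (position _)
      where
      ∃v = sum>0⇒∃ charge (≤-reflexive (sym Σ≡1))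
      absurd : ∀ v → 0 < charge v → Position v → ⊥
      absurd v 0<e (centre refl) = contradiction (subst (0 <_) charge-centre 0<e) λ ()
      absurd v 0<e (far v≢u ¬uv) with ∃-far-neighbour (subst (0 <_) (charge-far (v≢u , ¬uv)) 0<e)
      ... | w , vw , fw = <⇒≱ (≤-reflexive (cong suc Σ≡1)) (charges≤
                ((v , 1 , 0<e) ∷ (w , 1 , charge-far-far fw (v≢u , ¬uv) (Adj-sym vw)) ∷ [])
                ((Adj⇒≢ vw ∷ []) ∷ [] ∷ []))
      absurd v 0<e (near uv) with zero-or-pos (farNeighbours v)
      ... | inj₁ r≡0 = <⇒≱ 0<e (≤-trans (≤-reflexive (charge-near uv))
              (∸-monoˡ-≤ 1 (subst (λ r → nearNeighbours v + 2 * r ≤ 1) (sym r≡0)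
                (≤-trans (≤-reflexive (+-identityʳ _)) (nearNeighbours≤1 uv)))))
      ... | inj₂ 1≤r with ∃-far-neighbour 1≤r
      ...   | w , vw , fw with zero-or-pos (farNeighbours w)
      ...     | inj₂ 1≤rw = <⇒≱ (≤-reflexive (cong suc Σ≡1)) (charges≤
                  ((v , 1 , 0<e) ∷ (w , 1 , ≤-trans 1≤rw (≤-reflexive (sym (charge-far fw)))) ∷ [])
                  ((Adj⇒≢ vw ∷ []) ∷ [] ∷ []))
      ...     | inj₁ rw≡0 with other-neighbour {w} {v} (2≤degree w)
      ...       | v₂ , v₂≢v , wv₂ = <⇒≱ (≤-reflexive (cong suc Σ≡1)) (charges≤
                    ((v , 1 , 0<e) ∷ (v₂ , 1 , charge-near-far (far-neighbour-near fw rw≡0 wv₂) fw (Adj-sym wv₂)) ∷ [])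
                    ((v₂≢v ∘ sym ∷ []) ∷ [] ∷ []))

    -- The competitors at degree `2k`: four neighbours of `u` are each joined to a far vertex and
    -- the rest are paired into triangles. Whether there is one far vertex of degree 4 or two of
    -- degree 2 is left open; a common bound on the degree is enough for the weights.
    record Squares : Set where
      field
        near-degree : ∀ {v} → Adj u v → nearNeighbours v + farNeighbours v ≡ 1
        far-far     : ∀ {w} → Far w → farNeighbours w ≡ 0
        far-degree  : ∀ {w} → Far w → degree w ≤ 4
        total       : sum (λ v → adjacency u v * farNeighbours v) ≡ 4

    -- The 5-cycle is `u a x y b`. Its vertices other than `u` carry charge 1 each, which exhausts
    -- the total of 4 and forces triangles everywhere else.
    record Pentagon : Set where
      field
        a b x y     : Fin order
        ua          : Adj u a
        ub          : Adj u b
        a≢b         : a ≢ b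
        far-x       : Far x
        far-y       : Far y
        ax          : Adj a x
        xy          : Adj x y
        yb          : Adj y b
        only-far    : ∀ {w} → Far w → w ≡ x ⊎ w ≡ y
        a-near      : nearNeighbours a ≡ 0
        b-near      : nearNeighbours b ≡ 0
        a-far       : farNeighbours a ≡ 1
        b-far       : farNeighbours b ≡ 1
        triangle    : ∀ {v} → Adj u v → v ≢ a → v ≢ b → nearNeighbours v ≡ 1 × farNeighbours v ≡ 0

    module _ (Σ≡4 : sum charge ≡ 4) where

      overcharged : (L : List (∃[ v ] ∃[ b ] b ≤ charge v)) → Unique (map proj₁ L) →
        5 ≤ foldr (λ l s → proj₁ (proj₂ l) + s) 0 L → ⊥
      overcharged L unique 5≤ = <⇒≱ (≤-reflexive (cong suc Σ≡4)) (≤-trans 5≤ (charges≤ L unique))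

      squares : (∀ {w} → Far w → farNeighbours w ≡ 0) → Squares
      squares r≡0 = record
        { near-degree = near-degree
        ; far-far     = r≡0
        ; far-degree  = λ {w} fw → subst (degree w ≤_) Σ≡4 (sum-mono (far-degree fw))
        ; total       = trans (sum-cong-≗ λ v → total v (position v)) Σ≡4
        }
        where
        -- All neighbours of `w` are adjacent to `u` and charged because of `w`, so the degree of
        -- `w` is bounded by the total charge.
        far-degree : ∀ {w} → Far w → ∀ x → adjacency w x ≤ charge x
        far-degree {w} fw x with adj? w x
        ... | yes wx = charge-near-far (far-neighbour-near fw (r≡0 fw) wx) fw (Adj-sym wx)
        ... | no  _  = z≤n
        second : ∀ {v w} → Adj u v → Far w → Adj v w → ∃[ v₂ ] v₂ ≢ v × Adj u v₂ × Adj w v₂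
        second {v} {w} uv fw vw with other-neighbour {w} {v} (2≤degree w)
        ... | v₂ , v₂≢v , wv₂ = v₂ , v₂≢v , far-neighbour-near fw (r≡0 fw) wv₂ , wv₂
        -- Two far neighbours give `v` charge 3, and each of them has a second neighbour adjacent to
        -- `u`. If these differ, the charges reach `3 + 1 + 1`; if they coincide, that vertex also
        -- has two far neighbours and the charges reach `3 + 3`.
        far≤1 : ∀ {v} → Adj u v → farNeighbours v ≤ 1
        far≤1 {v} uv with farNeighbours v ≤? 1
        ... | yes ≤1 = ≤1
        ... | no  ≰1 with ∃-far-neighbour (≤-trans (s≤s z≤n) (≰⇒> ≰1))
        ...   | w₁ , vw₁ , fw₁ with ∃-other-far-neighbour w₁ (≰⇒> ≰1)
        ...     | w₂ , w₂≢w₁ , vw₂ , fw₂ with second uv fw₁ vw₁ | second uv fw₂ vw₂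
        ...       | a₁ , a₁≢v , ua₁ , w₁a₁ | a₂ , a₂≢v , ua₂ , w₂a₂ with a₁ Fin.≟ a₂
        ...         | no a₁≢a₂ = ⊥-elim (overcharged
                        ((v , 3 , charge-near-lower 2 uv (≰⇒> ≰1)) ∷
                         (a₁ , 1 , charge-near-far ua₁ fw₁ (Adj-sym w₁a₁)) ∷
                         (a₂ , 1 , charge-near-far ua₂ fw₂ (Adj-sym w₂a₂)) ∷ [])
                        ((a₁≢v ∘ sym ∷ a₂≢v ∘ sym ∷ []) ∷ (a₁≢a₂ ∷ []) ∷ [] ∷ []) ≤-refl)
        ...         | yes refl = ⊥-elim (overcharged
                        ((v , 3 , charge-near-lower 2 uv (≰⇒> ≰1)) ∷
                         (a₁ , 3 , charge-near-lower 2 ua₁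
                            (two-far-neighbours w₂≢w₁ (Adj-sym w₂a₂) fw₂ (Adj-sym w₁a₁) fw₁)) ∷ [])
                        ((a₁≢v ∘ sym ∷ []) ∷ [] ∷ []) (n≤1+n 5))
        near-degree : ∀ {v} → Adj u v → nearNeighbours v + farNeighbours v ≡ 1
        near-degree {v} uv = ≤-antisym ≤1 (≤-pred (≤-trans (2≤degree v) (≤-reflexive (degree-near uv))))
          where
          ≤1 : nearNeighbours v + farNeighbours v ≤ 1
          ≤1 with zero-or-pos (farNeighbours v)
          ... | inj₁ r≡0 = ≤-trans (≤-reflexive (trans (cong (nearNeighbours v +_) r≡0) (+-identityʳ _))) (nearNeighbours≤1 uv)
          ... | inj₂ 1≤r with zero-or-pos (nearNeighbours v)
          ...   | inj₁ c≡0 = ≤-trans (≤-reflexive (cong (_+ farNeighbours v) c≡0)) (far≤1 uv)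
          ...   | inj₂ 1≤c with ∃-far-neighbour 1≤r
          ...     | w , vw , fw with second uv fw vw
          ...       | v₂ , v₂≢v , uv₂ , wv₂ = ⊥-elim (triangle-excludes uv 1≤c fw vw uv₂ (Adj-sym wv₂) v₂≢v)
        total : ∀ v → Position v → adjacency u v * farNeighbours v ≡ charge v
        total v (centre refl) = trans (cong (adjacency u u *_) farNeighbours-centre)
                              (trans (*-zeroʳ (adjacency u u)) (sym charge-centre))
        total v (far v≢u ¬uv) = trans (cong (_* farNeighbours v) (adjacency-0 ¬uv))
                              (sym (trans (charge-far (v≢u , ¬uv)) (r≡0 (v≢u , ¬uv))))
        total v (near uv) = begin
          adjacency u v * r       ≡⟨ cong (_* r) (adjacency-1 uv) ⟩
          1 * r                   ≡⟨ +-identityʳ r ⟩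
          r                       ≡⟨⟩
          1 + r ∸ 1               ≡⟨ cong (λ n → n + r ∸ 1) (near-degree uv) ⟨
          c + r + r ∸ 1           ≡⟨ cong (_∸ 1) (solve 2 (λ c r → c :+ r :+ r := c :+ con 2 :* r) refl c r) ⟩
          c + 2 * r ∸ 1           ≡⟨ charge-near uv ⟨
          charge v                ∎
          where
          open ≡-Reasoning
          open +-*-Solver
          c = nearNeighbours v
          r = farNeighbours v

      -- Otherwise `x` has a second far neighbour `y₂` and charge at least 2. If `y` also has two
      -- far neighbours, the charges of `x`, `y`, `y₂` reach `2 + 2 + 1`. If not, `y` has a
      -- neighbour `b` adjacent to `u`, and they reach `2 + 1 + 1 + 1`.
      near-attachment : ∀ {x y} → Far x → Far y → Adj x y → ∃[ a ] Adj a x × Adj u a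
      near-attachment {x} {y} fx fy xy with zero-or-pos (nearNeighbours x)
      ... | inj₂ 1≤c with ∃-near-neighbour 1≤c
      ...   | a , xa , ua = a , Adj-sym xa , ua
      near-attachment {x} {y} fx fy xy | inj₁ c≡0
        with ∃-other-far-neighbour y (≤-trans (2≤degree x) (≤-reflexive (trans (degree-far fx) (cong (_+ farNeighbours x) c≡0))))
      ... | y₂ , y₂≢y , xy₂ , fy₂ with 2 ≤? farNeighbours y
      ...   | yes 2≤ = ⊥-elim (overcharged
                ((x , 2 , ≤-trans (two-far-neighbours y₂≢y xy₂ fy₂ xy fy) (≤-reflexive (sym (charge-far fx)))) ∷
                 (y , 2 , ≤-trans 2≤ (≤-reflexive (sym (charge-far fy)))) ∷
                 (y₂ , 1 , charge-far-far fy₂ fx (Adj-sym xy₂)) ∷ [])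
                ((Adj⇒≢ xy ∷ Adj⇒≢ xy₂ ∷ []) ∷ (y₂≢y ∘ sym ∷ []) ∷ [] ∷ []) ≤-refl)
      ...   | no 2≰ with ∃-near-neighbour {y} (+-cancelʳ-≤ 1 1 (nearNeighbours y)
                      (≤-trans (2≤degree y) (≤-trans (≤-reflexive (degree-far fy)) (+-monoʳ-≤ (nearNeighbours y) (≤-pred (≰⇒> 2≰))))))
      ...     | b , yb , ub = ⊥-elim (overcharged
                ((x , 2 , ≤-trans (two-far-neighbours y₂≢y xy₂ fy₂ xy fy) (≤-reflexive (sym (charge-far fx)))) ∷
                 (y , 1 , charge-far-far fy fx (Adj-sym xy)) ∷
                 (y₂ , 1 , charge-far-far fy₂ fx (Adj-sym xy₂)) ∷
                 (b , 1 , charge-near-far ub fy (Adj-sym yb)) ∷ [])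
                ((Adj⇒≢ xy ∷ Adj⇒≢ xy₂ ∷ far≢near fx ub ∷ []) ∷ (y₂≢y ∘ sym ∷ far≢near fy ub ∷ []) ∷
                 (far≢near fy₂ ub ∷ []) ∷ [] ∷ []) ≤-refl)

      -- Both `x` and `y` attach to neighbours `a` and `b` of `u`, distinct since a common one would
      -- have charge 3. The four charges then already add up to 4, so each is exactly 1 and every
      -- other vertex is uncharged.
      pentagon : ∀ {x y} → Far x → Far y → Adj x y → Pentagon
      pentagon {x} {y} fx fy xy with near-attachment fx fy xy | near-attachment fy fx (Adj-sym xy)
      ... | a , ax , ua | b , by , ub = record
        { ua = ua ; ub = ub ; a≢b = a≢b ; far-x = fx ; far-y = fy
        ; ax = ax ; xy = xy ; yb = Adj-sym by
        ; only-far = only-far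
        ; a-near = proj₁ (quiet ua fx ax only-a)
        ; b-near = proj₁ (quiet ub fy by only-b)
        ; a-far = proj₂ (quiet ua fx ax only-a)
        ; b-far = proj₂ (quiet ub fy by only-b)
        ; triangle = λ uv v≢a v≢b → near-inactive uv (inactive (near≢far uv fx) (near≢far uv fy) v≢a v≢b)
        }
        where
        1≤x = charge-far-far fx fy xy
        1≤y = charge-far-far fy fx (Adj-sym xy)
        1≤a = charge-near-far ua fx ax
        1≤b = charge-near-far ub fy by
        a≢b : a ≢ b
        a≢b refl = overcharged
          ((x , 1 , 1≤x) ∷ (y , 1 , 1≤y) ∷ (a , 3 , charge-near-lower 2 ua (two-far-neighbours (Adj⇒≢ xy) ax fx by fy)) ∷ [])
          ((Adj⇒≢ xy ∷ far≢near fx ua ∷ []) ∷ (far≢near fy ua ∷ []) ∷ [] ∷ []) ≤-refl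
        inactive : ∀ {v} → v ≢ x → v ≢ y → v ≢ a → v ≢ b → charge v ≡ 0
        inactive {v} v≢x v≢y v≢a v≢b with zero-or-pos (charge v)
        ... | inj₁ e≡0 = e≡0
        ... | inj₂ 1≤e = ⊥-elim (overcharged
          ((v , 1 , 1≤e) ∷ (x , 1 , 1≤x) ∷ (y , 1 , 1≤y) ∷ (a , 1 , 1≤a) ∷ (b , 1 , 1≤b) ∷ [])
          ((v≢x ∷ v≢y ∷ v≢a ∷ v≢b ∷ []) ∷ (Adj⇒≢ xy ∷ far≢near fx ua ∷ far≢near fx ub ∷ []) ∷
           (far≢near fy ua ∷ far≢near fy ub ∷ []) ∷ (a≢b ∷ []) ∷ [] ∷ []) ≤-refl)
        only-a : charge a ≤ 1
        only-a with charge a ≤? 1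
        ... | yes ≤1 = ≤1
        ... | no  ≰1 = ⊥-elim (overcharged
          ((a , 2 , ≰⇒> ≰1) ∷ (b , 1 , 1≤b) ∷ (x , 1 , 1≤x) ∷ (y , 1 , 1≤y) ∷ [])
          ((a≢b ∷ near≢far ua fx ∷ near≢far ua fy ∷ []) ∷ (near≢far ub fx ∷ near≢far ub fy ∷ []) ∷
           (Adj⇒≢ xy ∷ []) ∷ [] ∷ []) ≤-refl)
        only-b : charge b ≤ 1
        only-b with charge b ≤? 1
        ... | yes ≤1 = ≤1
        ... | no  ≰1 = ⊥-elim (overcharged
          ((b , 2 , ≰⇒> ≰1) ∷ (a , 1 , 1≤a) ∷ (x , 1 , 1≤x) ∷ (y , 1 , 1≤y) ∷ [])
          ((a≢b ∘ sym ∷ near≢far ub fx ∷ near≢far ub fy ∷ []) ∷ (near≢far ua fx ∷ near≢far ua fy ∷ []) ∷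
           (Adj⇒≢ xy ∷ []) ∷ [] ∷ []) ≤-refl)
        quiet : ∀ {v w} → Adj u v → Far w → Adj v w → charge v ≤ 1 → nearNeighbours v ≡ 0 × farNeighbours v ≡ 1
        quiet {v} uv fw vw e≤1 = extract (nearNeighbours v) (farNeighbours v)
          (far-neighbour vw fw) (subst (_≤ 1) (charge-near uv) e≤1)
          where
          extract : ∀ c r → 1 ≤ r → c + 2 * r ∸ 1 ≤ 1 → c ≡ 0 × r ≡ 1
          extract zero    (suc zero)    _ _ = refl , refl
          extract zero    (suc (suc r)) _ h rewrite +-suc r (suc (r + 0)) = contradiction h λ { (s≤s ()) }
          extract (suc c) (suc r)       _ h rewrite +-suc c (r + suc (r + 0)) | +-suc r (r + 0) | +-suc c (r + (r + 0))
            = contradiction h λ { (s≤s ()) }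
        -- A further far vertex would be uncharged, so its neighbours are all adjacent to `u` and
        -- charged. That leaves only `a` or `b`, which would then have two far neighbours and charge
        -- at least 3.
        only-far : ∀ {w} → Far w → w ≡ x ⊎ w ≡ y
        only-far {w} fw with w Fin.≟ x | w Fin.≟ y
        ... | yes w≡x | _       = inj₁ w≡x
        ... | no  _   | yes w≡y = inj₂ w≡y
        ... | no w≢x  | no w≢y  = ⊥-elim (isolated (other-neighbour {w} {w} (2≤degree w)))
          where
          r≡0 : farNeighbours w ≡ 0
          r≡0 = trans (sym (charge-far fw)) (inactive w≢x w≢y (far≢near fw ua) (far≢near fw ub))
          isolated : ∃[ v ] v ≢ w × Adj w v → ⊥
          isolated (v , _ , wv) with far-neighbour-near fw r≡0 wv
          ... | uv with v Fin.≟ a | v Fin.≟ b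
          ...   | yes refl | _ = contradiction
                  (≤-trans (charge-near-lower 2 ua (two-far-neighbours w≢x (Adj-sym wv) fw ax fx)) only-a) λ { (s≤s ()) }
          ...   | no _ | yes refl = contradiction
                  (≤-trans (charge-near-lower 2 ub (two-far-neighbours w≢y (Adj-sym wv) fw by fy)) only-b) λ { (s≤s ()) }
          ...   | no v≢a | no v≢b = contradiction
                  (subst (1 ≤_) (inactive (near≢far uv fx) (near≢far uv fy) v≢a v≢b) (charge-near-far uv fw (Adj-sym wv))) λ ()

      far? : ∀ w → Dec (Far w)
      far? w = ¬? (w Fin.≟ u) ×-dec ¬? (adj? u w)

      squares-or-pentagon : Squares ⊎ Pentagon
      squares-or-pentagon with Fin.any? (λ w → far? w ×-dec (1 ≤? farNeighbours w))
      ... | yes (x , fx , 1≤r) with ∃-far-neighbour 1≤r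
      ...   | y , xy , fy = inj₂ (pentagon fx fy xy)
      squares-or-pentagon | no none = inj₁ (squares λ {w} fw → n<1⇒n≡0 (≰⇒> λ 1≤r → none (w , fw , 1≤r)))

-- The weights as subinvariant vectors

module Weights where

  open SignlessLaplacian
  open Inequalities
  open Counting
  open Neighbourhood
  open import Data.Nat.Base
  open import Data.Nat.Properties
  open import Data.Nat.Solver using (module +-*-Solver)
  open import Algebra.Properties.Semiring.Sum +-*-semiring using (*-distribˡ-sum; *-distribʳ-sum)
  open import Algebra.Properties.CommutativeMonoid.Sum +-0-commutativeMonoid
    using (sum; sum-cong-≗; ∑-distrib-+)
  open ListSum +-0-commutativeMonoid using (∑-erase; erase; erase-self; erase-other)

  module _ (G : FiniteGraph) where
    open GraphFacts G

    lowDegree-subinvariant : ∀ j → size ≡ 3 * (j + 6) + 2 → (∀ v → 2 ≤ degree v) →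
      (∀ v → degree v < 2 * (j + 6)) →
      (∀ u → 2 * sum (λ v → adjacency u v * degree v) ≤ sum degree + degree u) →
      Subinvariant G (num (j + 6)) (den (j + 6)) (λ v → 7 * degree v ∸ 1)
    lowDegree-subinvariant j size≡m 2≤degree degree<2k bound u =
      degreeWeight-bound j (degree u) s t (2≤degree u) (degree<2k u)
        (subst (λ e → 2 * s ≤ e + degree u) (trans handshake (cong (2 *_) size≡m)) (bound u))
        (begin
          t + degree u
            ≡⟨ ∑-distrib-+ (λ v → adjacency u v * (7 * degree v ∸ 1)) (adjacency u) ⟨
          sum (λ v → adjacency u v * (7 * degree v ∸ 1) + adjacency u v)
            ≡⟨ sum-cong-≗ local ⟩
          sum (λ v → 7 * (adjacency u v * degree v))
            ≡⟨ *-distribˡ-sum 7 (λ v → adjacency u v * degree v) ⟨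
          7 * s ∎)
      where
      open ≡-Reasoning
      s = sum (λ v → adjacency u v * degree v)
      t = sum (λ v → adjacency u v * (7 * degree v ∸ 1))
      local : ∀ v → adjacency u v * (7 * degree v ∸ 1) + adjacency u v ≡ 7 * (adjacency u v * degree v)
      local v = begin
        A * (7 * d ∸ 1) + A             ≡⟨ cong (A * (7 * d ∸ 1) +_) (*-identityʳ A) ⟨
        A * (7 * d ∸ 1) + A * 1         ≡⟨ *-distribˡ-+ A (7 * d ∸ 1) 1 ⟨
        A * (7 * d ∸ 1 + 1)             ≡⟨ cong (A *_) (m∸n+n≡m (≤-trans (≤-trans (s≤s z≤n) (2≤degree v)) (m≤n*m d 7))) ⟩
        A * (7 * d)                     ≡⟨ solve 2 (λ A d → A :* (con 7 :* d) := con 7 :* (A :* d)) refl A d ⟩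
        7 * (A * d)                     ∎
        where
        open +-*-Solver
        A = adjacency u v
        d = degree v

    module _ (j : ℕ) (u : Fin order) (2≤degree : ∀ v → 2 ≤ degree v)
             (noDiamond : ThetaFree.NoDiamond G) (noHouse : ThetaFree.NoHouse G)
             (degree≡2k : degree u ≡ 2 * (j + 6)) where
      open Charges G u
      open Structure G u 2≤degree noDiamond noHouse
      open SquareWeights (den (j + 6)) (excess j)

      nearWeight : ℕ → ℕ
      nearWeight zero    = squareW
      nearWeight (suc _) = triangleW

      positionWeight : ∀ v → Position v → ℕ
      positionWeight v (centre _) = centreW
      positionWeight v (near _)   = nearWeight (nearNeighbours v)
      positionWeight v (far _ _)  = farW

      weight : Fin order → ℕ
      weight v = positionWeight v (position v)

      -- `weight` inspects the evidence that `position` happens to compute; this permits evaluating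
      -- it with any other evidence.
      weight-position : ∀ v (p : Position v) → weight v ≡ positionWeight v p
      weight-position v p = unique (position v) p
        where
        unique : ∀ p q → positionWeight v p ≡ positionWeight v q
        unique (centre _)    (centre _)    = refl
        unique (near _)      (near _)      = refl
        unique (far _ _)     (far _ _)     = refl
        unique (centre refl) (near uu)     = contradiction uu (Adj-irr refl)
        unique (centre v≡u)  (far v≢u _)   = contradiction v≡u v≢u
        unique (near uu)     (centre refl) = contradiction uu (Adj-irr refl)
        unique (near uv)     (far _ ¬uv)   = contradiction uv ¬uv
        unique (far v≢u _)   (centre v≡u)  = contradiction v≡u v≢u
        unique (far _ ¬uv)   (near uv)     = contradiction uv ¬uv

      weight-triangle : ∀ {v} → Adj u v → 1 ≤ nearNeighbours v → weight v ≡ triangleW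
      weight-triangle {v} uv 1≤c = trans (weight-position v (near uv)) (nearWeight-suc 1≤c)
        where
        nearWeight-suc : ∀ {c} → 1 ≤ c → nearWeight c ≡ triangleW
        nearWeight-suc (s≤s _) = refl

      weight-square : ∀ {v} → Adj u v → nearNeighbours v ≡ 0 → weight v ≡ squareW
      weight-square {v} uv c≡0 = trans (weight-position v (near uv)) (cong nearWeight c≡0)

      weight-far : ∀ {v} → Far v → weight v ≡ farW
      weight-far {v} (v≢u , ¬uv) = weight-position v (far v≢u ¬uv)

      weight-pos : ∀ v → 0 < weight v
      weight-pos v = pos (position v)
        where
        nearWeight-pos : ∀ c → 0 < nearWeight c
        nearWeight-pos zero    = 0<squareW j
        nearWeight-pos (suc _) = 0<triangleW j
        pos : ∀ p → 0 < positionWeight v p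
        pos (centre _) = 0<centreW j
        pos (near _)   = nearWeight-pos (nearNeighbours v)
        pos (far _ _)  = 0<farW j

      module _ (squares : Squares) where
        open Squares squares

        near-cases : ∀ {v} → Adj u v →
          (nearNeighbours v ≡ 1 × farNeighbours v ≡ 0) ⊎ (nearNeighbours v ≡ 0 × farNeighbours v ≡ 1)
        near-cases {v} uv = split (nearNeighbours v) (farNeighbours v) (near-degree uv)
          where
          split : ∀ c r → c + r ≡ 1 → (c ≡ 1 × r ≡ 0) ⊎ (c ≡ 0 × r ≡ 1)
          split zero       r r≡1  = inj₂ (refl , r≡1)
          split (suc zero) r r≡0  = inj₁ (refl , suc-injective r≡0)

        weight-near : ∀ {v} → Adj u v → weight v ≡ nearNeighbours v * triangleW + farNeighbours v * squareW
        weight-near {v} uv with near-cases uv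
        ... | inj₁ (c≡1 , r≡0) = trans (weight-triangle uv (≤-reflexive (sym c≡1)))
                (sym (trans (cong₂ (λ c r → c * triangleW + r * squareW) c≡1 r≡0)
                  (trans (+-identityʳ _) (+-identityʳ _))))
        ... | inj₂ (c≡0 , r≡1) = trans (weight-square uv c≡0)
                (sym (trans (cong₂ (λ c r → c * triangleW + r * squareW) c≡0 r≡1) (+-identityʳ _)))

        -- By `near-degree` every neighbour of `u` counts once, either here or in the sum of far
        -- neighbours; the latter is 4 and the degree is `2k`.
        near-near : sum (λ v → adjacency u v * nearNeighbours v) ≡ 2 * j + 8
        near-near = +-cancelʳ-≡ 4 _ (2 * j + 8) (begin
          sum (λ v → adjacency u v * nearNeighbours v) + 4
            ≡⟨ cong (sum (λ v → adjacency u v * nearNeighbours v) +_) total ⟨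
          sum (λ v → adjacency u v * nearNeighbours v) + sum (λ v → adjacency u v * farNeighbours v)
            ≡⟨ ∑-distrib-+ (λ v → adjacency u v * nearNeighbours v) (λ v → adjacency u v * farNeighbours v) ⟨
          sum (λ v → adjacency u v * nearNeighbours v + adjacency u v * farNeighbours v)
            ≡⟨ sum-cong-≗ local ⟩
          degree u
            ≡⟨ degree≡2k ⟩
          2 * (j + 6)
            ≡⟨ solve 1 (λ j → con 2 :* (j :+ con 6) := con 2 :* j :+ con 8 :+ con 4) refl j ⟩
          2 * j + 8 + 4 ∎)
          where
          open ≡-Reasoning
          open +-*-Solver
          local : ∀ v → adjacency u v * nearNeighbours v + adjacency u v * farNeighbours v ≡ adjacency u v
          local v with adj? u v
          ... | no  _  = refl
          ... | yes uv = trans (cong₂ _+_ (+-identityʳ (nearNeighbours v)) (+-identityʳ (farNeighbours v))) (near-degree uv)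

        sum-centre : sum (λ v → adjacency u v * weight v) ≡ (2 * j + 8) * triangleW + 4 * squareW
        sum-centre = begin
          sum (λ v → adjacency u v * weight v)
            ≡⟨ sum-cong-≗ local ⟩
          sum (λ v → adjacency u v * nearNeighbours v * triangleW + adjacency u v * farNeighbours v * squareW)
            ≡⟨ ∑-distrib-+ (λ v → adjacency u v * nearNeighbours v * triangleW) (λ v → adjacency u v * farNeighbours v * squareW) ⟩
          sum (λ v → adjacency u v * nearNeighbours v * triangleW) + sum (λ v → adjacency u v * farNeighbours v * squareW)
            ≡⟨ cong₂ _+_ (sym (*-distribʳ-sum triangleW (λ v → adjacency u v * nearNeighbours v)))
                         (sym (*-distribʳ-sum squareW (λ v → adjacency u v * farNeighbours v))) ⟩
          sum (λ v → adjacency u v * nearNeighbours v) * triangleW + sum (λ v → adjacency u v * farNeighbours v) * squareW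
            ≡⟨ cong₂ (λ c r → c * triangleW + r * squareW) near-near total ⟩
          (2 * j + 8) * triangleW + 4 * squareW ∎
          where
          open ≡-Reasoning
          local : ∀ v → adjacency u v * weight v ≡
            adjacency u v * nearNeighbours v * triangleW + adjacency u v * farNeighbours v * squareW
          local v = begin
            A * weight v                                ≡⟨ near-only v ⟩
            A * (c * triangleW + r * squareW)           ≡⟨ *-distribˡ-+ A (c * triangleW) (r * squareW) ⟩
            A * (c * triangleW) + A * (r * squareW)     ≡⟨ cong₂ _+_ (*-assoc A c triangleW) (*-assoc A r squareW) ⟨
            A * c * triangleW + A * r * squareW         ∎
            where
            A = adjacency u v
            c = nearNeighbours v
            r = farNeighbours v
            near-only : ∀ v → adjacency u v * weight v ≡ adjacency u v * (nearNeighbours v * triangleW + farNeighbours v * squareW)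
            near-only v = by-position (position v)
              where
              vanish : ¬ Adj u v → adjacency u v * weight v ≡ adjacency u v * (nearNeighbours v * triangleW + farNeighbours v * squareW)
              vanish ¬uv = trans (cong (_* weight v) (adjacency-0 ¬uv)) (cong (_* (nearNeighbours v * triangleW + farNeighbours v * squareW)) (sym (adjacency-0 ¬uv)))
              by-position : Position v → adjacency u v * weight v ≡ adjacency u v * (nearNeighbours v * triangleW + farNeighbours v * squareW)
              by-position (centre v≡u) = vanish (λ uv → Adj-irr (sym v≡u) uv)
              by-position (near uv)    = cong (adjacency u v *_) (weight-near uv)
              by-position (far _ ¬uv)  = vanish ¬uv

        sum-near : ∀ {v} → Adj u v → sum (λ x → adjacency v x * weight x) ≡
          centreW + (nearNeighbours v * triangleW + farNeighbours v * farW)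
        sum-near {v} uv = begin
          sum (λ x → adjacency v x * weight x)
            ≡⟨ ∑-erase u (λ x → adjacency v x * weight x) ⟩
          adjacency v u * weight u + sum (erase u (λ x → adjacency v x * weight x))
            ≡⟨ cong₂ _+_ (trans (cong₂ _*_ (adjacency-1 (Adj-sym uv)) (weight-position u (centre refl))) (+-identityʳ centreW))
                 (sum-cong-≗ λ x → local x (position x)) ⟩
          centreW + sum (λ x → adjacency v x * adjacency u x * triangleW + adjacency v x * farness x * farW)
            ≡⟨ cong (centreW +_) (∑-distrib-+ (λ x → adjacency v x * adjacency u x * triangleW) (λ x → adjacency v x * farness x * farW)) ⟩
          centreW + (sum (λ x → adjacency v x * adjacency u x * triangleW) + sum (λ x → adjacency v x * farness x * farW))
            ≡⟨ cong (centreW +_) (cong₂ _+_ (sym (*-distribʳ-sum triangleW (λ x → adjacency v x * adjacency u x)))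
                                            (sym (*-distribʳ-sum farW (λ x → adjacency v x * farness x)))) ⟩
          centreW + (nearNeighbours v * triangleW + farNeighbours v * farW) ∎
          where
          open ≡-Reasoning
          local : ∀ x → Position x → erase u (λ x → adjacency v x * weight x) x ≡
            adjacency v x * adjacency u x * triangleW + adjacency v x * farness x * farW
          local x (centre refl) = trans (erase-self u (λ x → adjacency v x * weight x))
            (sym (cong₂ _+_
              (cong (_* triangleW) (trans (cong (adjacency v u *_) (adjacency-0 {u} {u} (Adj-irr refl))) (*-zeroʳ (adjacency v u))))
              (cong (_* farW) (trans (cong (adjacency v u *_) farness-centre) (*-zeroʳ (adjacency v u))))))
          local x (far x≢u ¬ux) = trans (erase-other (λ x → adjacency v x * weight x) x≢u) (begin
            A * weight x                           ≡⟨ cong (A *_) (weight-far (x≢u , ¬ux)) ⟩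
            A * farW                               ≡⟨ cong (_* farW) (*-identityʳ A) ⟨
            A * 1 * farW                           ≡⟨ cong (λ z → z * triangleW + A * 1 * farW) (*-zeroʳ A) ⟨
            A * 0 * triangleW + A * 1 * farW       ≡⟨ cong₂ (λ n ω → A * n * triangleW + A * ω * farW)
                                                        (adjacency-0 ¬ux) (farness-1 (x≢u , ¬ux)) ⟨
            A * adjacency u x * triangleW + A * farness x * farW ∎)
            where A = adjacency v x
          local x (near ux) = trans (erase-other (λ x → adjacency v x * weight x) (Adj⇒≢ (Adj-sym ux))) (begin
            A * weight x                           ≡⟨ triangle (adj? v x) ⟩
            A * triangleW                          ≡⟨ cong (_* triangleW) (*-identityʳ A) ⟨
            A * 1 * triangleW                      ≡⟨ +-identityʳ _ ⟨
            A * 1 * triangleW + 0                  ≡⟨ cong (λ z → A * 1 * triangleW + z * farW) (*-zeroʳ A) ⟨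
            A * 1 * triangleW + A * 0 * farW       ≡⟨ cong₂ (λ n ω → A * n * triangleW + A * ω * farW)
                                                        (adjacency-1 ux) (farness-near ux) ⟨
            A * adjacency u x * triangleW + A * farness x * farW ∎)
            where
            A = adjacency v x
            triangle : Dec (Adj v x) → A * weight x ≡ A * triangleW
            triangle (yes vx) = cong (A *_) (weight-triangle ux (near-neighbour (Adj-sym vx) uv))
            triangle (no ¬vx) = trans (cong (_* weight x) (adjacency-0 ¬vx)) (cong (_* triangleW) (sym (adjacency-0 ¬vx)))

        sum-far : ∀ {w} → Far w → sum (λ x → adjacency w x * weight x) ≤ degree w * squareW
        sum-far {w} fw = ≤-trans (sum-mono λ x → local x (adj? w x))
          (≤-reflexive (sym (*-distribʳ-sum squareW (adjacency w))))
          where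
          local : ∀ x → Dec (Adj w x) → adjacency w x * weight x ≤ adjacency w x * squareW
          local x (no ¬wx) = ≤-trans (≤-reflexive (cong (_* weight x) (adjacency-0 ¬wx))) z≤n
          local x (yes wx) = *-monoʳ-≤ (adjacency w x) (≤-reflexive (weight-square ux (square (near-cases ux))))
            where
            ux : Adj u x
            ux = far-neighbour-near fw (far-far fw) wx
            square : (nearNeighbours x ≡ 1 × farNeighbours x ≡ 0) ⊎ (nearNeighbours x ≡ 0 × farNeighbours x ≡ 1) → nearNeighbours x ≡ 0
            square (inj₁ (_ , r≡0)) = contradiction (subst (1 ≤_) r≡0 (far-neighbour (Adj-sym wx) fw)) λ ()
            square (inj₂ (c≡0 , _)) = c≡0

        squares-subinvariant : Subinvariant G (num (j + 6)) (den (j + 6)) weight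
        squares-subinvariant v = by-position (position v)
          where
          D = den (j + 6)
          N = num (j + 6)
          Goal : ℕ → ℕ → Set
          Goal d w = D * (d * w + sum (λ x → adjacency v x * weight x)) ≤ N * w
          degree≡2 : Adj u v → degree v ≡ 2
          degree≡2 uv = trans (degree-near uv) (cong suc (near-degree uv))
          by-position : Position v → Goal (degree v) (weight v)
          by-position (centre refl) = subst₂ Goal
            (sym (trans degree≡2k (2*[j+6] j)))
            (sym (weight-position u (centre refl)))
            (squareWeights-centre j (≤-reflexive sum-centre))
            where
            open +-*-Solver
            2*[j+6] : ∀ j → 2 * (j + 6) ≡ 2 * j + 12
            2*[j+6] = solve 1 (λ j → con 2 :* (j :+ con 6) := con 2 :* j :+ con 12) refl
          by-position (near uv) with near-cases uv
          ... | inj₁ (c≡1 , r≡0) = subst₂ Goal (sym (degree≡2 uv)) (sym (weight-triangle uv (≤-reflexive (sym c≡1))))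
            (squareWeights-triangle j (≤-reflexive (trans (sum-near uv)
              (cong (centreW +_) (trans (cong₂ (λ c r → c * triangleW + r * farW) c≡1 r≡0) (trans (+-identityʳ _) (+-identityʳ _)))))))
          ... | inj₂ (c≡0 , r≡1) = subst₂ Goal (sym (degree≡2 uv)) (sym (weight-square uv c≡0))
            (squareWeights-square j (≤-reflexive (trans (sum-near uv)
              (cong (centreW +_) (trans (cong₂ (λ c r → c * triangleW + r * farW) c≡0 r≡1) (+-identityʳ _))))))
          by-position (far v≢u ¬uv) = subst (Goal (degree v)) (sym (weight-far (v≢u , ¬uv)))
            (squareWeights-far j (far-degree (v≢u , ¬uv)) (sum-far (v≢u , ¬uv)))

-- Reconstruction of H from the 5-cycle

module ExtremalGraph where

  open Counting
  open Neighbourhood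
  open import Data.Nat.Base
  open import Data.Nat.Properties
  open ListSum +-0-commutativeMonoid using (sumL; ∑-support)

  lookup-injective : ∀ {A : Set} {xs : List A} → Unique xs → ∀ {i j} → lookup xs i ≡ lookup xs j → i ≡ j
  lookup-injective {xs = x ∷ xs} (x∉ ∷ u) {zero}  {zero}  _ = refl
  lookup-injective {xs = x ∷ xs} (x∉ ∷ u) {zero}  {suc j} e = contradiction e (All.lookup x∉ (∈-lookup j))
  lookup-injective {xs = x ∷ xs} (x∉ ∷ u) {suc i} {zero}  e = contradiction (sym e) (All.lookup x∉ (∈-lookup i))
  lookup-injective {xs = x ∷ xs} (x∉ ∷ u) {suc i} {suc j} e = cong suc (lookup-injective u e)

  module FromPentagon (G : FiniteGraph) (u : Fin (FiniteGraph.order G))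
                      (2≤degree : ∀ v → 2 ≤ FiniteGraph.degree G v)
                      (noDiamond : ThetaFree.NoDiamond G) (noHouse : ThetaFree.NoHouse G)
                      (cycle : Structure.Pentagon G u 2≤degree noDiamond noHouse) where
    open GraphFacts G
    open Charges G u
    open Structure G u 2≤degree noDiamond noHouse
    open Pentagon cycle

    near-unique : ∀ {v w w′} → Adj u v → Adj v w → Adj u w → Adj v w′ → Adj u w′ → w ≡ w′
    near-unique uv vw uw vw′ uw′ = noDiamond uv uw (Adj-sym vw) uw′ (Adj-sym vw′)

    far-unique : ∀ {v w w′} → farNeighbours v ≡ 1 → Adj v w → Far w → Adj v w′ → Far w′ → w ≡ w′
    far-unique {v} {w} {w′} r≡1 vw fw vw′ fw′ with w Fin.≟ w′
    ... | yes w≡w′ = w≡w′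
    ... | no  w≢w′ = contradiction (subst (2 ≤_) r≡1 (two-far-neighbours w≢w′ vw fw vw′ fw′)) λ { (s≤s ()) }

    no-near : ∀ {v w} → nearNeighbours v ≡ 0 → Adj v w → ¬ Adj u w
    no-near c≡0 vw uw = contradiction (subst (1 ≤_) c≡0 (near-neighbour vw uw)) λ ()

    -- Lists each triangle at `u` exactly once by ordering it: `lead` is its vertex of smaller
    -- index. The number `h` of triangles stays open until the degree of `u` is counted.
    record Pairs (h : ℕ) : Set where
      field
        lead mate      : Fin h → Fin order
        lead-near      : ∀ i → Adj u (lead i)
        mate-near      : ∀ i → Adj u (mate i)
        lead-mate      : ∀ i → Adj (lead i) (mate i)
        lead<mate      : ∀ i → toℕ (lead i) < toℕ (mate i)
        lead-injective : ∀ {i i′} → lead i ≡ lead i′ → i ≡ i′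
        exhaustive     : ∀ {v w} → Adj u v → Adj v w → Adj u w → toℕ v < toℕ w → ∃[ i ] lead i ≡ v

      mate-injective : ∀ {i i′} → mate i ≡ mate i′ → i ≡ i′
      mate-injective {i} {i′} e = lead-injective (near-unique (mate-near i)
        (Adj-sym (lead-mate i)) (lead-near i) (subst (λ v → Adj v (lead i′)) (sym e) (Adj-sym (lead-mate i′))) (lead-near i′))

      lead≢mate : ∀ i i′ → lead i ≢ mate i′
      lead≢mate i i′ e = <-asym (lead<mate i) (subst₂ (λ v w → toℕ v < toℕ w) lead≡mate (sym e) (lead<mate i′))
        where
        lead≡mate : lead i′ ≡ mate i
        lead≡mate = near-unique (lead-near i) (subst (λ v → Adj v (lead i′)) (sym e) (Adj-sym (lead-mate i′)))
          (lead-near i′) (lead-mate i) (mate-near i)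

      lead≢ : ∀ {v} i → nearNeighbours v ≡ 0 → lead i ≢ v
      lead≢ i c≡0 refl = no-near c≡0 (lead-mate i) (mate-near i)

      mate≢ : ∀ {v} i → nearNeighbours v ≡ 0 → mate i ≢ v
      mate≢ i c≡0 refl = no-near c≡0 (Adj-sym (lead-mate i)) (lead-near i)

      near-classified : ∀ {v} → Adj u v → (v ≡ a ⊎ v ≡ b) ⊎ ∃[ i ] (lead i ≡ v ⊎ mate i ≡ v)
      near-classified {v} uv with v Fin.≟ a | v Fin.≟ b
      ... | yes v≡a | _       = inj₁ (inj₁ v≡a)
      ... | no  _   | yes v≡b = inj₁ (inj₂ v≡b)
      ... | no v≢a  | no v≢b  with ∃-near-neighbour (≤-reflexive (sym (proj₁ (triangle uv v≢a v≢b))))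
      ...   | w , vw , uw with Fin.<-cmp v w
      ...     | tri≈ _ v≡w _ = contradiction v≡w (Adj⇒≢ vw)
      ...     | tri< v<w _ _ with exhaustive uv vw uw v<w
      ...       | i , lead≡v = inj₂ (i , inj₁ lead≡v)
      near-classified {v} uv | no v≢a | no v≢b | w , vw , uw | tri> _ _ w<v with exhaustive uw (Adj-sym vw) uv w<v
      ...       | i , refl = inj₂ (i , inj₂ (near-unique uw (lead-mate i) (mate-near i) (Adj-sym vw) uv))

    pairs : ∃ Pairs
    pairs = length leads , record
      { lead           = lookup leads
      ; mate           = λ i → proj₁ (mated i)
      ; lead-near      = λ i → proj₁ (isLead i)
      ; mate-near      = λ i → proj₁ (proj₂ (proj₂ (mated i)))
      ; lead-mate      = λ i → proj₁ (proj₂ (mated i))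
      ; lead<mate      = λ i → proj₂ (proj₂ (proj₂ (mated i)))
      ; lead-injective = lookup-injective (Unique.filter⁺ lead? (Unique.allFin⁺ order))
      ; exhaustive     = λ {v} {w} uv vw uw v<w →
          let v∈leads = ∈-filter⁺ lead? (∈-allFin v) (uv , w , vw , uw , v<w)
          in index v∈leads , sym (lookup-index v∈leads)
      }
      where
      Lead : Fin order → Set
      Lead v = Adj u v × ∃[ w ] Adj v w × Adj u w × toℕ v < toℕ w
      lead? : ∀ v → Dec (Lead v)
      lead? v = adj? u v ×-dec Fin.any? (λ w → adj? v w ×-dec adj? u w ×-dec (toℕ v <? toℕ w))
      leads : List (Fin order)
      leads = filter lead? (allFin order)
      isLead : ∀ i → Lead (lookup leads i)
      isLead i = proj₂ (∈-filter⁻ lead? {xs = allFin order} (∈-lookup i))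
      mated : ∀ i → ∃[ w ] Adj (lookup leads i) w × Adj u w × toℕ (lookup leads i) < toℕ w
      mated i = proj₂ (isLead i)

    sumL-ones : ∀ {L} → All (Adj u) L → sumL (adjacency u) L ≡ length L
    sumL-ones []        = refl
    sumL-ones (uv ∷ uL) = cong₂ _+_ (adjacency-1 uv) (sumL-ones uL)

    -- Together with `degree u = 2k` this fixes the number of triangles as `k − 1`: the neighbours
    -- of `u` are `a`, `b` and the two vertices of each pair.
    degree-pairs : ∀ {h} → Pairs h → degree u ≡ 2 + (h + h)
    degree-pairs {h} P = begin
      degree u                   ≡⟨ ∑-support L (adjacency u) unique supported ⟩
      sumL (adjacency u) L       ≡⟨ sumL-ones (ua ∷ ub ∷ All.++⁺ (All.tabulate⁺ lead-near) (All.tabulate⁺ mate-near)) ⟩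
      length L                   ≡⟨ cong (2 +_) (trans (length-++ (tabulate lead))
                                      (cong₂ _+_ (length-tabulate lead) (length-tabulate mate))) ⟩
      2 + (h + h)                ∎
      where
      open ≡-Reasoning
      open Pairs P
      L = a ∷ b ∷ tabulate lead ++ tabulate mate
      unique : Unique L
      unique =
        (a≢b ∷ All.++⁺ (All.tabulate⁺ (λ i → lead≢ i a-near ∘ sym)) (All.tabulate⁺ (λ i → mate≢ i a-near ∘ sym))) ∷
        All.++⁺ (All.tabulate⁺ (λ i → lead≢ i b-near ∘ sym)) (All.tabulate⁺ (λ i → mate≢ i b-near ∘ sym)) ∷
        Unique.++⁺ (Unique.tabulate⁺ lead-injective) (Unique.tabulate⁺ mate-injective) disjoint
        where
        disjoint : ∀ {v} → ¬ (v ∈ tabulate lead × v ∈ tabulate mate)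
        disjoint (v∈lead , v∈mate) with ∈-tabulate⁻ v∈lead | ∈-tabulate⁻ v∈mate
        ... | i , refl | i′ , e = lead≢mate i i′ e
      supported : ∀ v → v ∈ L ⊎ adjacency u v ≡ 0
      supported v with adj? u v
      ... | no  _  = inj₂ refl
      ... | yes uv with near-classified uv
      ...   | inj₁ (inj₁ v≡a) = inj₁ (here v≡a)
      ...   | inj₁ (inj₂ v≡b) = inj₁ (there (here v≡b))
      ...   | inj₂ (i , inj₁ refl) = inj₁ (there (there (∈-++⁺ˡ (∈-tabulate⁺ i))))
      ...   | inj₂ (i , inj₂ refl) = inj₁ (there (there (∈-++⁺ʳ (tabulate lead) (∈-tabulate⁺ i))))

    module _ (p : ℕ) (P : Pairs ((p ∸ 1) / 2)) where
      open Pairs P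

      embed : HVertex p 5 → Fin order
      embed centre      = u
      embed (leaf i 0F) = lead i
      embed (leaf i 1F) = mate i
      embed (rim 0F)    = a
      embed (rim 1F)    = x
      embed (rim 2F)    = y
      embed (rim 3F)    = b

      preimage : ∀ v → ∃[ h ] embed h ≡ v
      preimage v with position v
      ... | centre v≡u = centre , sym v≡u
      ... | near uv with near-classified uv
      ...   | inj₁ (inj₁ v≡a)      = rim 0F , sym v≡a
      ...   | inj₁ (inj₂ v≡b)      = rim 3F , sym v≡b
      ...   | inj₂ (i , inj₁ eq)   = leaf i 0F , eq
      ...   | inj₂ (i , inj₂ eq)   = leaf i 1F , eq
      preimage v | far v≢u ¬uv with only-far (v≢u , ¬uv)
      ...   | inj₁ v≡x = rim 1F , sym v≡x
      ...   | inj₂ v≡y = rim 2F , sym v≡y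

      embed-near : ∀ {h} → Adj u (embed h) → SymClosure (HLink p 5) centre h
      embed-near {centre}    uv = contradiction uv (Adj-irr refl)
      embed-near {leaf i k}  uv = fwd (spoke i k)
      embed-near {rim 0F}    uv = fwd (first 0F refl)
      embed-near {rim 1F}    uv = contradiction uv (proj₂ far-x)
      embed-near {rim 2F}    uv = contradiction uv (proj₂ far-y)
      embed-near {rim 3F}    uv = bwd (last 3F refl)

      leaf-near : ∀ i k → Adj u (embed (leaf i k))
      leaf-near i 0F = lead-near i
      leaf-near i 1F = mate-near i

      leaf≢ : ∀ i k {v} → nearNeighbours v ≡ 0 → embed (leaf i k) ≢ v
      leaf≢ i 0F = lead≢ i
      leaf≢ i 1F = mate≢ i

      embed-injective : ∀ g h → embed g ≡ embed h → g ≡ h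
      embed-injective centre     centre     _ = refl
      embed-injective centre     (leaf i k) e = contradiction e (Adj⇒≢ (leaf-near i k))
      embed-injective centre     (rim 0F)   e = contradiction e (Adj⇒≢ ua)
      embed-injective centre     (rim 3F)   e = contradiction e (Adj⇒≢ ub)
      embed-injective centre     (rim 1F)   e = contradiction e (proj₁ far-x ∘ sym)
      embed-injective centre     (rim 2F)   e = contradiction e (proj₁ far-y ∘ sym)
      embed-injective (leaf i k) centre     e = contradiction (sym e) (Adj⇒≢ (leaf-near i k))
      embed-injective (leaf i 0F) (leaf i′ 0F) e = cong (λ i → leaf i 0F) (lead-injective e)
      embed-injective (leaf i 0F) (leaf i′ 1F) e = contradiction e (lead≢mate i i′)
      embed-injective (leaf i 1F) (leaf i′ 0F) e = contradiction (sym e) (lead≢mate i′ i)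
      embed-injective (leaf i 1F) (leaf i′ 1F) e = cong (λ i → leaf i 1F) (mate-injective e)
      embed-injective (leaf i k) (rim 0F)   e = contradiction e (leaf≢ i k a-near)
      embed-injective (leaf i k) (rim 3F)   e = contradiction e (leaf≢ i k b-near)
      embed-injective (leaf i k) (rim 1F)   e = contradiction e (near≢far (leaf-near i k) far-x)
      embed-injective (leaf i k) (rim 2F)   e = contradiction e (near≢far (leaf-near i k) far-y)
      embed-injective (rim 0F)   centre     e = contradiction (sym e) (Adj⇒≢ ua)
      embed-injective (rim 0F)   (leaf i k) e = contradiction (sym e) (leaf≢ i k a-near)
      embed-injective (rim 0F)   (rim 0F)   _ = refl
      embed-injective (rim 0F)   (rim 3F)   e = contradiction e (a≢b)
      embed-injective (rim 0F)   (rim 1F)   e = contradiction e (near≢far ua far-x)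
      embed-injective (rim 0F)   (rim 2F)   e = contradiction e (near≢far ua far-y)
      embed-injective (rim 3F)   centre     e = contradiction (sym e) (Adj⇒≢ ub)
      embed-injective (rim 3F)   (leaf i k) e = contradiction (sym e) (leaf≢ i k b-near)
      embed-injective (rim 3F)   (rim 0F)   e = contradiction (sym e) (a≢b)
      embed-injective (rim 3F)   (rim 3F)   _ = refl
      embed-injective (rim 3F)   (rim 1F)   e = contradiction e (near≢far ub far-x)
      embed-injective (rim 3F)   (rim 2F)   e = contradiction e (near≢far ub far-y)
      embed-injective (rim 1F)   centre     e = contradiction (sym e) (proj₁ far-x ∘ sym)
      embed-injective (rim 1F)   (leaf i k) e = contradiction (sym e) (near≢far (leaf-near i k) far-x)
      embed-injective (rim 1F)   (rim 0F)   e = contradiction (sym e) (near≢far ua far-x)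
      embed-injective (rim 1F)   (rim 3F)   e = contradiction (sym e) (near≢far ub far-x)
      embed-injective (rim 1F)   (rim 1F)   _ = refl
      embed-injective (rim 1F)   (rim 2F)   e = contradiction e (Adj⇒≢ xy)
      embed-injective (rim 2F)   centre     e = contradiction (sym e) (proj₁ far-y ∘ sym)
      embed-injective (rim 2F)   (leaf i k) e = contradiction (sym e) (near≢far (leaf-near i k) far-y)
      embed-injective (rim 2F)   (rim 0F)   e = contradiction (sym e) (near≢far ua far-y)
      embed-injective (rim 2F)   (rim 3F)   e = contradiction (sym e) (near≢far ub far-y)
      embed-injective (rim 2F)   (rim 1F)   e = contradiction (sym e) (Adj⇒≢ xy)
      embed-injective (rim 2F)   (rim 2F)   _ = refl

      link : ∀ {g h} → HLink p 5 g h → Adj (embed g) (embed h)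
      link (spoke i 0F)     = lead-near i
      link (spoke i 1F)     = mate-near i
      link (base i)         = lead-mate i
      link (first 0F _)     = ua
      link (next 0F 1F _)   = ax
      link (next 1F 2F _)   = xy
      link (next 2F 3F _)   = yb
      link (last 3F _)      = Adj-sym ub

      leaf-not-far : ∀ i k {w} → Far w → Adj (embed (leaf i k)) w → ⊥
      leaf-not-far i k fw e = contradiction
        (subst (1 ≤_) (proj₂ (triangle (leaf-near i k) (leaf≢ i k a-near) (leaf≢ i k b-near))) (far-neighbour e fw)) λ ()

      private
        swap : ∀ {g h} → SymClosure (HLink p 5) g h → SymClosure (HLink p 5) h g
        swap = SymClosure.symmetric (HLink p 5)

      -- No edges exist beyond those of `H`: the partner of a leaf is unique without diamonds,
      -- leaves have no far neighbours, and `a` and `b` have one far neighbour each and none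
      -- adjacent to `u`.
      link⁻ : ∀ g h → Adj (embed g) (embed h) → SymClosure (HLink p 5) g h
      link⁻ centre h e = embed-near e
      link⁻ g centre e = swap (embed-near (Adj-sym e))
      link⁻ (leaf i 0F) (leaf i′ 0F) e = contradiction (near-unique (lead-near i) e (lead-near i′) (lead-mate i) (mate-near i)) (lead≢mate i′ i)
      link⁻ (leaf i 0F) (leaf i′ 1F) e with mate-injective (near-unique (lead-near i) (lead-mate i) (mate-near i) e (mate-near i′))
      ... | refl = fwd (base i)
      link⁻ (leaf i 1F) (leaf i′ 0F) e with lead-injective (near-unique (mate-near i) (Adj-sym (lead-mate i)) (lead-near i) e (lead-near i′))
      ... | refl = bwd (base i)
      link⁻ (leaf i 1F) (leaf i′ 1F) e = contradiction (near-unique (mate-near i) (Adj-sym (lead-mate i)) (lead-near i) e (mate-near i′)) (lead≢mate i i′)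
      link⁻ (leaf i k) (rim 0F)   e = contradiction (leaf-near i k) (no-near a-near (Adj-sym e))
      link⁻ (leaf i k) (rim 3F)   e = contradiction (leaf-near i k) (no-near b-near (Adj-sym e))
      link⁻ (leaf i k) (rim 1F)   e = ⊥-elim (leaf-not-far i k far-x e)
      link⁻ (leaf i k) (rim 2F)   e = ⊥-elim (leaf-not-far i k far-y e)
      link⁻ (rim 0F)   (leaf i k) e = contradiction (leaf-near i k) (no-near a-near e)
      link⁻ (rim 0F)   (rim 0F)   e = contradiction e (Adj-irr refl)
      link⁻ (rim 0F)   (rim 3F)   e = contradiction ub (no-near a-near e)
      link⁻ (rim 0F)   (rim 1F)   e = fwd (next 0F 1F refl)
      link⁻ (rim 0F)   (rim 2F)   e = contradiction (far-unique a-far ax far-x e far-y) (Adj⇒≢ xy)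
      link⁻ (rim 3F)   (leaf i k) e = contradiction (leaf-near i k) (no-near b-near e)
      link⁻ (rim 3F)   (rim 0F)   e = contradiction ub (no-near a-near (Adj-sym e))
      link⁻ (rim 3F)   (rim 3F)   e = contradiction e (Adj-irr refl)
      link⁻ (rim 3F)   (rim 1F)   e = contradiction (far-unique b-far (Adj-sym yb) far-y e far-x) (Adj⇒≢ (Adj-sym xy))
      link⁻ (rim 3F)   (rim 2F)   e = bwd (next 2F 3F refl)
      link⁻ (rim 1F)   (leaf i k) e = ⊥-elim (leaf-not-far i k far-x (Adj-sym e))
      link⁻ (rim 1F)   (rim 0F)   e = bwd (next 0F 1F refl)
      link⁻ (rim 1F)   (rim 3F)   e = contradiction (far-unique b-far (Adj-sym yb) far-y (Adj-sym e) far-x) (Adj⇒≢ (Adj-sym xy))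
      link⁻ (rim 1F)   (rim 1F)   e = contradiction e (Adj-irr refl)
      link⁻ (rim 1F)   (rim 2F)   e = fwd (next 1F 2F refl)
      link⁻ (rim 2F)   (leaf i k) e = ⊥-elim (leaf-not-far i k far-y (Adj-sym e))
      link⁻ (rim 2F)   (rim 0F)   e = contradiction (far-unique a-far ax far-x (Adj-sym e) far-y) (Adj⇒≢ xy)
      link⁻ (rim 2F)   (rim 3F)   e = fwd (next 2F 3F refl)
      link⁻ (rim 2F)   (rim 1F)   e = bwd (next 1F 2F refl)
      link⁻ (rim 2F)   (rim 2F)   e = contradiction e (Adj-irr refl)

      isomorphism : toGraph ≅ H p 5
      isomorphism = mk↔ₛ′ (λ v → proj₁ (preimage v)) embed
          (λ h → embed-injective (proj₁ (preimage (embed h))) h (proj₂ (preimage (embed h))))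
          (λ v → proj₂ (preimage v))
        , λ v w → mk⇔
          (λ vw → link⁻ (proj₁ (preimage v)) (proj₁ (preimage w))
                    (subst₂ Adj (sym (proj₂ (preimage v))) (sym (proj₂ (preimage w))) vw))
          (λ l → subst₂ Adj (proj₂ (preimage v)) (proj₂ (preimage w)) (unlink l))
        where
        unlink : ∀ {g h} → SymClosure (HLink p 5) g h → Adj (embed g) (embed h)
        unlink (fwd l) = link l
        unlink (bwd l) = Adj-sym (link l)

-- The eigenvector of H and the quartic

module ExtremalSpectrum where

  open CollatzWielandt
  open Roots
  open SignlessLaplacian
  open Counting
  open import Data.Rational.Base
  open import Data.Rational.Properties
  open import Data.Rational.Solver using (module +-*-Solver)
  open import Algebra.Properties.CommutativeMonoid.Sum +-0-commutativeMonoid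
    using () renaming (sum to sumℚ; sum-cong-≗ to sumℚ-cong)
  open ListSum +-0-commutativeMonoid using () renaming (sumL to sumLℚ; ∑-support to sumℚ-support)

  open Real using (ℝ; seq; Eventually)
  open +-*-Solver using (solve; _:=_; _:+_; _:*_; _:-_; :-_; con)

  module HNeighbours (p : ℕ) where
    ℓ : ℕ
    ℓ = (p ℕ.∸ 1) ℕ./ 2

    leaves : Fin 2 → List (HVertex p 5)
    leaves k = tabulate (λ i → leaf i k)

    neighbours : HVertex p 5 → List (HVertex p 5)
    neighbours centre      = rim 0F ∷ rim 3F ∷ leaves 0F ++ leaves 1F
    neighbours (leaf i 0F) = centre ∷ leaf i 1F ∷ []
    neighbours (leaf i 1F) = centre ∷ leaf i 0F ∷ []
    neighbours (rim 0F)    = centre ∷ rim 1F ∷ []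
    neighbours (rim 1F)    = rim 0F ∷ rim 2F ∷ []
    neighbours (rim 2F)    = rim 1F ∷ rim 3F ∷ []
    neighbours (rim 3F)    = rim 2F ∷ centre ∷ []

    neighbours-unique : ∀ g → Unique (neighbours g)
    neighbours-unique centre =
      ((λ ()) ∷ All.++⁺ (rim∉ 0F 0F) (rim∉ 0F 1F)) ∷ All.++⁺ (rim∉ 3F 0F) (rim∉ 3F 1F) ∷
      Unique.++⁺ (leaves-unique 0F) (leaves-unique 1F) disjoint
      where
      rim∉ : ∀ j k → All (rim j ≢_) (leaves k)
      rim∉ j k = All.tabulate⁺ {f = λ i → leaf i k} (λ i ())
      leaves-unique : ∀ k → Unique (leaves k)
      leaves-unique k = Unique.tabulate⁺ {f = λ i → leaf i k} (λ { refl → refl })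
      disjoint : ∀ {v} → ¬ (v ∈ leaves 0F × v ∈ leaves 1F)
      disjoint (∈₀ , ∈₁) with ∈-tabulate⁻ {f = λ i → leaf i 0F} ∈₀ | ∈-tabulate⁻ {f = λ i → leaf i 1F} ∈₁
      ... | i , refl | i′ , ()
    neighbours-unique (leaf i 0F) = ((λ ()) ∷ []) ∷ [] ∷ []
    neighbours-unique (leaf i 1F) = ((λ ()) ∷ []) ∷ [] ∷ []
    neighbours-unique (rim 0F)    = ((λ ()) ∷ []) ∷ [] ∷ []
    neighbours-unique (rim 1F)    = ((λ ()) ∷ []) ∷ [] ∷ []
    neighbours-unique (rim 2F)    = ((λ ()) ∷ []) ∷ [] ∷ []
    neighbours-unique (rim 3F)    = ((λ ()) ∷ []) ∷ [] ∷ []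

    All-neighbours : ∀ g → All (SymClosure (HLink p 5) g) (neighbours g)
    All-neighbours centre = fwd (first 0F refl) ∷ bwd (last 3F refl) ∷
      All.++⁺ (All.tabulate⁺ {f = λ i → leaf i 0F} (λ i → fwd (spoke i 0F)))
              (All.tabulate⁺ {f = λ i → leaf i 1F} (λ i → fwd (spoke i 1F)))
    All-neighbours (leaf i 0F) = bwd (spoke i 0F) ∷ fwd (base i) ∷ []
    All-neighbours (leaf i 1F) = bwd (spoke i 1F) ∷ bwd (base i) ∷ []
    All-neighbours (rim 0F)    = bwd (first 0F refl) ∷ fwd (next 0F 1F refl) ∷ []
    All-neighbours (rim 1F)    = bwd (next 0F 1F refl) ∷ fwd (next 1F 2F refl) ∷ []
    All-neighbours (rim 2F)    = bwd (next 1F 2F refl) ∷ fwd (next 2F 3F refl) ∷ []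
    All-neighbours (rim 3F)    = bwd (next 2F 3F refl) ∷ fwd (last 3F refl) ∷ []

    ∈-neighbours : ∀ {g h} → SymClosure (HLink p 5) g h → h ∈ neighbours g
    ∈-neighbours (fwd (spoke i 0F))      = there (there (∈-++⁺ˡ (∈-tabulate⁺ i)))
    ∈-neighbours (fwd (spoke i 1F))      = there (there (∈-++⁺ʳ (leaves 0F) (∈-tabulate⁺ i)))
    ∈-neighbours (bwd (spoke i 0F))      = here refl
    ∈-neighbours (bwd (spoke i 1F))      = here refl
    ∈-neighbours (fwd (base i))          = there (here refl)
    ∈-neighbours (bwd (base i))          = there (here refl)
    ∈-neighbours (fwd (first 0F _))      = here refl
    ∈-neighbours (bwd (first 0F _))      = here refl
    ∈-neighbours (fwd (next 0F 1F _))    = there (here refl)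
    ∈-neighbours (bwd (next 0F 1F _))    = here refl
    ∈-neighbours (fwd (next 1F 2F _))    = there (here refl)
    ∈-neighbours (bwd (next 1F 2F _))    = here refl
    ∈-neighbours (fwd (next 2F 3F _))    = there (here refl)
    ∈-neighbours (bwd (next 2F 3F _))    = here refl
    ∈-neighbours (fwd (last 3F _))       = there (here refl)
    ∈-neighbours (bwd (last 3F _))       = there (here refl)

  values-small : ∀ x (F : ℝ → ℝ) (φ : ℚ → ℚ) → (∀ z t → seq (F z) t ≡ φ (seq z t)) →
    F x Real.≃ Real.0ℝ → ∀ ε → 0ℚ < ε → Eventually λ t → ∣ φ (seq x t) ∣ < ε
  values-small x F φ pointwise Fx≃0 ε 0<ε =
    let N , close = Fx≃0 ε 0<ε
    in N , λ t N≤t → subst (λ p → ∣ p ∣ < ε) (trans (p-0≡p (seq (F x) t)) (pointwise x t)) (close t N≤t)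

  ≃-from-values : ∀ x y (r : ℕ → ℚ) → (∀ t → seq x t ≡ seq y t - r t) →
    (∀ ε → 0ℚ < ε → Eventually λ t → ∣ r t ∣ < ε) → x Real.≃ y
  ≃-from-values x y r x≡y-r r-small ε 0<ε =
    let N , small = r-small ε 0<ε
    in N , λ t N≤t → subst (_< ε)
      (sym (trans (cong ∣_∣ (trans (cong (_- seq y t) (x≡y-r t)) (cancel (seq y t) (r t)))) (∣-p∣≡∣p∣ (r t))))
      (small t N≤t)
    where
    cancel : ∀ y r → (y - r) - y ≡ - r
    cancel = solve 2 (λ y r → (y :- r) :- y := :- r) refl

  -- Lets an eigenvector be verified term by term over the rationals: at each index `t` the equation
  -- has an exact error `r`, and only its convergence to zero involves limits.
  approximate-eigenvalue : ∀ {n} (R : Real.Matrix n) (M : Fin n → Fin n → ℚ) → (∀ i j t → seq (R i j) t ≡ M i j) →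
    ∀ μ (x : Fin n → ℝ) (r : Fin n → ℕ → ℚ) → ¬ (∀ i → x i Real.≃ Real.0ℝ) →
    (∀ i t → sumℚ (λ j → M i j * seq (x j) t) ≡ seq μ t * seq (x i) t - r i t) →
    (∀ i ε → 0ℚ < ε → Eventually λ t → ∣ r i t ∣ < ε) → Real.IsEigenvalue R μ
  approximate-eigenvalue R M R≡M μ x r x≄0 equation r-small = x , x≄0 , λ i →
    ≃-from-values (Real.sum (λ j → R i j Real.* x j)) (μ Real.* x i) (r i)
      (λ t → trans (seq-sum (λ j → R i j Real.* x j) t)
        (trans (sumℚ-cong (λ j → cong (_* seq (x j) t) (R≡M i j t))) (equation i t)))
      (r-small i)

  sumLℚ-++ : ∀ {A : Set} (X : A → ℚ) L L′ → sumLℚ X (L ++ L′) ≡ sumLℚ X L + sumLℚ X L′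
  sumLℚ-++ X []      L′ = sym (+-identityˡ (sumLℚ X L′))
  sumLℚ-++ X (v ∷ L) L′ = trans (cong (X v +_) (sumLℚ-++ X L L′)) (sym (+-assoc (X v) (sumLℚ X L) (sumLℚ X L′)))

  sumLℚ-constant : ∀ {A : Set} n (X : A → ℚ) c (f : Fin n → A) → (∀ i → X (f i) ≡ c) →
    sumLℚ X (tabulate f) ≡ ι n * c
  sumLℚ-constant zero    X c f h = sym (*-zeroˡ c)
  sumLℚ-constant (suc n) X c f h = begin
    X (f zero) + sumLℚ X (tabulate (λ i → f (suc i)))  ≡⟨ cong₂ _+_ (h zero) (sumLℚ-constant n X c (λ i → f (suc i)) (λ i → h (suc i))) ⟩
    c + ι n * c                                        ≡⟨ cong (_+ ι n * c) (*-identityˡ c) ⟨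
    1ℚ * c + ι n * c                                   ≡⟨ *-distribʳ-+ c 1ℚ (ι n) ⟨
    (1ℚ + ι n) * c                                     ≡⟨ cong (_* c) (ι-+ 1 n) ⟨
    ι (suc n) * c                                      ∎
    where open ≡-Reasoning

  -- Eliminating all other coordinates from the eigenvalue equation for q leaves
  -- the quartic as the residual at the centre; the vector is cleared of
  -- denominators.
  module Eigenvector (p : ℕ) where
    open HNeighbours p

    -- By symmetry both far rim vertices carry one value `r`. Their equation gives `P r` at the rim
    -- ends, the equation of the ends gives `L r` at the centre, and a leaf carries the centre value
    -- divided by `P`. The choice `r = P` clears the denominator.
    P L : ℚ → ℚ
    P q = q - ι 3
    L q = P q * P q + P q - ι 1

    X : ℚ → HVertex p 5 → ℚ
    X q centre     = P q * L q
    X q (leaf _ _) = L q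
    X q (rim 0F)   = P q * P q
    X q (rim 1F)   = P q
    X q (rim 2F)   = P q
    X q (rim 3F)   = P q * P q

    residual : ℕ → ℚ → HVertex p 5 → ℚ
    residual m q centre     = quarticℚ m q
    residual m q (leaf _ _) = 0ℚ
    residual m q (rim _)    = 0ℚ

    degreeℚ : HVertex p 5 → ℚ
    degreeℚ g = sumLℚ (λ _ → 1ℚ) (neighbours g)

    private
      -- The literal zeros and ones reproduce the unfolding of `sumLℚ` over a two-element neighbour
      -- list, so that this identity and the similar ones apply by computation.
      leaf-equation : ∀ q → let l = L q in (1ℚ + (1ℚ + 0ℚ)) * l + (P q * l + (l + 0ℚ)) ≡ q * l - 0ℚ
      leaf-equation = solve 1 (λ q →
        let p = q :- con (ι 3) ; l = p :* p :+ p :- con (ι 1) in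
        (con 1ℚ :+ (con 1ℚ :+ con 0ℚ)) :* l :+ (p :* l :+ (l :+ con 0ℚ)) := q :* l :- con 0ℚ) refl

      end-equation : ∀ q → let r = P q * P q in (1ℚ + (1ℚ + 0ℚ)) * r + (P q * L q + (P q + 0ℚ)) ≡ q * r - 0ℚ
      end-equation = solve 1 (λ q →
        let p = q :- con (ι 3) ; l = p :* p :+ p :- con (ι 1) ; r = p :* p in
        (con 1ℚ :+ (con 1ℚ :+ con 0ℚ)) :* r :+ (p :* l :+ (p :+ con 0ℚ)) := q :* r :- con 0ℚ) refl

      end-equation′ : ∀ q → let r = P q * P q in (1ℚ + (1ℚ + 0ℚ)) * r + (P q + (P q * L q + 0ℚ)) ≡ q * r - 0ℚ
      end-equation′ = solve 1 (λ q →
        let p = q :- con (ι 3) ; l = p :* p :+ p :- con (ι 1) ; r = p :* p in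
        (con 1ℚ :+ (con 1ℚ :+ con 0ℚ)) :* r :+ (p :+ (p :* l :+ con 0ℚ)) := q :* r :- con 0ℚ) refl

      middle-equation : ∀ q → let r = P q * P q in (1ℚ + (1ℚ + 0ℚ)) * P q + (r + (P q + 0ℚ)) ≡ q * P q - 0ℚ
      middle-equation = solve 1 (λ q →
        let p = q :- con (ι 3) ; r = p :* p in
        (con 1ℚ :+ (con 1ℚ :+ con 0ℚ)) :* p :+ (r :+ (p :+ con 0ℚ)) := q :* p :- con 0ℚ) refl

      middle-equation′ : ∀ q → let r = P q * P q in (1ℚ + (1ℚ + 0ℚ)) * P q + (P q + (r + 0ℚ)) ≡ q * P q - 0ℚ
      middle-equation′ = solve 1 (λ q →
        let p = q :- con (ι 3) ; r = p :* p in
        (con 1ℚ :+ (con 1ℚ :+ con 0ℚ)) :* p :+ (p :+ (r :+ con 0ℚ)) := q :* p :- con 0ℚ) refl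

      centre-equation : ∀ n q → let r = P q * P q ; l = L q ; m = ι 3 * (n + 1ℚ) + ι 2 in
        (1ℚ + (1ℚ + (n * 1ℚ + n * 1ℚ))) * (P q * l) + (r + (r + (n * l + n * l))) ≡
        q * (P q * l) -
        ( q * (q * (q * (q * 1ℚ)))
        - (ℤ.+ 2 / 3) * (m + ι 10) * (q * (q * (q * 1ℚ)))
        + (ℤ.+ 2 / 3) * (ι 7 * m + ι 16) * (q * (q * 1ℚ))
        - (ι 10 * m - ι 7) * q
        + (ℤ.+ 4 / 3) * (ι 5 * m - ι 16))
      centre-equation = solve 2 (λ n q →
        let p = q :- con (ι 3) ; l = p :* p :+ p :- con (ι 1) ; r = p :* p
            m = con (ι 3) :* (n :+ con 1ℚ) :+ con (ι 2) in
        (con 1ℚ :+ (con 1ℚ :+ (n :* con 1ℚ :+ n :* con 1ℚ))) :* (p :* l) :+ (r :+ (r :+ (n :* l :+ n :* l))) :=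
        q :* (p :* l) :-
        ( q :* (q :* (q :* (q :* con 1ℚ)))
        :- con (ℤ.+ 2 / 3) :* (m :+ con (ι 10)) :* (q :* (q :* (q :* con 1ℚ)))
        :+ con (ℤ.+ 2 / 3) :* (con (ι 7) :* m :+ con (ι 16)) :* (q :* (q :* con 1ℚ))
        :- (con (ι 10) :* m :- con (ι 7)) :* q
        :+ con (ℤ.+ 4 / 3) :* (con (ι 5) :* m :- con (ι 16)))) refl

      sum-leaves : ∀ (Y : HVertex p 5 → ℚ) c → (∀ i k → Y (leaf i k) ≡ c) →
        sumLℚ Y (leaves 0F ++ leaves 1F) ≡ ι ℓ * c + ι ℓ * c
      sum-leaves Y c Y≡c = trans (sumLℚ-++ Y (leaves 0F) (leaves 1F))
        (cong₂ _+_ (sumLℚ-constant ℓ Y c (λ i → leaf i 0F) (λ i → Y≡c i 0F))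
                   (sumLℚ-constant ℓ Y c (λ i → leaf i 1F) (λ i → Y≡c i 1F)))

    -- A polynomial identity in `q`, valid away from the roots as well. Where the quartic is
    -- non-negative it shows `Q X ≤ q X`, an upper bound on the radius; at a root its residual
    -- vanishes and `X` is an eigenvector. One computation thus serves both inequalities for `H`.
    eigen-equation : ∀ m q → ι m ≡ ι 3 * (ι ℓ + 1ℚ) + ι 2 → ∀ g →
      degreeℚ g * X q g + sumLℚ (X q) (neighbours g) ≡ q * X q g - residual m q g
    eigen-equation m q m≡ (leaf i 0F) = leaf-equation q
    eigen-equation m q m≡ (leaf i 1F) = leaf-equation q
    eigen-equation m q m≡ (rim 0F)    = end-equation q
    eigen-equation m q m≡ (rim 1F)    = middle-equation q
    eigen-equation m q m≡ (rim 2F)    = middle-equation′ q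
    eigen-equation m q m≡ (rim 3F)    = end-equation′ q
    eigen-equation m q m≡ centre      = trans
      (cong₂ (λ d s → (1ℚ + (1ℚ + d)) * (P q * L q) + (P q * P q + (P q * P q + s)))
        (sum-leaves (λ _ → 1ℚ) 1ℚ (λ _ _ → refl)) (sum-leaves (X q) (L q) (λ _ _ → refl)))
      (trans (centre-equation (ι ℓ) q) (cong (λ m → q * (P q * L q) -
        ( q * (q * (q * (q * 1ℚ)))
        - (ℤ.+ 2 / 3) * (m + ι 10) * (q * (q * (q * 1ℚ)))
        + (ℤ.+ 2 / 3) * (ι 7 * m + ι 16) * (q * (q * 1ℚ))
        - (ι 10 * m - ι 7) * q
        + (ℤ.+ 4 / 3) * (ι 5 * m - ι 16))) (sym m≡)))

    1≤P : ∀ q → ι 4 ≤ q → 1ℚ ≤ P q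
    1≤P q 4≤q = +-monoˡ-≤ (- ι 3) 4≤q

    0<P : ∀ q → ι 4 ≤ q → 0ℚ < P q
    0<P q 4≤q = <-≤-trans (positive⁻¹ 1ℚ) (1≤P q 4≤q)

    0<L : ∀ q → ι 4 ≤ q → 0ℚ < L q
    0<L q 4≤q = subst (0ℚ <_) (sym (+-assoc (P q * P q) (P q) (- ι 1)))
      (+-mono-<-≤ (*-pos (0<P q 4≤q) (0<P q 4≤q)) (p≤q⇒0≤q-p {1ℚ} {P q} (1≤P q 4≤q)))

    X-pos : ∀ q → ι 4 ≤ q → ∀ g → 0ℚ < X q g
    X-pos q 4≤q centre     = *-pos (0<P q 4≤q) (0<L q 4≤q)
    X-pos q 4≤q (leaf _ _) = 0<L q 4≤q
    X-pos q 4≤q (rim 0F)   = *-pos (0<P q 4≤q) (0<P q 4≤q)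
    X-pos q 4≤q (rim 1F)   = 0<P q 4≤q
    X-pos q 4≤q (rim 2F)   = 0<P q 4≤q
    X-pos q 4≤q (rim 3F)   = *-pos (0<P q 4≤q) (0<P q 4≤q)

    residual-elim : (Q : ℚ → Set) → ∀ m q → Q 0ℚ → Q (quarticℚ m q) → ∀ g → Q (residual m q g)
    residual-elim Q m q Q0 Qf centre     = Qf
    residual-elim Q m q Q0 Qf (leaf _ _) = Q0
    residual-elim Q m q Q0 Qf (rim _)    = Q0

    Pℝ Lℝ : ℝ → ℝ
    Pℝ q = q Real.- Real.fromℕ 3
    Lℝ q = Pℝ q Real.* Pℝ q Real.+ Pℝ q Real.- Real.fromℕ 1

    Xℝ : ℝ → HVertex p 5 → ℝ
    Xℝ q centre     = Pℝ q Real.* Lℝ q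
    Xℝ q (leaf _ _) = Lℝ q
    Xℝ q (rim 0F)   = Pℝ q Real.* Pℝ q
    Xℝ q (rim 1F)   = Pℝ q
    Xℝ q (rim 2F)   = Pℝ q
    Xℝ q (rim 3F)   = Pℝ q Real.* Pℝ q

    seq-Xℝ : ∀ q g t → seq (Xℝ q g) t ≡ X (seq q t) g
    seq-Xℝ q centre     t = refl
    seq-Xℝ q (leaf _ _) t = refl
    seq-Xℝ q (rim 0F)   t = refl
    seq-Xℝ q (rim 1F)   t = refl
    seq-Xℝ q (rim 2F)   t = refl
    seq-Xℝ q (rim 3F)   t = refl

  module FromIsomorphism (G : FiniteGraph) (p m : ℕ)
                         (m≡ : ι m ≡ ι 3 * (ι ((p ℕ.∸ 1) ℕ./ 2) + 1ℚ) + ι 2)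
                         (iso : FiniteGraph.toGraph G ≅ H p 5) where
    open FiniteGraph G
    open GraphFacts G using (adjacency-1)
    open HNeighbours p
    open Eigenvector p

    to : Fin order → HVertex p 5
    to = Inverse.to (proj₁ iso)

    from : HVertex p 5 → Fin order
    from = Inverse.from (proj₁ iso)

    to-from : ∀ g → to (from g) ≡ g
    to-from = Inverse.strictlyInverseˡ (proj₁ iso)

    from-to : ∀ v → from (to v) ≡ v
    from-to = Inverse.strictlyInverseʳ (proj₁ iso)

    sum-neighbours : ∀ (Y : HVertex p 5 → ℚ) v →
      sumℚ (λ w → ι (adjacency v w) * Y (to w)) ≡ sumLℚ Y (neighbours (to v))
    sum-neighbours Y v = trans
      (sumℚ-support (map from (neighbours (to v))) (λ w → ι (adjacency v w) * Y (to w))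
        (Unique.map⁺ (λ {g} {h} e → trans (sym (to-from g)) (trans (cong to e) (to-from h))) (neighbours-unique (to v)))
        supported)
      (values (All-neighbours (to v)))
      where
      supported : ∀ w → w ∈ map from (neighbours (to v)) ⊎ ι (adjacency v w) * Y (to w) ≡ 0ℚ
      supported w with adj? v w
      ... | yes vw = inj₁ (subst (_∈ map from (neighbours (to v))) (from-to w)
                       (∈-map⁺ from (∈-neighbours (Equivalence.to (proj₂ iso v w) vw))))
      ... | no  _  = inj₂ (*-zeroˡ (Y (to w)))
      values : ∀ {M} → All (SymClosure (HLink p 5) (to v)) M →
        sumLℚ (λ w → ι (adjacency v w) * Y (to w)) (map from M) ≡ sumLℚ Y M
      values []             = refl
      values {g ∷ M} (l ∷ ls) = cong₂ _+_
        (trans (cong₂ (λ A h → ι A * Y h)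
          (adjacency-1 (Equivalence.from (proj₂ iso v (from g)) (subst (SymClosure (HLink p 5) (to v)) (sym (to-from g)) l)))
          (to-from g)) (*-identityˡ (Y g)))
        (values ls)

    ι-degree : ∀ v → ι (degree v) ≡ degreeℚ (to v)
    ι-degree v = begin
      ι (degree v)                              ≡⟨ sumℚ-ι (adjacency v) ⟨
      sumℚ (λ w → ι (adjacency v w))            ≡⟨ sumℚ-cong (λ w → *-identityʳ (ι (adjacency v w))) ⟨
      sumℚ (λ w → ι (adjacency v w) * 1ℚ)       ≡⟨ sum-neighbours (λ _ → 1ℚ) v ⟩
      degreeℚ (to v)                            ∎
      where open ≡-Reasoning

    eigen-residual : ∀ q v →
      ι (degree v) * X q (to v) + sumℚ (λ w → ι (adjacency v w) * X q (to w)) ≡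
      q * X q (to v) - residual m q (to v)
    eigen-residual q v = trans
      (cong₂ (λ d s → d * X q (to v) + s) (ι-degree v) (sum-neighbours (X q) v))
      (eigen-equation m q m≡ (to v))

    -- The residual is subtracted, so a non-negative quartic makes the vector `X μ` subinvariant;
    -- `4 ≤ μ` gives `P ≥ 1` and thereby positive weights.
    spectralRadius≤quartic : ∀ μ → ι 4 ≤ μ → 0ℚ ≤ quarticℚ m μ →
      ∀ q → IsSignlessLaplacianSpectralRadius q → q Real.≤ Real.fromℚ μ
    spectralRadius≤quartic μ 4≤μ 0≤f = spectralRadius≤ G (λ v → X μ (to v)) (λ v → X-pos μ 4≤μ (to v))
      μ (≤-trans (ι-nonNeg 4) 4≤μ)
      (λ v → subst (_≤ μ * X μ (to v)) (sym (eigen-residual μ v))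
        (0≤q-p⇒p≤q {μ * X μ (to v) - residual m μ (to v)} {μ * X μ (to v)}
          (subst (0ℚ ≤_) (cancel (residual m μ (to v)) (μ * X μ (to v))) (residual-elim (0ℚ ≤_) m μ ≤-refl 0≤f (to v)))))
      where
      cancel : ∀ r x → r ≡ x - (x - r)
      cancel = solve 2 (λ r x → r := x :- (x :- r)) refl

    root-isEigenvalue : ∀ q → quartic m q Real.≃ Real.0ℝ → Real.fromℚ (ι 4) Real.≤ q →
      Real.IsEigenvalue (FiniteGraph.signlessLaplacian G) q
    root-isEigenvalue q root 4≤q = approximate-eigenvalue (FiniteGraph.signlessLaplacian G) (signlessLaplacianℚ G)
      (signlessLaplacian-entries G) q x (λ v t → residual m (seq q t) (to v)) nonzero equation
      (λ v ε 0<ε →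
        let N , small = values-small q (quartic m) (quarticℚ m) (quartic-pointwise m) root ε 0<ε
        in N , λ t N≤t → residual-elim (λ r → ∣ r ∣ < ε) m (seq q t) 0<ε (small t N≤t) (to v))
      where
      x : Fin (FiniteGraph.order G) → ℝ
      x v = Xℝ q (to v)
      equation : ∀ v t → sumℚ (λ w → signlessLaplacianℚ G v w * seq (x w) t) ≡
        seq q t * seq (x v) t - residual m (seq q t) (to v)
      equation v t = begin
        sumℚ (λ w → signlessLaplacianℚ G v w * seq (x w) t)
          ≡⟨ sumℚ-cong (λ w → cong (signlessLaplacianℚ G v w *_) (seq-Xℝ q (to w) t)) ⟩
        sumℚ (λ w → signlessLaplacianℚ G v w * X (seq q t) (to w))
          ≡⟨ signlessLaplacianℚ-apply G (λ w → X (seq q t) (to w)) v ⟩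
        ι (degree v) * X (seq q t) (to v) + sumℚ (λ w → ι (adjacency v w) * X (seq q t) (to w))
          ≡⟨ eigen-residual (seq q t) v ⟩
        seq q t * X (seq q t) (to v) - residual m (seq q t) (to v)
          ≡⟨ cong (λ s → seq q t * s - residual m (seq q t) (to v)) (seq-Xℝ q (to v) t) ⟨
        seq q t * seq (x v) t - residual m (seq q t) (to v) ∎
        where open ≡-Reasoning
      nonzero : ¬ (∀ v → x v Real.≃ Real.0ℝ)
      -- The coordinate at `rim 1F` is `q − 3`, which is at least 1 because `4 ≤ q`. A tolerance of
      -- `½` on each side is enough to separate it from zero.
      nonzero all-zero =
        let a , large = 4≤q ½ (positive⁻¹ ½)
            b , small = all-zero (from (rim 1F)) ½ (positive⁻¹ ½)
        in absurd (seq q (a ℕ.⊔ b)) (large (a ℕ.⊔ b) (ℕ.m≤m⊔n a b))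
             (subst (λ g → ∣ seq (Xℝ q g) (a ℕ.⊔ b) - 0ℚ ∣ < ½) (to-from (rim 1F)) (small (a ℕ.⊔ b) (ℕ.m≤n⊔m a b)))
        where
        absurd : ∀ s → ι 4 < s + ½ → ¬ (∣ P s - 0ℚ ∣ < ½)
        absurd s 4<s+½ P<½ = <-irrefl refl (begin-strict
          ι 4               <⟨ 4<s+½ ⟩
          s + ½             ≡⟨ solve 1 (λ s → s :+ con ½ := (s :- con (ι 3)) :- con 0ℚ :+ (con (ι 3) :+ con ½)) refl s ⟩
          P s - 0ℚ + (ι 3 + ½)     ≤⟨ +-monoˡ-≤ (ι 3 + ½) (p≤∣p∣ (P s - 0ℚ)) ⟩
          ∣ P s - 0ℚ ∣ + (ι 3 + ½) <⟨ +-monoˡ-< (ι 3 + ½) P<½ ⟩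
          ι 4               ∎)
          where open ≤-Reasoning

-- Comparison of the radius with the largest root

module Comparison where

  open CollatzWielandt
  open Roots
  open SignlessLaplacian
  open Inequalities
  open ExtremalSpectrum
  open import Data.Rational.Base
  open import Data.Rational.Properties
  open import Data.Rational.Solver using (module +-*-Solver)

  open Real using (ℝ; seq)
  open +-*-Solver using (solve; _:=_; _:+_; _:*_; _:-_; :-_; con)

  ≤ℝ-trans : ∀ x y z → x Real.≤ y → y Real.≤ z → x Real.≤ z
  ≤ℝ-trans x y z x≤y y≤z e 0<e =
    let M , x< = x≤y (e * ½) (Real.half-pos 0<e)
        N , y< = y≤z (e * ½) (Real.half-pos 0<e)
    in M ℕ.⊔ N , λ t ≤t → begin-strict
      seq x t                     <⟨ x< t (ℕ.m⊔n≤o⇒m≤o M N ≤t) ⟩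
      seq y t + e * ½             <⟨ +-monoˡ-< (e * ½) (y< t (ℕ.m⊔n≤o⇒n≤o M N ≤t)) ⟩
      seq z t + e * ½ + e * ½     ≡⟨ +-assoc (seq z t) (e * ½) (e * ½) ⟩
      seq z t + (e * ½ + e * ½)   ≡⟨ cong (seq z t +_) (Real.half+half e) ⟩
      seq z t + e                 ∎
    where open ≤-Reasoning

  ≤ℝ-antisym : ∀ x y → x Real.≤ y → y Real.≤ x → x Real.≃ y
  ≤ℝ-antisym x y x≤y y≤x e 0<e =
    let M , x< = x≤y e 0<e
        N , y< = y≤x e 0<e
    in M ℕ.⊔ N , λ t ≤t → close (seq x t) (seq y t) (x< t (ℕ.m⊔n≤o⇒m≤o M N ≤t)) (y< t (ℕ.m⊔n≤o⇒n≤o M N ≤t))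
    where
    close : ∀ p q → p < q + e → q < p + e → ∣ p - q ∣ < e
    close p q p< q< = ∣p∣<e
      (0<q-p⇒p<q (subst (0ℚ <_) (solve 3 (λ p q e → p :+ e :- q := p :- q :- :- e) refl p q e) (p<q⇒0<q-p {q} {p + e} q<)))
      (0<q-p⇒p<q (subst (0ℚ <_) (solve 3 (λ p q e → q :+ e :- p := e :- (p :- q)) refl p q e) (p<q⇒0<q-p {p} {q + e} p<)))

  ≃⇒≥ : ∀ x y → x Real.≃ y → y Real.≤ x
  ≃⇒≥ x y x≃y e 0<e = let N , close = x≃y e 0<e
    in N , λ t N≤t → ∣p-q∣<e⇒q<p+e {seq x t} {seq y t} (close t N≤t)

  ≃-trans : ∀ x y z → x Real.≃ y → y Real.≃ z → x Real.≃ z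
  ≃-trans x y z x≃y y≃z e 0<e =
    let M , xy = x≃y (e * ½) (Real.half-pos 0<e)
        N , yz = y≃z (e * ½) (Real.half-pos 0<e)
    in M ℕ.⊔ N , λ t ≤t → subst (∣ seq x t - seq z t ∣ <_) (Real.half+half e)
         (∣-∣-triangle {seq x t} {seq y t} {seq z t} (xy t (ℕ.m⊔n≤o⇒m≤o M N ≤t)) (yz t (ℕ.m⊔n≤o⇒n≤o M N ≤t)))

  negative⇒not-root : ∀ m μ → quarticℚ m μ < 0ℚ → ¬ quartic m (Real.fromℚ μ) Real.≃ Real.0ℝ
  negative⇒not-root m μ f<0 root =
    let N , small = values-small (Real.fromℚ μ) (quartic m) (quarticℚ m) (quartic-pointwise m) root
                      (- quarticℚ m μ) (neg-antimono-< f<0)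
    in <-irrefl refl (≤-<-trans (p≤∣p∣ (- quarticℚ m μ))
         (subst (_< - quarticℚ m μ) (sym (∣-p∣≡∣p∣ (quarticℚ m μ))) (small N ℕ.≤-refl)))

  quartic-numerator : ∀ κ d x →
    ( x * (x * (x * (x * 1ℚ)))
    - (ℤ.+ 2 / 3) * ((ι 3 * κ + ι 2) + ι 10) * (x * (x * (x * 1ℚ)))
    + (ℤ.+ 2 / 3) * (ι 7 * (ι 3 * κ + ι 2) + ι 16) * (x * (x * 1ℚ))
    - (ι 10 * (ι 3 * κ + ι 2) - ι 7) * x
    + (ℤ.+ 4 / 3) * (ι 5 * (ι 3 * κ + ι 2) - ι 16)) * (d * d * d * d)
    ≡ ((d * x) * (d * x) * (d * x) * (d * x) + (ι 14 * κ + ι 20) * (d * x) * (d * x) * d * d + ι 20 * κ * d * d * d * d)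
    - ((ι 2 * κ + ι 8) * (d * x) * (d * x) * (d * x) * d + (ι 30 * κ + ι 13) * (d * x) * d * d * d + ι 8 * d * d * d * d)
  quartic-numerator = solve 3 (λ κ d x →
    let m = con (ι 3) :* κ :+ con (ι 2) ; n = d :* x in
    ( x :* (x :* (x :* (x :* con 1ℚ)))
    :- con (ℤ.+ 2 / 3) :* (m :+ con (ι 10)) :* (x :* (x :* (x :* con 1ℚ)))
    :+ con (ℤ.+ 2 / 3) :* (con (ι 7) :* m :+ con (ι 16)) :* (x :* (x :* con 1ℚ))
    :- (con (ι 10) :* m :- con (ι 7)) :* x
    :+ con (ℤ.+ 4 / 3) :* (con (ι 5) :* m :- con (ι 16))) :* (d :* d :* d :* d)
    := (n :* n :* n :* n :+ (con (ι 14) :* κ :+ con (ι 20)) :* n :* n :* d :* d :+ con (ι 20) :* κ :* d :* d :* d :* d)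
    :- ((con (ι 2) :* κ :+ con (ι 8)) :* n :* n :* n :* d :+ (con (ι 30) :* κ :+ con (ι 13)) :* n :* d :* d :* d :+ con (ι 8) :* d :* d :* d :* d))
    refl

  module Threshold (j m : ℕ) (m≡ : m ≡ 3 ℕ.* (j ℕ.+ 6) ℕ.+ 2) where
    k : ℕ
    k = j ℕ.+ 6

    ιm≡ : ι m ≡ ι 3 * ι k + ι 2
    ιm≡ = trans (cong ι m≡) (trans (ι-+ (3 ℕ.* k) 2) (cong (_+ ι 2) (ι-* 3 k)))

    -- At the fraction `N / D` the sign of the quartic becomes a comparison of two natural numbers
    -- after multiplication by `D⁴`.
    quarticℚ-scaled : ∀ N D x → ι D * x ≡ ι N →
      quarticℚ m x * (ι D * ι D * ι D * ι D) ≡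
      ι (evalℕ quartic⁺ (k ∷ D ∷ N ∷ [])) - ι (evalℕ quartic⁻ (k ∷ D ∷ N ∷ []))
    quarticℚ-scaled N D x Dx≡N = begin
      quarticℚ m x * (ι D * ι D * ι D * ι D)
        ≡⟨ cong (λ n → ( x * (x * (x * (x * 1ℚ)))
           - (ℤ.+ 2 / 3) * (n + ι 10) * (x * (x * (x * 1ℚ)))
           + (ℤ.+ 2 / 3) * (ι 7 * n + ι 16) * (x * (x * 1ℚ))
           - (ι 10 * n - ι 7) * x
           + (ℤ.+ 4 / 3) * (ι 5 * n - ι 16)) * (ι D * ι D * ι D * ι D)) ιm≡ ⟩
      _ ≡⟨ quartic-numerator (ι k) (ι D) x ⟩
      _ ≡⟨ cong (λ n → evalℚ quartic⁺ (ι k ∷ ι D ∷ n ∷ []) - evalℚ quartic⁻ (ι k ∷ ι D ∷ n ∷ [])) Dx≡N ⟩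
      evalℚ quartic⁺ (ι k ∷ ι D ∷ ι N ∷ []) - evalℚ quartic⁻ (ι k ∷ ι D ∷ ι N ∷ [])
        ≡⟨ cong₂ _-_ (ι-eval quartic⁺ (k ∷ D ∷ N ∷ [])) (ι-eval quartic⁻ (k ∷ D ∷ N ∷ [])) ⟨
      ι (evalℕ quartic⁺ (k ∷ D ∷ N ∷ [])) - ι (evalℕ quartic⁻ (k ∷ D ∷ N ∷ [])) ∎
      where open ≡-Reasoning

    private
      D N : ℕ
      D = den k
      N = num k

      0<D : 0 ℕ.< D
      0<D = ℕ.m≤n+m 1 (5 ℕ.* k)

      0<D⁴ : 0ℚ < ι D * ι D * ι D * ι D
      0<D⁴ = *-pos (*-pos (*-pos (ι-pos D 0<D) (ι-pos D 0<D)) (ι-pos D 0<D)) (ι-pos D 0<D)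

      threshold : ∃[ μ ] 0ℚ < μ × ι D * μ ≡ ι N
      threshold = Real.shrink (ι D) (ι N) (ι-pos D 0<D) (ι-pos N (ℕ.≤-trans (ℕ.s≤s ℕ.z≤n) (ℕ.m≤n+m 5 ((2 ℕ.* k ℕ.+ 1) ℕ.* D))))

    μ : ℚ
    μ = proj₁ threshold

    Dμ≡N : ι D * μ ≡ ι N
    Dμ≡N = proj₂ (proj₂ threshold)

    quartic-μ<0 : quarticℚ m μ < 0ℚ
    quartic-μ<0 = *-cancelʳ-<-nonNeg (ι D * ι D * ι D * ι D) {{nonNegative (<⇒≤ 0<D⁴)}}
      (subst₂ _<_ (sym (quarticℚ-scaled N D μ Dμ≡N)) (sym (*-zeroˡ (ι D * ι D * ι D * ι D)))
        (p<q⇒p-q<0 (ι-mono-< (evalℕ quartic⁺ (k ∷ D ∷ N ∷ [])) (evalℕ quartic⁻ (k ∷ D ∷ N ∷ [])) (quartic-negative-at-threshold j))))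
      where
      p<q⇒p-q<0 : ∀ {p q} → p < q → p - q < 0ℚ
      p<q⇒p-q<0 {p} {q} p<q = subst (p - q <_) (+-inverseʳ q) (+-monoˡ-< (- q) p<q)

    0≤quartic-μ+1 : 0ℚ ≤ quarticℚ m (μ + 1ℚ)
    0≤quartic-μ+1 = *-cancelʳ-≤-pos (ι D * ι D * ι D * ι D) {{positive 0<D⁴}}
      (subst₂ _≤_ (sym (*-zeroˡ (ι D * ι D * ι D * ι D))) (sym (quarticℚ-scaled (N ℕ.+ D) D (μ + 1ℚ) scaled))
        (p≤q⇒0≤q-p {ι (evalℕ quartic⁻ (k ∷ D ∷ N ℕ.+ D ∷ []))} {ι (evalℕ quartic⁺ (k ∷ D ∷ N ℕ.+ D ∷ []))}
          (ι-mono-≤ (evalℕ quartic⁻ (k ∷ D ∷ N ℕ.+ D ∷ [])) (evalℕ quartic⁺ (k ∷ D ∷ N ℕ.+ D ∷ []))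
            (quartic-nonNegative-beyond-threshold j))))
      where
      scaled : ι D * (μ + 1ℚ) ≡ ι (N ℕ.+ D)
      scaled = trans (*-distribˡ-+ (ι D) μ 1ℚ) (trans (cong₂ _+_ Dμ≡N (*-identityʳ (ι D))) (sym (ι-+ N D)))

    4≤μ : ι 4 ≤ μ
    4≤μ = *-cancelˡ-≤-pos (ι D) {{positive (ι-pos D 0<D)}}
      (subst₂ _≤_ (ι-* D 4) (sym Dμ≡N) (ι-mono-≤ (D ℕ.* 4) N D*4≤N))
      where
      open ℕ.≤-Reasoning
      D*4≤N : D ℕ.* 4 ℕ.≤ N
      D*4≤N = begin
        D ℕ.* 4                        ≡⟨ ℕ.*-comm D 4 ⟩
        4 ℕ.* D                        ≤⟨ ℕ.*-monoˡ-≤ D (ℕ.≤-trans (ℕ.≤-trans (ℕ.m≤n+m 4 2) (ℕ.m≤n+m 6 j)) (ℕ.≤-trans (ℕ.m≤m+n k (k ℕ.+ 0)) (ℕ.m≤m+n (2 ℕ.* k) 1))) ⟩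
        (2 ℕ.* k ℕ.+ 1) ℕ.* D          ≤⟨ ℕ.m≤m+n ((2 ℕ.* k ℕ.+ 1) ℕ.* D) 5 ⟩
        N                              ∎

    open Bisection (quartic m) (quarticℚ m) (quartic-pointwise m) μ quartic-μ<0 0≤quartic-μ+1 public

    module _ (q′ : ℝ) (largest : Real.IsLargestRoot (quartic m) q′) where

      root≤q′ : root Real.≤ q′
      root≤q′ = proj₂ largest root root-isRoot

      μ≤q′ : Real.fromℚ μ Real.≤ q′
      μ≤q′ = ≤ℝ-trans (Real.fromℚ μ) root q′ lo≤root root≤q′

      -- The source of strictness for competitors: by continuity, a real equal to `q′` is also a
      -- root, but the quartic is negative at `μ`.
      μ≄q′ : ¬ Real.fromℚ μ Real.≃ q′
      μ≄q′ μ≃q′ = negative⇒not-root m μ quartic-μ<0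
        (≃-trans (quartic m (Real.fromℚ μ)) (quartic m q′) Real.0ℝ
          (pointwise-cong (Real.fromℚ μ) q′ μ≃q′ (quartic m) (quarticℚ m) (quartic-pointwise m))
          (proj₁ largest))

      module _ (G : FiniteGraph) (q : ℝ) (radius : FiniteGraph.IsSignlessLaplacianSpectralRadius G q) where

        below : q Real.≤ Real.fromℚ μ → q Real.≤ q′ × ¬ q Real.≃ q′
        below q≤μ = ≤ℝ-trans q (Real.fromℚ μ) q′ q≤μ μ≤q′ , λ q≃q′ → μ≄q′ (≤ℝ-antisym (Real.fromℚ μ) q′ μ≤q′
          (≤ℝ-trans q′ q (Real.fromℚ μ) (≃⇒≥ q q′ q≃q′) q≤μ))

        subinvariant⇒below : ∀ y → (∀ v → 0 ℕ.< y v) → Subinvariant G N D y → q Real.≤ q′ × ¬ q Real.≃ q′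
        subinvariant⇒below y y>0 sub = below (subinvariant⇒spectralRadius≤ G N D μ 0<D Dμ≡N y y>0 sub q radius)

        module _ (p : ℕ) (ℓ≡ : (p ℕ.∸ 1) ℕ./ 2 ≡ j ℕ.+ 5) (iso : FiniteGraph.toGraph G ≅ H p 5) where

          private
            ιk≡ : ι k ≡ ι ((p ℕ.∸ 1) ℕ./ 2) + 1ℚ
            ιk≡ = trans (cong ι (sym (ℕ.+-assoc j 5 1))) (trans (ι-+ (j ℕ.+ 5) 1) (cong (λ l → ι l + 1ℚ) (sym ℓ≡)))
            module Iso = FromIsomorphism G p m (trans ιm≡ (cong (λ κ → ι 3 * κ + ι 2) ιk≡)) iso

          -- The quartic is non-negative at each upper bisection endpoint, so `X` is a certificate
          -- there and `q` lies below that endpoint. In the limit `q ≤ root`, and `q′` is at least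
          -- every root.
          q≤q′ : q Real.≤ q′
          q≤q′ = ≤ℝ-trans q root q′
            (≤root q (λ n → Iso.spectralRadius≤quartic (upper n)
              (≤-trans 4≤μ (≤-trans (≤lower 0 n ℕ.z≤n) (lower≤upper n))) (0≤φupper n) q radius))
            root≤q′

          -- `q′` is an eigenvalue, with an eigenvector that is nonzero because `q′ ≥ μ ≥ 4`, and
          -- `q` is the largest eigenvalue.
          q′≤q : q′ Real.≤ q
          q′≤q = proj₂ radius q′ (Iso.root-isEigenvalue q′ (proj₁ largest)
            (≤ℝ-trans (Real.fromℚ (ι 4)) (Real.fromℚ μ) q′ 4≤ℝμ μ≤q′))
            where
            4≤ℝμ : Real.fromℚ (ι 4) Real.≤ Real.fromℚ μ
            4≤ℝμ e 0<e = 0 , λ _ _ → ≤-<-trans 4≤μ (subst (_< μ + e) (+-identityʳ μ) (+-monoʳ-< μ 0<e))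

          q≃q′ : q Real.≃ q′
          q≃q′ = ≤ℝ-antisym q q′ q≤q′ q′≤q

-- Degree bound, case distinction and the theorem

module Conclusion where

  open Inequalities
  open SignlessLaplacian using (Subinvariant)
  open Counting
  open Neighbourhood
  open Weights
  open ExtremalGraph
  open Comparison
  open import Data.Nat.Base
  open import Data.Nat.DivMod using (m*n/n≡m)
  open import Data.Nat.Properties
  open import Data.Nat.Solver using (module +-*-Solver)
  open import Relation.Binary.Construct.Closure.ReflexiveTransitive using (Star; ε; _◅_)
  open import Algebra.Properties.CommutativeMonoid.Sum +-0-commutativeMonoid using (sum)
  open +-*-Solver using (solve; _:=_; _:+_; _:*_; con)

  module _ (G : FiniteGraph) where
    open GraphFacts G

    -- Connectivity rules out isolated vertices: as there is an edge, some vertex `w` has positive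
    -- degree, and a walk from `v` to `w` either is empty or starts with an edge at `v`. Without
    -- pendant vertices all degrees are then at least 2.
    positive-degree : Connected → 0 < size → ∀ v → 0 < degree v
    positive-degree connected 0<size v = leaving (connected v w)
      where
      non-isolated : ∃[ w ] 0 < degree w
      non-isolated = sum>0⇒∃ degree (subst (0 <_) (sym handshake) (≤-trans 0<size (m≤m+n size (size + 0))))
      w = proj₁ non-isolated
      leaving : ∀ {v} → Star Adj v w → 0 < degree v
      leaving ε            = proj₂ non-isolated
      leaving {v} (_◅_ {j = x} vx _) = ≤-trans (≤-reflexive (sym (adjacency-1 vx))) (term≤sum (adjacency v) x)

    module _ (j : ℕ) (size≡ : size ≡ 3 * (j + 6) + 2) (2≤degree : ∀ v → 2 ≤ degree v)
             (noDiamond : ThetaFree.NoDiamond G) (noHouse : ThetaFree.NoHouse G) where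

      module _ (u : Fin order) where
        open Charges G u
        open Structure G u 2≤degree noDiamond noHouse

        degree-charge : 3 * degree u + sum charge ≡ 6 * (j + 6) + 4
        degree-charge = trans (sym (sum-charge 2≤degree)) (trans handshake (trans (cong (2 *_) size≡) (double j)))
          where
          double : ∀ j → 2 * (3 * (j + 6) + 2) ≡ 6 * (j + 6) + 4
          double = solve 1 (λ j → con 2 :* (con 3 :* (j :+ con 6) :+ con 2) := con 6 :* (j :+ con 6) :+ con 4) refl

        -- With `degree u = 2k + 1 + c` the charge equation becomes `3c + Σ charge = 1`, so `c = 0`
        -- and the total charge is 1, which is impossible.
        degree≤2k : degree u ≤ 2 * (j + 6)
        degree≤2k = ≮⇒≥ (λ 2k<d → excluded (m≤n⇒∃[o]m+o≡n 2k<d))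
          where
          balance : ∀ j c e → 3 * (suc (2 * (j + 6)) + c) + e ≡ 6 * (j + 6) + (3 + (3 * c + e))
          balance = solve 3 (λ j c e → con 3 :* (con 1 :+ con 2 :* (j :+ con 6) :+ c) :+ e
            := con 6 :* (j :+ con 6) :+ (con 3 :+ (con 3 :* c :+ e))) refl
          excluded : ¬ (∃[ c ] suc (2 * (j + 6)) + c ≡ degree u)
          excluded (c , eq) = small c (+-cancelˡ-≡ 3 _ 1 (+-cancelˡ-≡ (6 * (j + 6)) _ 4
            (trans (sym (balance j c (sum charge))) (trans (cong (λ d → 3 * d + sum charge) eq) degree-charge))))
            where
            small : ∀ c → ¬ (3 * c + sum charge ≡ 1)
            small zero    e = charge≢1 e
            small (suc c) e = contradiction
              (≤-trans (*-monoʳ-≤ 3 {1} {suc c} (s≤s z≤n)) (≤-trans (m≤m+n _ _) (≤-reflexive e))) λ { (s≤s ()) }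

        total-charge : degree u ≡ 2 * (j + 6) → sum charge ≡ 4
        total-charge d≡ = +-cancelˡ-≡ (6 * (j + 6)) _ 4
          (trans (trans (six j (sum charge)) (cong (λ d → 3 * d + sum charge) (sym d≡))) degree-charge)
          where
          six : ∀ j e → 6 * (j + 6) + e ≡ 3 * (2 * (j + 6)) + e
          six = solve 2 (λ j e → con 6 :* (j :+ con 6) :+ e := con 3 :* (con 2 :* (j :+ con 6)) :+ e) refl

      SmallWeights : Set
      SmallWeights = ∃[ y ] (∀ v → 0 < y v) × Subinvariant G (num (j + 6)) (den (j + 6)) y

      smallWeights-or-extremal : ∀ p → (p ∸ 1) / 2 ≡ j + 5 → SmallWeights ⊎ toGraph ≅ H p 5
      smallWeights-or-extremal p ℓ≡ with Fin.any? (λ u → 2 * (j + 6) ≤? degree u)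
      ... | no none = inj₁ ((λ v → 7 * degree v ∸ 1)
          , (λ v → ≤-trans (s≤s z≤n) (∸-monoˡ-≤ 1 (*-monoʳ-≤ 7 (2≤degree v))))
          , lowDegree-subinvariant G j size≡ 2≤degree (λ v → ≰⇒> λ 2k≤ → none (v , 2k≤))
              (λ u → Structure.neighbourhood-degrees G u 2≤degree noDiamond noHouse))
      ... | yes (u , 2k≤d) = [ fromSquares , fromCycle ]′ (squares-or-pentagon (total-charge u d≡))
        where
        open Structure G u 2≤degree noDiamond noHouse
        d≡ : degree u ≡ 2 * (j + 6)
        d≡ = ≤-antisym (degree≤2k u) 2k≤d
        fromSquares : Squares → SmallWeights ⊎ toGraph ≅ H p 5
        fromSquares squares = inj₁ (weight G j u 2≤degree noDiamond noHouse d≡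
          , weight-pos G j u 2≤degree noDiamond noHouse d≡
          , squares-subinvariant G j u 2≤degree noDiamond noHouse d≡ squares)
        fromCycle : Pentagon → SmallWeights ⊎ toGraph ≅ H p 5
        fromCycle cycle = inj₂ (isomorphism p (subst Pairs h≡ (proj₂ pairs)))
          where
          open FromPentagon G u 2≤degree noDiamond noHouse cycle
          h = proj₁ pairs
          double : ∀ j → 2 * (j + 6) ≡ 2 + 2 * (j + 5)
          double = solve 1 (λ j → con 2 :* (j :+ con 6) := con 2 :+ con 2 :* (j :+ con 5)) refl
          h≡ : h ≡ (p ∸ 1) / 2
          h≡ = trans (*-cancelˡ-≡ h (j + 5) 2 (+-cancelˡ-≡ 2 (2 * h) (2 * (j + 5))
            (trans (cong (λ x → 2 + (h + x)) (+-identityʳ h))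
              (trans (sym (degree-pairs (proj₂ pairs))) (trans d≡ (double j)))))) (sym ℓ≡)

  -- For `k = j + 6` the friendship part has order `p = 2k − 1`, so both divisions are exact and
  -- there are `k − 1` triangles.
  leaf-pairs : ∀ j → ((2 * (3 * (j + 6) + 2) ∸ 7) / 3 ∸ 1) / 2 ≡ j + 5
  leaf-pairs j = begin
    ((2 * (3 * (j + 6) + 2) ∸ 7) / 3 ∸ 1) / 2
      ≡⟨ cong (λ n → ((n ∸ 7) / 3 ∸ 1) / 2) (three j) ⟩
    (((2 * (j + 5) + 1) * 3 + 7 ∸ 7) / 3 ∸ 1) / 2
      ≡⟨ cong (λ n → (n / 3 ∸ 1) / 2) (m+n∸n≡m ((2 * (j + 5) + 1) * 3) 7) ⟩
    (((2 * (j + 5) + 1) * 3) / 3 ∸ 1) / 2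
      ≡⟨ cong (λ n → (n ∸ 1) / 2) (m*n/n≡m (2 * (j + 5) + 1) 3) ⟩
    (2 * (j + 5) + 1 ∸ 1) / 2
      ≡⟨ cong (_/ 2) (trans (m+n∸n≡m (2 * (j + 5)) 1) (*-comm 2 (j + 5))) ⟩
    ((j + 5) * 2) / 2
      ≡⟨ m*n/n≡m (j + 5) 2 ⟩
    j + 5 ∎
    where
    open ≡-Reasoning
    three : ∀ j → 2 * (3 * (j + 6) + 2) ≡ (2 * (j + 5) + 1) * 3 + 7
    three = solve 1 (λ j → con 2 :* (con 3 :* (j :+ con 6) :+ con 2) := (con 2 :* (j :+ con 5) :+ con 1) :* con 3 :+ con 7) refl

  -- An isomorphism with `H` gives equality in either alternative. The converse is vacuous when
  -- small weights exist, since then `q` differs from `q′`, and otherwise the isomorphism is already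
  -- at hand.
  bound-and-equality : ∀ j m → m ≡ 3 * (j + 6) + 2 → ∀ G → let open FiniteGraph G in
    Connected → ¬ θ (1 ∷ 2 ∷ 2 ∷ []) ⊑ toGraph → ¬ θ (1 ∷ 2 ∷ 3 ∷ []) ⊑ toGraph →
    size ≡ m → (∀ u → ¬ Pendant u) →
    ∀ q q′ → IsSignlessLaplacianSpectralRadius q → Real.IsLargestRoot (quartic m) q′ →
    q Real.≤ q′ × (q Real.≃ q′ ⇔ toGraph ≅ H ((2 * m ∸ 7) / 3) 5)
  bound-and-equality j m m≡ G connected ¬diamond ¬house size≡ ¬pendant q q′ radius largest =
    [ (λ (y , y>0 , sub) → let q≤q′ , q≄q′ = subinvariant⇒below q′ largest G q radius y y>0 sub
                           in q≤q′ , mk⇔ (λ q≃q′ → contradiction q≃q′ q≄q′) equality)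
    , (λ iso → q≤q′ q′ largest G q radius p ℓ≡ iso , mk⇔ (λ _ → iso) equality)
    ]′ (smallWeights-or-extremal G j (trans size≡ m≡) 2≤degree
         (ThetaFree.noDiamond G ¬diamond) (ThetaFree.noHouse G ¬house) p ℓ≡)
    where
    open Threshold j m m≡
    p : ℕ
    p = (2 * m ∸ 7) / 3
    ℓ≡ : (p ∸ 1) / 2 ≡ j + 5
    ℓ≡ = trans (cong (λ m → ((2 * m ∸ 7) / 3 ∸ 1) / 2) m≡) (leaf-pairs j)
    equality : FiniteGraph.toGraph G ≅ H p 5 → q Real.≃ q′
    equality = q≃q′ q′ largest G q radius p ℓ≡
    0<size : 0 < FiniteGraph.size G
    0<size = subst (0 <_) (sym (trans size≡ m≡)) (≤-trans (s≤s z≤n) (m≤n+m 2 (3 * (j + 6))))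
    2≤degree : ∀ v → 2 ≤ FiniteGraph.degree G v
    2≤degree v = ≤∧≢⇒< (positive-degree G connected 0<size v) (λ 1≡d → ¬pendant v (sym 1≡d))

open import Data.Nat.Base using (_+_; _*_; _∸_; _/_; _≤_)

theorem4p2 : ∀ (k m : ℕ) → 6 ≤ k → m ≡ 3 * k + 2 →
    ∀ (G : FiniteGraph) → let open FiniteGraph G in
    Connected →
    ((θ (1 ∷ 2 ∷ 2 ∷ []) ∷ θ (1 ∷ 2 ∷ 3 ∷ []) ∷ []) Free) toGraph →
    size ≡ m →
    (∀ u → ¬ Pendant u) →
    ∀ (q q′ : Real.ℝ) →
    IsSignlessLaplacianSpectralRadius q →
    Real.IsLargestRoot (quartic m) q′ →
    q Real.≤ q′ × (q Real.≃ q′ ⇔ toGraph ≅ H ((2 * m ∸ 7) / 3) 5)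
theorem4p2 k m 6≤k m≡ G connected (¬diamond ∷ ¬house ∷ []) =
  Conclusion.bound-and-equality (k ∸ 6) m
    (trans m≡ (cong (λ k → 3 * k + 2) (sym (ℕ.m∸n+n≡m 6≤k)))) G connected ¬diamond ¬house
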